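{- There exists a constant $C>0$ such that for all integers $r\ge 2$, $d\ge 1$ and every (finite) linear, $r$-uniform, $d$-regular hypergraph $G$ on $n$ vertices with no cross-edges, $$\frac{\log_2 i_r(G)}{n}\;\le\;\frac{r-1}{r}+C\,d^{ -1/(r-1)},$$ where $i_r(G)$ denotes the number of weak independent sets of $G$.
   Context: A hypergraph $G=(V,E)$ consists of a finite vertex set $V$ and a collection $E$ of subsets of $V$ (edges). It is $r$-uniform if every edge has exactly $r$ vertices; the degree of a vertex $v$ is $|\{e\in E: v\in e\}|$, and $G$ is $d$-regular if every vertex has degree $d$. It is linear if each pair of distinct vertices appears in at most one common edge. Two distinct vertices $u,v$ are neighbors if some edge contains both. A cross-edge in the neighborhood of a vertex $v$ is an edge that contains two (distinct) neighbors $u_1,u_2$ of $v$ but not $v$ itself; $G$ has no cross-edges if there is no such edge for any vertex $v$. A weak independent set ($r$-independent set) in an $r$-uniform hypergraph is a set $I\subseteq V$ with $|I\cap e|<r$ for all $e\in E$; $i_r(G)$ is the number of weak independent sets (including the empty set). -}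

module Defs where

open import Data.Empty using (⊥)
open import Data.Fin using (Fin)
open import Data.Fin.Subset using (Subset; inside; outside; _∈_; _∉_; _∩_; ∣_∣)
  renaming (⊥ to ∅)
open import Data.Fin.Subset.Properties using (_∈?_; ∩-zeroˡ; ∣⊥∣≡0)
open import Data.Integer as ℤ using (+_; -[1+_]; +<+; -<+)
import Data.Integer.Properties as ℤ
open import Data.List using (List; []; _∷_; [_]; _++_; map; filter; length)
open import Data.List.Membership.Propositional using () renaming (_∈_ to _∈ˡ_)
open import Data.List.Membership.Propositional.Properties
  using (∈-++⁺ˡ; ∈-++⁺ʳ; ∈-map⁺; ∈-map⁻; ∈-filter⁺)
open import Data.List.Relation.Unary.All as All using (All; all?)
open import Data.List.Relation.Unary.Any using (here; there)
open import Data.List.Relation.Unary.Unique.Propositional using (Unique; []; _∷_)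
open import Data.List.Relation.Unary.Unique.Propositional.Properties as Unique using ()
open import Data.Nat as ℕ using (ℕ; zero; suc; NonZero; NonTrivial; z≤n; s≤s; _∸_; _^_)
import Data.Nat.Properties as ℕ
open import Data.Nat.Tactic.RingSolver using (solve-∀)
open import Data.Product using (∃; ∃-syntax; _×_; _,_; proj₁; proj₂)
open import Data.Rational.Unnormalised as ℚ
  using (ℚᵘ; mkℚᵘ; 0ℚᵘ; Positive; *<*; *≡*; _≃_; _/_; ½; 1/_)
import Data.Rational.Unnormalised.Properties as ℚ
open import Data.Sum using (_⊎_; inj₁; inj₂)
open import Data.Unit using (⊤; tt)
open import Data.Vec using ([]; _∷_)
open import Data.Vec.Properties using (∷-injectiveˡ; ∷-injectiveʳ)
open import Function using (case_of_)
open import Relation.Binary.Definitions using (tri<; tri≈; tri>)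
open import Relation.Binary.PropositionalEquality
  using (_≡_; _≢_; refl; sym; trans; cong; subst; subst₂)
open import Relation.Nullary using (¬_; Dec; yes; no; contradiction)

------------------------------------------------------------------------
-- Hypergraphs on the vertex set Fin n

record Hypergraph (n : ℕ) : Set where
  field
    edges  : List (Subset n)
    unique : Unique edges

open Hypergraph public using (edges)

module _ {n : ℕ} (G : Hypergraph n) where

  Uniform : ℕ → Set
  Uniform r = ∀ e → e ∈ˡ edges G → ∣ e ∣ ≡ r

  degree : Fin n → ℕ
  degree v = length (filter (v ∈?_) (edges G))

  Regular : ℕ → Set
  Regular d = ∀ v → degree v ≡ d

  Linear : Set
  Linear = ∀ u v → u ≢ v → ∀ e f → e ∈ˡ edges G → f ∈ˡ edges G →
           u ∈ e → v ∈ e → u ∈ f → v ∈ f → e ≡ f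

  Neighbours : Fin n → Fin n → Set
  Neighbours u v = u ≢ v × ∃[ e ] e ∈ˡ edges G × u ∈ e × v ∈ e

  CrossEdge : Fin n → Subset n → Set
  CrossEdge v e = e ∈ˡ edges G × v ∉ e ×
    ∃[ u₁ ] ∃[ u₂ ] u₁ ≢ u₂ × Neighbours u₁ v × Neighbours u₂ v × u₁ ∈ e × u₂ ∈ e

  NoCrossEdges : Set
  NoCrossEdges = ∀ v e → ¬ CrossEdge v e

  WeakIndependent : ℕ → Subset n → Set
  WeakIndependent r I = All (λ e → ∣ I ∩ e ∣ ℕ.< r) (edges G)

  weakIndependent? : ∀ r I → Dec (WeakIndependent r I)
  weakIndependent? r I = all? (λ e → ∣ I ∩ e ∣ ℕ.<? r) (edges G)

subsets : ∀ n → List (Subset n)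
subsets zero    = [ [] ]
subsets (suc n) = map (inside ∷_) (subsets n) ++ map (outside ∷_) (subsets n)

∈-subsets : ∀ {n} (p : Subset n) → p ∈ˡ subsets n
∈-subsets []            = here refl
∈-subsets (inside  ∷ p) = ∈-++⁺ˡ (∈-map⁺ (inside ∷_) (∈-subsets p))
∈-subsets (outside ∷ p) = ∈-++⁺ʳ _ (∈-map⁺ (outside ∷_) (∈-subsets p))

subsets-unique : ∀ n → Unique (subsets n)
subsets-unique zero    = All.[] ∷ []
subsets-unique (suc n) = Unique.++⁺
  (Unique.map⁺ ∷-injectiveʳ (subsets-unique n))
  (Unique.map⁺ ∷-injectiveʳ (subsets-unique n))
  λ (p∈ , q∈) → case ∈-map⁻ _ p∈ , ∈-map⁻ _ q∈ of λ
    { ((_ , _ , refl) , (_ , _ , eq)) → case ∷-injectiveˡ eq of λ () }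

weakIndependentSets : ∀ {n} → ℕ → Hypergraph n → List (Subset n)
weakIndependentSets {n} r G = filter (weakIndependent? G r) (subsets n)

i : ∀ {n} → ℕ → Hypergraph n → ℕ
i r G = length (weakIndependentSets r G)

∅-weakIndependent : ∀ {n} (G : Hypergraph n) r .{{_ : NonZero r}} → WeakIndependent G r ∅
∅-weakIndependent {n} G (suc r) = All.universal
  (λ e → subst (ℕ._< suc r) (sym (trans (cong ∣_∣ (∩-zeroˡ e)) (∣⊥∣≡0 n))) (s≤s z≤n)) _

i-nonZero : ∀ {n} r (G : Hypergraph n) .{{_ : NonZero r}} → NonZero (i r G)
i-nonZero {n} r G = nonEmpty
  (∈-filter⁺ (weakIndependent? G r) (∈-subsets ∅) (∅-weakIndependent G r))
  where
  nonEmpty : ∀ {xs : List (Subset n)} {x} → x ∈ˡ xs → NonZero (length xs)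
  nonEmpty (here  _) = _
  nonEmpty (there _) = _

nonTrivial⇒∸1-nonZero : ∀ r → .{{NonTrivial r}} → NonZero (r ∸ 1)
nonTrivial⇒∸1-nonZero (suc (suc r)) = _

------------------------------------------------------------------------
-- Dedekind reals

record ℝ : Set₁ where
  field
    Lower Upper     : ℚᵘ → Set
    lower-inhabited : ∃ Lower
    upper-inhabited : ∃ Upper
    lower-closed    : ∀ {p q} → p ℚ.< q → Lower q → Lower p
    upper-closed    : ∀ {p q} → p ℚ.< q → Upper p → Upper q
    lower-open      : ∀ {p} → Lower p → ∃[ q ] p ℚ.< q × Lower q
    upper-open      : ∀ {q} → Upper q → ∃[ p ] p ℚ.< q × Upper p
    disjoint        : ∀ {p} → Lower p → Upper p → ⊥
    located         : ∀ {p q} → p ℚ.< q → Lower p ⊎ Upper q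

  lower-resp : ∀ {p q} → p ≃ q → Lower p → Lower q
  lower-resp p≃q l with lower-open l
  ... | _ , p<s , l′ = lower-closed (ℚ.<-respˡ-≃ p≃q p<s) l′

  upper-resp : ∀ {p q} → p ≃ q → Upper p → Upper q
  upper-resp p≃q u with upper-open u
  ... | _ , s<p , u′ = upper-closed (ℚ.<-respʳ-≃ p≃q s<p) u′

  lower<upper : ∀ {p q} → Lower p → Upper q → p ℚ.< q
  lower<upper {p} {q} l u with ℚ.<-cmp p q
  ... | tri< p<q _ _ = p<q
  ... | tri≈ _ p≃q _ = contradiction u (disjoint (lower-resp p≃q l))
  ... | tri> _ _ q<p = contradiction u (disjoint (lower-closed q<p l))

open ℝ

infix 4 _≤_

_≤_ : ℝ → ℝ → Set
x ≤ y = ∀ {q} → Lower x q → Lower y q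

fromℚ : ℚᵘ → ℝ
fromℚ s = record
  { Lower           = ℚ._< s
  ; Upper           = s ℚ.<_
  ; lower-inhabited = s ℚ.- ℚ.1ℚᵘ , ℚ.<-respʳ-≃ (ℚ.+-identityʳ s) (ℚ.+-monoʳ-< s (*<* -<+))
  ; upper-inhabited = s ℚ.+ ℚ.1ℚᵘ , ℚ.<-respˡ-≃ (ℚ.+-identityʳ s) (ℚ.+-monoʳ-< s (*<* (+<+ (s≤s z≤n))))
  ; lower-closed    = ℚ.<-trans
  ; upper-closed    = λ p<q s<p → ℚ.<-trans s<p p<q
  ; lower-open      = λ p<s → case ℚ.<-dense p<s of λ (m , p<m , m<s) → m , p<m , m<s
  ; upper-open      = λ s<q → case ℚ.<-dense s<q of λ (m , s<m , m<q) → m , m<q , s<m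
  ; disjoint        = ℚ.<-asym
  ; located         = λ {p} {q} p<q → loc p<q
  }
  where
  loc : ∀ {p q} → p ℚ.< q → p ℚ.< s ⊎ s ℚ.< q
  loc {p} p<q with p ℚ.<? s
  ... | yes p<s = inj₁ p<s
  ... | no  p≮s = inj₂ (ℚ.≤-<-trans (ℚ.≮⇒≥ p≮s) p<q)

private
  cancel-+ : ∀ p a → p ℚ.+ (a ℚ.- p) ≃ a
  cancel-+ p a = begin-equality
    p ℚ.+ (a ℚ.- p)       ≃⟨ ℚ.+-congʳ p (ℚ.+-comm a (ℚ.- p)) ⟩
    p ℚ.+ (ℚ.- p ℚ.+ a)   ≃⟨ ℚ.+-assoc p (ℚ.- p) a ⟨
    (p ℚ.- p) ℚ.+ a       ≃⟨ ℚ.+-congˡ a (ℚ.+-inverseʳ p) ⟩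
    0ℚᵘ ℚ.+ a             ≃⟨ ℚ.+-identityˡ a ⟩
    a                     ∎
    where open ℚ.≤-Reasoning

  cancel-* : ∀ c .{{_ : ℚ.NonZero c}} a → c ℚ.* (1/ c ℚ.* a) ≃ a
  cancel-* c a = begin-equality
    c ℚ.* (1/ c ℚ.* a)   ≃⟨ ℚ.*-assoc c (1/ c) a ⟨
    c ℚ.* 1/ c ℚ.* a     ≃⟨ ℚ.*-congʳ (ℚ.*-inverseʳ c) ⟩
    ℚ.1ℚᵘ ℚ.* a          ≃⟨ ℚ.*-identityˡ a ⟩
    a                    ∎
    where open ℚ.≤-Reasoning

  <-suc∣num∣ : ∀ s → s ℚ.< mkℚᵘ (+ suc ℤ.∣ ℚ.↥ s ∣) 0
  <-suc∣num∣ (mkℚᵘ (+ m) d) = *<* (subst₂ ℤ._<_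
    (ℤ.pos-* m 1) (ℤ.pos-* (suc m) (suc d))
    (+<+ (ℕ.<-≤-trans (subst (ℕ._< suc m) (sym (ℕ.*-identityʳ m)) (ℕ.n<1+n m))
                      (ℕ.m≤m*n (suc m) (suc d)))))
  <-suc∣num∣ (mkℚᵘ -[1+ m ] d) = *<* -<+

  archimedean : ∀ δ .{{_ : Positive δ}} s → ∃[ N ] s ℚ.< mkℚᵘ (+ N) 0 ℚ.* δ
  archimedean δ s = _ , (begin-strict
    s                              ≃⟨ cancel-* δ s ⟨
    δ ℚ.* t                        <⟨ ℚ.*-monoʳ-<-pos δ (<-suc∣num∣ t) ⟩
    δ ℚ.* mkℚᵘ (+ _) 0             ≃⟨ ℚ.*-comm δ (mkℚᵘ (+ _) 0) ⟩
    mkℚᵘ (+ _) 0 ℚ.* δ             ∎)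
    where
    open ℚ.≤-Reasoning
    instance _ = ℚ.pos⇒nonZero δ
    t = 1/ δ ℚ.* s

  p<p+δ : ∀ p δ .{{_ : Positive δ}} → p ℚ.< p ℚ.+ δ
  p<p+δ p δ = ℚ.<-respˡ-≃ (ℚ.+-identityʳ p) (ℚ.+-monoʳ-< p (ℚ.positive⁻¹ δ))

  suc-* : ∀ N δ → mkℚᵘ (+ suc N) 0 ℚ.* δ ≃ δ ℚ.+ mkℚᵘ (+ N) 0 ℚ.* δ
  suc-* N δ = begin-equality
    mkℚᵘ (+ suc N) 0 ℚ.* δ                    ≃⟨ ℚ.*-congʳ {δ} {mkℚᵘ (+ suc N) 0} {ℚ.1ℚᵘ ℚ.+ mkℚᵘ (+ N) 0} (*≡* eq) ⟩
    (ℚ.1ℚᵘ ℚ.+ mkℚᵘ (+ N) 0) ℚ.* δ            ≃⟨ ℚ.*-distribʳ-+ δ ℚ.1ℚᵘ (mkℚᵘ (+ N) 0) ⟩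
    ℚ.1ℚᵘ ℚ.* δ ℚ.+ mkℚᵘ (+ N) 0 ℚ.* δ        ≃⟨ ℚ.+-congˡ _ (ℚ.*-identityˡ δ) ⟩
    δ ℚ.+ mkℚᵘ (+ N) 0 ℚ.* δ                  ∎
    where
    open ℚ.≤-Reasoning
    eq : + suc N ℤ.* + 1 ≡ (+ 1 ℤ.* + 1 ℤ.+ + N ℤ.* + 1) ℤ.* + 1
    eq = cong (ℤ._* + 1) (cong (λ k → + 1 ℤ.+ k) (sym (ℤ.*-identityʳ (+ N))))

  approximate : ∀ x ε → 0ℚᵘ ℚ.< ε →
    ∃[ p ] ∃[ q ] Lower x p × Upper x q × q ℚ.< p ℚ.+ ε
  approximate x ε 0<ε = finish (walk N (proj₂ (lower-inhabited x)) top)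
    where
    open ℚ.≤-Reasoning
    instance
      ε>0 : Positive ε
      ε>0 = ℚ.positive 0<ε
    δ = ½ ℚ.* ε
    instance
      δ>0 : Positive δ
      δ>0 = ℚ.positive (ℚ.<-respˡ-≃ (ℚ.*-zeroʳ ½) (ℚ.*-monoʳ-<-pos ½ 0<ε))
    p₀ = proj₁ (lower-inhabited x)
    q₀ = proj₁ (upper-inhabited x)
    N  = proj₁ (archimedean δ (q₀ ℚ.- p₀))

    top : Upper x (p₀ ℚ.+ mkℚᵘ (+ N) 0 ℚ.* δ)
    top = upper-closed x (begin-strict
      q₀                                ≃⟨ cancel-+ p₀ q₀ ⟨
      p₀ ℚ.+ (q₀ ℚ.- p₀)                <⟨ ℚ.+-monoʳ-< p₀ (proj₂ (archimedean δ (q₀ ℚ.- p₀))) ⟩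
      p₀ ℚ.+ mkℚᵘ (+ N) 0 ℚ.* δ         ∎) (proj₂ (upper-inhabited x))

    walk : ∀ N {p} → Lower x p → Upper x (p ℚ.+ mkℚᵘ (+ N) 0 ℚ.* δ) →
           ∃[ p ] Lower x p × Upper x (p ℚ.+ δ ℚ.+ δ)
    walk zero {p} l u = contradiction
      (upper-resp x (begin-equality
        p ℚ.+ 0ℚᵘ ℚ.* δ   ≃⟨ ℚ.+-congʳ p (ℚ.*-zeroˡ δ) ⟩
        p ℚ.+ 0ℚᵘ         ≃⟨ ℚ.+-identityʳ p ⟩
        p                 ∎) u) (disjoint x l)
    walk (suc N) {p} l u with located x (p<p+δ (p ℚ.+ δ) δ)
    ... | inj₂ u′ = p , l , u′
    ... | inj₁ l′ = walk N l′ (upper-resp x (begin-equality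
        p ℚ.+ mkℚᵘ (+ suc N) 0 ℚ.* δ          ≃⟨ ℚ.+-congʳ p (suc-* N δ) ⟩
        p ℚ.+ (δ ℚ.+ mkℚᵘ (+ N) 0 ℚ.* δ)      ≃⟨ ℚ.+-assoc p δ _ ⟨
        p ℚ.+ δ ℚ.+ mkℚᵘ (+ N) 0 ℚ.* δ        ∎) u)

    finish : ∃[ p ] Lower x p × Upper x (p ℚ.+ δ ℚ.+ δ) →
             ∃[ p ] ∃[ q ] Lower x p × Upper x q × q ℚ.< p ℚ.+ ε
    finish (p , l , u) with lower-open x l
    ... | p′ , p<p′ , l′ = p′ , p ℚ.+ δ ℚ.+ δ , l′ , u , (begin-strict
        p ℚ.+ δ ℚ.+ δ           ≃⟨ ℚ.+-assoc p δ δ ⟩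
        p ℚ.+ (δ ℚ.+ δ)         ≃⟨ ℚ.+-congʳ p (ℚ.*-distribʳ-+ ε ½ ½) ⟨
        p ℚ.+ (½ ℚ.+ ½) ℚ.* ε   ≃⟨ ℚ.+-congʳ p (ℚ.*-congʳ {ε} {½ ℚ.+ ½} {ℚ.1ℚᵘ} (*≡* refl)) ⟩
        p ℚ.+ ℚ.1ℚᵘ ℚ.* ε       ≃⟨ ℚ.+-congʳ p (ℚ.*-identityˡ ε) ⟩
        p ℚ.+ ε                 <⟨ ℚ.+-monoˡ-< ε p<p′ ⟩
        p′ ℚ.+ ε                ∎)

infixl 6 _+_

_+_ : ℝ → ℝ → ℝ
x + y = record
  { Lower           = λ s → ∃[ p ] ∃[ q ] Lower x p × Lower y q × s ℚ.< p ℚ.+ q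
  ; Upper           = λ s → ∃[ p ] ∃[ q ] Upper x p × Upper y q × p ℚ.+ q ℚ.< s
  ; lower-inhabited = li (lower-inhabited x) (lower-inhabited y)
  ; upper-inhabited = ui (upper-inhabited x) (upper-inhabited y)
  ; lower-closed    = λ s<t (p , q , lp , lq , t<) → p , q , lp , lq , ℚ.<-trans s<t t<
  ; upper-closed    = λ s<t (p , q , up , uq , <s) → p , q , up , uq , ℚ.<-trans <s s<t
  ; lower-open      = λ (p , q , lp , lq , s<) → case ℚ.<-dense s< of λ
      (m , s<m , m<) → m , s<m , p , q , lp , lq , m<
  ; upper-open      = λ (p , q , up , uq , <s) → case ℚ.<-dense <s of λ
      (m , <m , m<s) → m , m<s , p , q , up , uq , <m
  ; disjoint        = λ (p , q , lp , lq , s<) (p′ , q′ , up , uq , <s) → ℚ.<-asym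
      (ℚ.<-trans s< (ℚ.+-mono-< (lower<upper x lp up) (lower<upper y lq uq))) <s
  ; located         = loc
  }
  where
  li : ∃ (Lower x) → ∃ (Lower y) →
       ∃[ s ] ∃[ p ] ∃[ q ] Lower x p × Lower y q × s ℚ.< p ℚ.+ q
  li (p , lp) (q , lq) with lower-open x lp
  ... | p′ , p<p′ , lp′ = _ , p′ , q , lp′ , lq , ℚ.+-monoˡ-< q p<p′

  ui : ∃ (Upper x) → ∃ (Upper y) →
       ∃[ s ] ∃[ p ] ∃[ q ] Upper x p × Upper y q × p ℚ.+ q ℚ.< s
  ui (p , up) (q , uq) with upper-open x up
  ... | p′ , p′<p , up′ = _ , p′ , q , up′ , uq , ℚ.+-monoˡ-< q p′<p

  loc : ∀ {a b} → a ℚ.< b →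
        (∃[ p ] ∃[ q ] Lower x p × Lower y q × a ℚ.< p ℚ.+ q) ⊎
        (∃[ p ] ∃[ q ] Upper x p × Upper y q × p ℚ.+ q ℚ.< b)
  loc {a} {b} a<b with approximate x (b ℚ.- a) (ℚ.<-respˡ-≃ (ℚ.+-inverseʳ a) (ℚ.+-monoˡ-< (ℚ.- a) a<b))
  ... | p , p′ , lp , up , p′< with ℚ.<-dense gap
    where
    open ℚ.≤-Reasoning
    gap : a ℚ.- p ℚ.< b ℚ.- p′
    gap = begin-strict
      a ℚ.- p                               ≃⟨ cancel-+ p′ (a ℚ.- p) ⟨
      p′ ℚ.+ (a ℚ.- p ℚ.- p′)               <⟨ ℚ.+-monoˡ-< (a ℚ.- p ℚ.- p′) p′< ⟩
      p ℚ.+ (b ℚ.- a) ℚ.+ (a ℚ.- p ℚ.- p′)  ≃⟨ ℚ.+-assoc (p ℚ.+ (b ℚ.- a)) (a ℚ.- p) (ℚ.- p′) ⟨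
      p ℚ.+ (b ℚ.- a) ℚ.+ (a ℚ.- p) ℚ.- p′  ≃⟨ ℚ.+-congˡ (ℚ.- p′) (begin-equality
        p ℚ.+ (b ℚ.- a) ℚ.+ (a ℚ.- p)       ≃⟨ ℚ.+-congˡ (a ℚ.- p) (ℚ.+-comm p (b ℚ.- a)) ⟩
        b ℚ.- a ℚ.+ p ℚ.+ (a ℚ.- p)         ≃⟨ ℚ.+-assoc (b ℚ.- a) p (a ℚ.- p) ⟩
        b ℚ.- a ℚ.+ (p ℚ.+ (a ℚ.- p))       ≃⟨ ℚ.+-congʳ (b ℚ.- a) (cancel-+ p a) ⟩
        b ℚ.- a ℚ.+ a                       ≃⟨ ℚ.+-comm (b ℚ.- a) a ⟩
        a ℚ.+ (b ℚ.- a)                     ≃⟨ cancel-+ a b ⟩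
        b                                   ∎) ⟩
      b ℚ.- p′                              ∎
  ... | s , a-p<s , s<b-p′ with ℚ.<-dense s<b-p′
  ... | t , s<t , t<b-p′ with located y s<t
  ... | inj₁ ls = inj₁ (p , s , lp , ls , ℚ.<-respˡ-≃ (cancel-+ p a) (ℚ.+-monoʳ-< p a-p<s))
  ... | inj₂ ut = inj₂ (p′ , t , up , ut , ℚ.<-respʳ-≃ (cancel-+ p′ b) (ℚ.+-monoʳ-< p′ t<b-p′))

infixr 7 _·_

_·_ : (c : ℚᵘ) .{{_ : Positive c}} → ℝ → ℝ
c · x = record
  { Lower           = λ s → ∃[ p ] Lower x p × s ℚ.< c ℚ.* p
  ; Upper           = λ s → ∃[ p ] Upper x p × c ℚ.* p ℚ.< s
  ; lower-inhabited = case lower-open x (proj₂ (lower-inhabited x)) of λ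
      (p , q<p , lp) → _ , p , lp , ℚ.*-monoʳ-<-pos c q<p
  ; upper-inhabited = case upper-open x (proj₂ (upper-inhabited x)) of λ
      (p , p<q , up) → _ , p , up , ℚ.*-monoʳ-<-pos c p<q
  ; lower-closed    = λ s<t (p , lp , t<) → p , lp , ℚ.<-trans s<t t<
  ; upper-closed    = λ s<t (p , up , <s) → p , up , ℚ.<-trans <s s<t
  ; lower-open      = λ (p , lp , s<) → case ℚ.<-dense s< of λ
      (m , s<m , m<) → m , s<m , p , lp , m<
  ; upper-open      = λ (p , up , <s) → case ℚ.<-dense <s of λ
      (m , <m , m<s) → m , m<s , p , up , <m
  ; disjoint        = λ (p , lp , s<) (q , uq , <s) → ℚ.<-asym
      (ℚ.<-trans s< (ℚ.*-monoʳ-<-pos c (lower<upper x lp uq))) <s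
  ; located         = loc
  }
  where
  instance _ = ℚ.pos⇒nonZero c
  instance _ = ℚ.pos⇒nonNeg c

  loc : ∀ {a b} → a ℚ.< b →
        (∃[ p ] Lower x p × a ℚ.< c ℚ.* p) ⊎ (∃[ p ] Upper x p × c ℚ.* p ℚ.< b)
  loc {a} {b} a<b with ℚ.<-dense gap
    where
    gap : 1/ c ℚ.* a ℚ.< 1/ c ℚ.* b
    gap = ℚ.*-cancelˡ-<-nonNeg c
      (ℚ.<-respˡ-≃ (ℚ.≃-sym (cancel-* c a)) (ℚ.<-respʳ-≃ (ℚ.≃-sym (cancel-* c b)) a<b))
  ... | s , a/c<s , s<b/c with ℚ.<-dense s<b/c
  ... | t , s<t , t<b/c with located x s<t
  ... | inj₁ ls = inj₁ (s , ls , ℚ.<-respˡ-≃ (cancel-* c a) (ℚ.*-monoʳ-<-pos c a/c<s))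
  ... | inj₂ ut = inj₂ (t , ut , ℚ.<-respʳ-≃ (cancel-* c b) (ℚ.*-monoʳ-<-pos c t<b/c))

infixl 7 _÷ℕ_

_÷ℕ_ : ℝ → (n : ℕ) → .{{NonZero n}} → ℝ
x ÷ℕ (suc n) = (+ 1 / suc n) · x

-- A nonnegative real t described by its comparisons with the fractions
-- m / D (D ≥ 1): m / D < t iff F m < G D, and t < m / D iff G D < F m.
record Comparison : Set where
  field
    F G        : ℕ → ℕ
    F-mono     : ∀ {m m′} → m ℕ.< m′ → F m ℕ.< F m′
    scale      : ∀ N .{{_ : NonZero N}} → ∃[ h ]
                   (∀ {a b} → a ℕ.< b → h a ℕ.< h b) ×
                   (∀ m → F (m ℕ.* N) ≡ h (F m)) ×
                   (∀ D → G (D ℕ.* N) ≡ h (G D))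
    bounded    : ∃[ m ] G 1 ℕ.< F m
    below-open : ∀ {m D} → F m ℕ.< G D → ∃[ N ] F (suc (m ℕ.* suc N)) ℕ.< G (D ℕ.* suc N)
    above-open : ∀ {m D} → G D ℕ.< F m →
                   ∃[ N ] ∃[ m′ ] m ℕ.* suc N ≡ suc m′ × G (D ℕ.* suc N) ℕ.< F m′

  Below Above : ℚᵘ → Set
  Below (mkℚᵘ (+ m)    D-1) = F m ℕ.< G (suc D-1)
  Below (mkℚᵘ -[1+ _ ] _)   = ⊤
  Above (mkℚᵘ (+ m)    D-1) = G (suc D-1) ℕ.< F m
  Above (mkℚᵘ -[1+ _ ] _)   = ⊥

  private
    mono-≤ : ∀ {m m′} → m ℕ.≤ m′ → F m ℕ.≤ F m′
    mono-≤ m≤m′ with ℕ.m≤n⇒m<n∨m≡n m≤m′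
    ... | inj₁ m<m′ = ℕ.<⇒≤ (F-mono m<m′)
    ... | inj₂ refl = ℕ.≤-refl

    module _ {m D : ℕ} (N : ℕ) .{{_ : NonZero N}} where
      private
        h   = proj₁ (scale N)
        h<  = proj₁ (proj₂ (scale N))
        hF  = proj₁ (proj₂ (proj₂ (scale N))) m
        hG  = proj₂ (proj₂ (proj₂ (scale N))) D

      scale-below : F m ℕ.< G D → F (m ℕ.* N) ℕ.< G (D ℕ.* N)
      scale-below lt = subst₂ ℕ._<_ (sym hF) (sym hG) (h< lt)

      scale-above : G D ℕ.< F m → G (D ℕ.* N) ℕ.< F (m ℕ.* N)
      scale-above lt = subst₂ ℕ._<_ (sym hG) (sym hF) (h< lt)

      scale-≡ : F m ≡ G D → F (m ℕ.* N) ≡ G (D ℕ.* N)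
      scale-≡ eq = trans hF (trans (cong h eq) (sym hG))

    unscale-below : ∀ {m D} N .{{_ : NonZero N}} → F (m ℕ.* N) ℕ.< G (D ℕ.* N) → F m ℕ.< G D
    unscale-below {m} {D} N lt with ℕ.<-cmp (F m) (G D)
    ... | tri< a _ _ = a
    ... | tri≈ _ b _ = contradiction lt (ℕ.<-irrefl (scale-≡ N b))
    ... | tri> _ _ c = contradiction lt (ℕ.<-asym (scale-above {m} {D} N c))

    unscale-above : ∀ {m D} N .{{_ : NonZero N}} → G (D ℕ.* N) ℕ.< F (m ℕ.* N) → G D ℕ.< F m
    unscale-above {m} {D} N lt with ℕ.<-cmp (F m) (G D)
    ... | tri< a _ _ = contradiction lt (ℕ.<-asym (scale-below {m} {D} N a))
    ... | tri≈ _ b _ = contradiction lt (ℕ.<-irrefl (sym (scale-≡ N b)))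
    ... | tri> _ _ c = c

    cross : ∀ {m D m′ D′} → mkℚᵘ (+ m) D ℚ.< mkℚᵘ (+ m′) D′ → m ℕ.* suc D′ ℕ.< m′ ℕ.* suc D
    cross {m} {D} {m′} {D′} (*<* lt) =
      ℤ.drop‿+<+ (subst₂ ℤ._<_ (sym (ℤ.pos-* m (suc D′))) (sym (ℤ.pos-* m′ (suc D))) lt)

    uncross : ∀ {m D m′ D′} → m ℕ.* suc D′ ℕ.< m′ ℕ.* suc D → mkℚᵘ (+ m) D ℚ.< mkℚᵘ (+ m′) D′
    uncross {m} {D} {m′} {D′} lt =
      *<* (subst₂ ℤ._<_ (ℤ.pos-* m (suc D′)) (ℤ.pos-* m′ (suc D)) (+<+ lt))

    below-closed : ∀ {p q} → p ℚ.< q → Below q → Below p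
    below-closed {mkℚᵘ -[1+ _ ] _} p<q b = tt
    below-closed {mkℚᵘ (+ m) D} {mkℚᵘ -[1+ _ ] _} (*<* lt) b with m | lt
    ... | zero  | ()
    ... | suc _ | ()
    below-closed {mkℚᵘ (+ m) D} {mkℚᵘ (+ m′) D′} p<q b = unscale-below (suc D′)
      (ℕ.<-trans (F-mono (cross p<q))
        (subst (λ k → F (m′ ℕ.* suc D) ℕ.< G k) (ℕ.*-comm (suc D′) (suc D))
          (scale-below (suc D) b)))

    above-closed : ∀ {p q} → p ℚ.< q → Above p → Above q
    above-closed {mkℚᵘ (+ m) D} {mkℚᵘ -[1+ _ ] _} (*<* lt) a with m | lt
    ... | zero  | ()
    ... | suc _ | ()
    above-closed {mkℚᵘ (+ m) D} {mkℚᵘ (+ m′) D′} p<q a = unscale-above (suc D)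
      (ℕ.<-trans (subst (λ k → G k ℕ.< F (m ℕ.* suc D′)) (ℕ.*-comm (suc D) (suc D′))
          (scale-above (suc D′) a))
        (F-mono (cross p<q)))

    bopen : ∀ {p} → Below p → ∃[ q ] p ℚ.< q × Below q
    bopen {mkℚᵘ -[1+ m ] D} _ = mkℚᵘ -[1+ m ] (suc D) , *<* (ℤ.-<- (s≤s′ m D)) , tt
      where
      s≤s′ : ∀ m D → D ℕ.+ m ℕ.* suc D ℕ.< suc D ℕ.+ m ℕ.* suc (suc D)
      s≤s′ m D = ℕ.+-mono-<-≤ (ℕ.n<1+n D) (ℕ.*-monoʳ-≤ m (ℕ.n≤1+n (suc D)))
    bopen {mkℚᵘ (+ m) D} b with below-open b
    ... | N , lt = mkℚᵘ (+ suc (m ℕ.* suc N)) (N ℕ.+ D ℕ.* suc N) ,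
      uncross (subst (ℕ._< suc (m ℕ.* suc N) ℕ.* suc D) (eq m D N)
                (ℕ.*-monoˡ-< (suc D) (ℕ.n<1+n (m ℕ.* suc N)))) , lt
      where
      eq : ∀ m D N → m ℕ.* suc N ℕ.* suc D ≡ m ℕ.* (suc D ℕ.* suc N)
      eq = solve-∀

    aopen : ∀ {q} → Above q → ∃[ p ] p ℚ.< q × Above p
    aopen {mkℚᵘ (+ m) D} a with above-open a
    ... | N , m′ , eq , lt = mkℚᵘ (+ m′) (N ℕ.+ D ℕ.* suc N) ,
      uncross (subst (m′ ℕ.* suc D ℕ.<_) (trans (cong (ℕ._* suc D) (sym eq)) (eq′ m D N))
                (ℕ.*-monoˡ-< (suc D) (ℕ.n<1+n m′))) , lt
      where
      eq′ : ∀ m D N → m ℕ.* suc N ℕ.* suc D ≡ m ℕ.* (suc D ℕ.* suc N)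
      eq′ = solve-∀

    loc : ∀ {p q} → p ℚ.< q → Below p ⊎ Above q
    loc {mkℚᵘ -[1+ _ ] _} p<q = inj₁ tt
    loc {mkℚᵘ (+ m) D} {mkℚᵘ -[1+ _ ] _} (*<* lt) with m | lt
    ... | zero  | ()
    ... | suc _ | ()
    loc {mkℚᵘ (+ m) D} {mkℚᵘ (+ m′) D′} p<q with ℕ.<-cmp (F m) (G (suc D))
    ... | tri< a _ _ = inj₁ a
    ... | tri≈ _ b _ = inj₂ (unscale-above (suc D) (subst₂ ℕ._<_
      (trans (scale-≡ {m} {suc D} (suc D′) b) (cong G (ℕ.*-comm (suc D) (suc D′)))) refl
      (F-mono (cross p<q))))
    ... | tri> _ _ c = inj₂ (above-closed p<q c)

    disj : ∀ {p} → Below p → Above p → ⊥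
    disj {mkℚᵘ (+ _) _} = ℕ.<-asym

  cut : ℝ
  cut = record
    { Lower           = Below
    ; Upper           = Above
    ; lower-inhabited = mkℚᵘ -[1+ 0 ] 0 , tt
    ; upper-inhabited = mkℚᵘ (+ proj₁ bounded) 0 , proj₂ bounded
    ; lower-closed    = λ {p} {q} → below-closed {p} {q}
    ; upper-closed    = λ {p} {q} → above-closed {p} {q}
    ; lower-open      = bopen
    ; upper-open      = aopen
    ; disjoint        = λ {p} → disj {p}
    ; located         = loc
    }

open Comparison using (cut)

private
  bernoulli : ∀ x N → x ^ N ℕ.* (x ℕ.+ N) ℕ.≤ suc x ^ N ℕ.* x
  bernoulli x zero    = ℕ.≤-reflexive (cong (1 ℕ.*_) (ℕ.+-identityʳ x))
  bernoulli x (suc N) = begin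
    x ℕ.* x ^ N ℕ.* (x ℕ.+ suc N)                     ≤⟨ ℕ.m≤m+n _ (x ^ N ℕ.* N) ⟩
    x ℕ.* x ^ N ℕ.* (x ℕ.+ suc N) ℕ.+ x ^ N ℕ.* N     ≡⟨ eq x (x ^ N) N ⟩
    suc x ℕ.* (x ^ N ℕ.* (x ℕ.+ N))                   ≤⟨ ℕ.*-monoʳ-≤ (suc x) (bernoulli x N) ⟩
    suc x ℕ.* (suc x ^ N ℕ.* x)                       ≡⟨ ℕ.*-assoc (suc x) (suc x ^ N) x ⟨
    suc x ℕ.* suc x ^ N ℕ.* x                         ∎
    where
    open ℕ.≤-Reasoning
    eq : ∀ x y N → x ℕ.* y ℕ.* (x ℕ.+ suc N) ℕ.+ y ℕ.* N ≡ suc x ℕ.* (y ℕ.* (x ℕ.+ N))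
    eq = solve-∀

  power-gap : ∀ x y .{{_ : NonZero x}} → x ℕ.< y → ∃[ N ] 2 ℕ.* x ^ suc N ℕ.< y ^ suc N
  power-gap x@(suc x-1) y x<y = x-1 ℕ.+ x , (begin-strict
    2 ℕ.* x ^ N       <⟨ ℕ.*-monoˡ-< (x ^ N) {{ℕ.m^n≢0 x N}} (ℕ.n<1+n 2) ⟩
    3 ℕ.* x ^ N       ≤⟨ ℕ.*-cancelʳ-≤ (3 ℕ.* x ^ N) (suc x ^ N) x (begin
      3 ℕ.* x ^ N ℕ.* x            ≡⟨ eq x (x ^ N) ⟩
      x ^ N ℕ.* (x ℕ.+ (x ℕ.+ x))  ≤⟨ bernoulli x N ⟩
      suc x ^ N ℕ.* x              ∎) ⟩
    suc x ^ N         ≤⟨ ℕ.^-monoˡ-≤ N x<y ⟩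
    y ^ N             ∎)
    where
    open ℕ.≤-Reasoning
    N = x ℕ.+ x
    eq : ∀ x y → 3 ℕ.* y ℕ.* x ≡ y ℕ.* (x ℕ.+ (x ℕ.+ x))
    eq = solve-∀

  n<2^n : ∀ n → n ℕ.< 2 ^ n
  n<2^n zero    = s≤s z≤n
  n<2^n (suc n) = ℕ.+-mono-≤ (ℕ.m^n>0 2 n) (ℕ.≤-trans (n<2^n n) (ℕ.m≤m+n (2 ^ n) 0))

-- m / D < log₂ a  iff  2 ^ m < a ^ D.
log₂ : (a : ℕ) .{{_ : NonZero a}} → ℝ
log₂ a = cut record
  { F          = 2 ^_
  ; G          = a ^_
  ; F-mono     = ℕ.^-monoʳ-< 2 (ℕ.n<1+n 1)
  ; scale      = λ N → _^ N , ℕ.^-monoˡ-< N , (λ m → sym (ℕ.^-*-assoc 2 m N))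
                     , (λ D → sym (ℕ.^-*-assoc a D N))
  ; bounded    = a , subst (ℕ._< 2 ^ a) (sym (ℕ.*-identityʳ a)) (n<2^n a)
  ; below-open = λ {m} {D} lt → case power-gap (2 ^ m) (a ^ D) {{ℕ.m^n≢0 2 m}} lt of λ
      (N , gap) → N , subst₂ (λ u v → 2 ℕ.* u ℕ.< v) (ℕ.^-*-assoc 2 m (suc N))
                                                       (ℕ.^-*-assoc a D (suc N)) gap
  ; above-open = λ {m} {D} lt → case power-gap (a ^ D) (2 ^ m) {{ℕ.m^n≢0 a D}} lt of λ
      (N , gap) → N , halve (m ℕ.* suc N) (a ^ (D ℕ.* suc N)) {{ℕ.m^n≢0 a (D ℕ.* suc N)}}
        (subst₂ (λ u v → 2 ℕ.* u ℕ.< v) (ℕ.^-*-assoc a D (suc N))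
                                          (ℕ.^-*-assoc 2 m (suc N)) gap)
  }
  where
  halve : ∀ M b .{{_ : NonZero b}} → 2 ℕ.* b ℕ.< 2 ^ M → ∃[ m′ ] M ≡ suc m′ × b ℕ.< 2 ^ m′
  halve zero    (suc b) (s≤s ())
  halve (suc M) b       lt       = M , refl , ℕ.*-cancelˡ-< 2 b (2 ^ M) lt

private
  ^-distrib-* : ∀ a b k → (a ℕ.* b) ^ k ≡ a ^ k ℕ.* b ^ k
  ^-distrib-* a b zero    = refl
  ^-distrib-* a b (suc k) = trans (cong (a ℕ.* b ℕ.*_) (^-distrib-* a b k))
                                  (eq a b (a ^ k) (b ^ k))
    where
    eq : ∀ a b x y → a ℕ.* b ℕ.* (x ℕ.* y) ≡ a ℕ.* x ℕ.* (b ℕ.* y)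
    eq = solve-∀

  power-step-up : ∀ m k → ∃[ c ] ∀ N →
    N ℕ.* suc (m ℕ.* N) ^ k ℕ.≤ N ^ k ℕ.* (N ℕ.* m ^ k ℕ.+ c)
  power-step-up m zero    = 0 , λ N → ℕ.≤-reflexive (eq N)
    where
    eq : ∀ N → N ℕ.* 1 ≡ 1 ℕ.* (N ℕ.* 1 ℕ.+ 0)
    eq = solve-∀
  power-step-up m (suc k) with power-step-up m k
  ... | c , ih = m ℕ.* c ℕ.+ m ^ k ℕ.+ c , step
    where
    open ℕ.≤-Reasoning
    eq₁ : ∀ N x y → N ℕ.* (x ℕ.* y) ≡ x ℕ.* (N ℕ.* y)
    eq₁ = solve-∀
    eq₂ : ∀ m N y z c →
      suc (m ℕ.* N) ℕ.* (z ℕ.* (N ℕ.* y ℕ.+ c)) ≡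
      z ℕ.* (N ℕ.* (N ℕ.* (m ℕ.* y) ℕ.+ (m ℕ.* c ℕ.+ y)) ℕ.+ c)
    eq₂ = solve-∀
    eq₃ : ∀ m N y z c →
      z ℕ.* (N ℕ.* (N ℕ.* (m ℕ.* y) ℕ.+ (m ℕ.* c ℕ.+ y)) ℕ.+ N ℕ.* c) ≡
      N ℕ.* z ℕ.* (N ℕ.* (m ℕ.* y) ℕ.+ (m ℕ.* c ℕ.+ y ℕ.+ c))
    eq₃ = solve-∀
    step : ∀ N → N ℕ.* suc (m ℕ.* N) ^ suc k ℕ.≤
                 N ^ suc k ℕ.* (N ℕ.* m ^ suc k ℕ.+ (m ℕ.* c ℕ.+ m ^ k ℕ.+ c))
    step zero      = z≤n
    step N@(suc _) = begin
      N ℕ.* (suc (m ℕ.* N) ℕ.* suc (m ℕ.* N) ^ k)   ≡⟨ eq₁ N (suc (m ℕ.* N)) _ ⟩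
      suc (m ℕ.* N) ℕ.* (N ℕ.* suc (m ℕ.* N) ^ k)   ≤⟨ ℕ.*-monoʳ-≤ (suc (m ℕ.* N)) (ih N) ⟩
      suc (m ℕ.* N) ℕ.* (N ^ k ℕ.* (N ℕ.* m ^ k ℕ.+ c))
        ≡⟨ eq₂ m N (m ^ k) (N ^ k) c ⟩
      N ^ k ℕ.* (N ℕ.* (N ℕ.* (m ℕ.* m ^ k) ℕ.+ (m ℕ.* c ℕ.+ m ^ k)) ℕ.+ c)
        ≤⟨ ℕ.*-monoʳ-≤ (N ^ k) (ℕ.+-monoʳ-≤ _ (ℕ.m≤n*m c N)) ⟩
      N ^ k ℕ.* (N ℕ.* (N ℕ.* (m ℕ.* m ^ k) ℕ.+ (m ℕ.* c ℕ.+ m ^ k)) ℕ.+ N ℕ.* c)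
        ≡⟨ eq₃ m N (m ^ k) (N ^ k) c ⟩
      N ^ suc k ℕ.* (N ℕ.* m ^ suc k ℕ.+ (m ℕ.* c ℕ.+ m ^ k ℕ.+ c)) ∎

  power-step-down : ∀ m k → ∃[ c ] ∀ N m′ → m ℕ.* N ≡ suc m′ →
    N ^ k ℕ.* (N ℕ.* m ^ k) ℕ.≤ N ℕ.* m′ ^ k ℕ.+ N ^ k ℕ.* c
  power-step-down m zero    = 0 , λ N m′ _ → ℕ.≤-reflexive (eq N)
    where
    eq : ∀ N → 1 ℕ.* (N ℕ.* 1) ≡ N ℕ.* 1 ℕ.+ 1 ℕ.* 0
    eq = solve-∀
  power-step-down m (suc k) with power-step-down m k
  ... | c , ih = m ℕ.* c ℕ.+ m ^ k , step
    where
    open ℕ.≤-Reasoning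
    eq₁ : ∀ m N y z → N ℕ.* z ℕ.* (N ℕ.* (m ℕ.* y)) ≡ m ℕ.* N ℕ.* (z ℕ.* (N ℕ.* y))
    eq₁ = solve-∀
    eq₂ : ∀ m N z c w → m ℕ.* N ℕ.* (N ℕ.* w ℕ.+ z ℕ.* c) ≡
                        m ℕ.* N ℕ.* (N ℕ.* w) ℕ.+ N ℕ.* z ℕ.* (m ℕ.* c)
    eq₂ = solve-∀
    eq₃ : ∀ N m′ w t → suc m′ ℕ.* (N ℕ.* w) ℕ.+ t ≡ N ℕ.* (m′ ℕ.* w) ℕ.+ (t ℕ.+ N ℕ.* w)
    eq₃ = solve-∀
    eq₄ : ∀ m N y z c → N ℕ.* z ℕ.* (m ℕ.* c) ℕ.+ N ℕ.* (y ℕ.* z) ≡ N ℕ.* z ℕ.* (m ℕ.* c ℕ.+ y)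
    eq₄ = solve-∀
    step : ∀ N m′ → m ℕ.* N ≡ suc m′ →
           N ^ suc k ℕ.* (N ℕ.* m ^ suc k) ℕ.≤
           N ℕ.* m′ ^ suc k ℕ.+ N ^ suc k ℕ.* (m ℕ.* c ℕ.+ m ^ k)
    step N m′ eq = begin
      N ^ suc k ℕ.* (N ℕ.* m ^ suc k)                  ≡⟨ eq₁ m N (m ^ k) (N ^ k) ⟩
      m ℕ.* N ℕ.* (N ^ k ℕ.* (N ℕ.* m ^ k))            ≤⟨ ℕ.*-monoʳ-≤ (m ℕ.* N) (ih N m′ eq) ⟩
      m ℕ.* N ℕ.* (N ℕ.* m′ ^ k ℕ.+ N ^ k ℕ.* c)       ≡⟨ eq₂ m N (N ^ k) c (m′ ^ k) ⟩
      m ℕ.* N ℕ.* (N ℕ.* m′ ^ k) ℕ.+ N ^ suc k ℕ.* (m ℕ.* c)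
        ≡⟨ cong (λ M → M ℕ.* (N ℕ.* m′ ^ k) ℕ.+ N ^ suc k ℕ.* (m ℕ.* c)) eq ⟩
      suc m′ ℕ.* (N ℕ.* m′ ^ k) ℕ.+ N ^ suc k ℕ.* (m ℕ.* c)
        ≡⟨ eq₃ N m′ (m′ ^ k) _ ⟩
      N ℕ.* m′ ^ suc k ℕ.+ (N ^ suc k ℕ.* (m ℕ.* c) ℕ.+ N ℕ.* m′ ^ k)
        ≤⟨ ℕ.+-monoʳ-≤ (N ℕ.* m′ ^ suc k) (ℕ.+-monoʳ-≤ (N ^ suc k ℕ.* (m ℕ.* c))
             (ℕ.*-monoʳ-≤ N (begin
               m′ ^ k           ≤⟨ ℕ.^-monoˡ-≤ k (ℕ.≤-trans (ℕ.n≤1+n m′) (ℕ.≤-reflexive (sym eq))) ⟩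
               (m ℕ.* N) ^ k    ≡⟨ ^-distrib-* m N k ⟩
               m ^ k ℕ.* N ^ k  ∎))) ⟩
      N ℕ.* m′ ^ suc k ℕ.+ (N ^ suc k ℕ.* (m ℕ.* c) ℕ.+ N ℕ.* (m ^ k ℕ.* N ^ k))
        ≡⟨ cong (N ℕ.* m′ ^ suc k ℕ.+_) (eq₄ m N (m ^ k) (N ^ k) c) ⟩
      N ℕ.* m′ ^ suc k ℕ.+ N ^ suc k ℕ.* (m ℕ.* c ℕ.+ m ^ k) ∎

infix 8 _^-1/_

-- The nonnegative t with t ^ k · d = 1:  m / D < t  iff  m ^ k · d < D ^ k.
_^-1/_ : (d k : ℕ) .{{_ : NonZero d}} .{{_ : NonZero k}} → ℝ
d ^-1/ k = cut record
  { F          = λ m → m ^ k ℕ.* d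
  ; G          = λ D → D ^ k
  ; F-mono     = λ m<m′ → ℕ.*-monoˡ-< d (ℕ.^-monoˡ-< k m<m′)
  ; scale      = λ N → (ℕ._* N ^ k) , ℕ.*-monoˡ-< (N ^ k) {{ℕ.m^n≢0 N k}}
                     , (λ m → trans (cong (ℕ._* d) (^-distrib-* m N k)) (eq (m ^ k) (N ^ k) d))
                     , (λ D → ^-distrib-* D N k)
  ; bounded    = 2 , (begin-strict
      1 ^ k        ≡⟨ ℕ.^-zeroˡ k ⟩
      1            <⟨ ℕ.n<1+n 1 ⟩
      2 ^ 1        ≤⟨ ℕ.^-monoʳ-≤ 2 (ℕ.>-nonZero⁻¹ k) ⟩
      2 ^ k        ≤⟨ ℕ.m≤m*n (2 ^ k) d ⟩
      2 ^ k ℕ.* d  ∎)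
  ; below-open = λ {m} {D} → bopen m D
  ; above-open = λ {m} {D} → aopen m D
  }
  where
  open ℕ.≤-Reasoning
  eq : ∀ x y d → x ℕ.* y ℕ.* d ≡ x ℕ.* d ℕ.* y
  eq = solve-∀

  bopen : ∀ m D → m ^ k ℕ.* d ℕ.< D ^ k →
          ∃[ N ] suc (m ℕ.* suc N) ^ k ℕ.* d ℕ.< (D ℕ.* suc N) ^ k
  bopen m D lt with power-step-up m k
  ... | c , bound = c ℕ.* d , ℕ.*-cancelˡ-< N _ _ (begin-strict
    N ℕ.* (suc (m ℕ.* N) ^ k ℕ.* d)                ≡⟨ ℕ.*-assoc N (suc (m ℕ.* N) ^ k) d ⟨
    N ℕ.* suc (m ℕ.* N) ^ k ℕ.* d                  ≤⟨ ℕ.*-monoˡ-≤ d (bound N) ⟩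
    N ^ k ℕ.* (N ℕ.* m ^ k ℕ.+ c) ℕ.* d            ≡⟨ eq₁ (N ^ k) N (m ^ k) c d ⟩
    N ^ k ℕ.* (c ℕ.* d ℕ.+ N ℕ.* (m ^ k ℕ.* d))    <⟨ ℕ.*-monoʳ-< (N ^ k) {{ℕ.m^n≢0 N k}}
                                                        (ℕ.+-monoˡ-< _ (ℕ.n<1+n (c ℕ.* d))) ⟩
    N ^ k ℕ.* (N ℕ.+ N ℕ.* (m ^ k ℕ.* d))          ≡⟨ cong (N ^ k ℕ.*_) (ℕ.*-suc N _) ⟨
    N ^ k ℕ.* (N ℕ.* suc (m ^ k ℕ.* d))            ≤⟨ ℕ.*-monoʳ-≤ (N ^ k) (ℕ.*-monoʳ-≤ N lt) ⟩
    N ^ k ℕ.* (N ℕ.* D ^ k)                        ≡⟨ eq₂ (N ^ k) N (D ^ k) ⟩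
    N ℕ.* (D ^ k ℕ.* N ^ k)                        ≡⟨ cong (N ℕ.*_) (^-distrib-* D N k) ⟨
    N ℕ.* (D ℕ.* N) ^ k                            ∎)
    where
    N = suc (c ℕ.* d)
    eq₁ : ∀ z N y c d → z ℕ.* (N ℕ.* y ℕ.+ c) ℕ.* d ≡ z ℕ.* (c ℕ.* d ℕ.+ N ℕ.* (y ℕ.* d))
    eq₁ = solve-∀
    eq₂ : ∀ z N x → z ℕ.* (N ℕ.* x) ≡ N ℕ.* (x ℕ.* z)
    eq₂ = solve-∀

  aopen : ∀ m D → D ^ k ℕ.< m ^ k ℕ.* d →
          ∃[ N ] ∃[ m′ ] m ℕ.* suc N ≡ suc m′ × (D ℕ.* suc N) ^ k ℕ.< m′ ^ k ℕ.* d
  aopen zero    D lt = contradiction (subst (λ z → D ^ k ℕ.< z ℕ.* d) (zero^ k) lt) λ ()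
    where
    zero^ : ∀ k .{{_ : NonZero k}} → 0 ^ k ≡ 0
    zero^ (suc _) = refl
  aopen m@(suc m-1) D lt with power-step-down m k
  ... | c , bound = c ℕ.* d , m′ , refl ,
    ℕ.*-cancelˡ-< N _ _ (ℕ.+-cancelʳ-< (N ^ k ℕ.* (c ℕ.* d)) _ _ (begin-strict
      N ℕ.* (D ℕ.* N) ^ k ℕ.+ N ^ k ℕ.* (c ℕ.* d)
        ≡⟨ cong (λ z → N ℕ.* z ℕ.+ N ^ k ℕ.* (c ℕ.* d)) (^-distrib-* D N k) ⟩
      N ℕ.* (D ^ k ℕ.* N ^ k) ℕ.+ N ^ k ℕ.* (c ℕ.* d)
        ≡⟨ eq₁ N (D ^ k) (N ^ k) (c ℕ.* d) ⟩
      N ^ k ℕ.* (c ℕ.* d ℕ.+ N ℕ.* D ^ k)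
        <⟨ ℕ.*-monoʳ-< (N ^ k) {{ℕ.m^n≢0 N k}} (ℕ.+-monoˡ-< _ (ℕ.n<1+n (c ℕ.* d))) ⟩
      N ^ k ℕ.* (N ℕ.+ N ℕ.* D ^ k)
        ≡⟨ cong (N ^ k ℕ.*_) (ℕ.*-suc N (D ^ k)) ⟨
      N ^ k ℕ.* (N ℕ.* suc (D ^ k))
        ≤⟨ ℕ.*-monoʳ-≤ (N ^ k) (ℕ.*-monoʳ-≤ N lt) ⟩
      N ^ k ℕ.* (N ℕ.* (m ^ k ℕ.* d))
        ≡⟨ eq₂ N (m ^ k) (N ^ k) d ⟩
      N ^ k ℕ.* (N ℕ.* m ^ k) ℕ.* d
        ≤⟨ ℕ.*-monoˡ-≤ d (bound N m′ refl) ⟩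
      (N ℕ.* m′ ^ k ℕ.+ N ^ k ℕ.* c) ℕ.* d
        ≡⟨ eq₃ N (m′ ^ k) (N ^ k) c d ⟩
      N ℕ.* (m′ ^ k ℕ.* d) ℕ.+ N ^ k ℕ.* (c ℕ.* d) ∎))
    where
    N = suc (c ℕ.* d)
    m′ = c ℕ.* d ℕ.+ m-1 ℕ.* N
    eq₁ : ∀ N x z e → N ℕ.* (x ℕ.* z) ℕ.+ z ℕ.* e ≡ z ℕ.* (e ℕ.+ N ℕ.* x)
    eq₁ = solve-∀
    eq₂ : ∀ N y z d → z ℕ.* (N ℕ.* (y ℕ.* d)) ≡ z ℕ.* (N ℕ.* y) ℕ.* d
    eq₂ = solve-∀
    eq₃ : ∀ N w z c d → (N ℕ.* w ℕ.+ z ℕ.* c) ℕ.* d ≡ N ℕ.* (w ℕ.* d) ℕ.+ z ℕ.* (c ℕ.* d)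
    eq₃ = solve-∀

{-# OPTIONS --safe #-}
-- The occupancy method.  Let Z(λ) = Σ λ^|I| over the weak independent sets I, and draw I with probability
-- proportional to λ^|I|, where 0 < λ ≤ 1; put q = λ / (1 + λ), k = r − 1 and c = 1 − q^k.  Fix a vertex v, and
-- call a neighbour u of v blocked if some edge f with u ∈ f and v ∉ f has all its other vertices in I.  As there
-- are no cross-edges, the blocked vertices are determined by I outside the closed neighbourhood of v.  If m edges
-- at v have no blocked vertex, then v is occupied with conditional odds at most λ c^m, and a neighbour of v is
-- occupied with probability at most q, and only if it is unblocked.  Optimising over m gives
--   r E|I| ≤ n q (r − 1 + 2 c^d).
-- If M^k ≤ d then c^d ≤ 16 / ((1 + Mλ)(2 + Mλ)), and integrating the resulting bound on the logarithmic derivative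
--   r Z′/Z ≤ n ((r − 1) / (1 + λ) + 32 / ((1 + Mλ)(2 + Mλ)))
-- from 0 to 1 gives r log₂ i_r(G) ≤ n (r − 1 + O(1 / M)), with M = ⌊d^(1/k)⌋.
-- The weight λ is written a / b with natural numbers a and b, and the integral is a telescoping product over
-- λ = j / N.  Every probabilistic step compares I with I ∪ {u} or I ∖ {u} for a single vertex u.
module Submission where

open import Defs hiding (_≤_; _+_; _·_)
open import Data.Nat.Tactic.RingSolver using (solve-∀)
open import Relation.Binary.PropositionalEquality

module Counting where

  open import Data.Bool using (Bool; true; false; not)
  open import Data.Fin using (Fin; zero; suc; _≟_)
  open import Data.Fin.Subset using (Subset; inside; outside; _∈_; _∉_; _⊆_; ∣_∣)
  open import Data.Fin.Subset.Properties using (_∈?_; _⊆?_; p⊆q⇒∣p∣≤∣q∣; x∈p∩q⁺)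
  open import Data.List using (List; []; _∷_; map; length; filter; allFin; _++_)
  open import Data.List.Membership.Propositional using () renaming (_∈_ to _∈ˡ_)
  open import Data.List.Membership.Propositional.Properties using (∈-filter⁺; ∈-filter⁻; ∈-allFin)
  open import Data.List.Properties using (map-tabulate; length-tabulate)
  open import Data.List.Relation.Unary.All as All using (All; all?)
  open import Data.List.Relation.Unary.Any using (here; there)
  open import Data.List.Relation.Unary.Unique.Propositional using (Unique; []; _∷_)
  import Data.List.Relation.Unary.Unique.Propositional.Properties as Unique
  open import Data.Nat hiding (_≟_)
  open import Data.Nat.Properties hiding (_≟_)
  open import Data.Product using (_×_; _,_; proj₁; proj₂; ∃-syntax)
  open import Data.Sum using (_⊎_; inj₁; inj₂)
  open import Data.Vec using ([]; _∷_; lookup; _[_]≔_; here; there)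
  open import Data.Vec.Properties
    using (lookup⇒[]=; []=⇒lookup; []≔-minimal; []≔-updates; lookup∘update; lookup∘update′)
  open import Function using (_∘_)
  open import Relation.Nullary using (¬_; Dec; yes; no; contradiction)
  open import Relation.Nullary.Decidable using (¬?; _→-dec_)
  open import Relation.Unary using (Decidable)
  open ≤-Reasoning

  -- Indicators and finite sums.

  private variable
    A A′ : Set
    n : ℕ

  ≤-from-+ : ∀ {x y} z → x + z ≡ y → x ≤ y
  ≤-from-+ {x} z refl = m≤m+n x z

  𝟙 : {P : Set} → Dec P → ℕ
  𝟙 (yes _) = 1
  𝟙 (no _)  = 0

  𝟙-mono : {P Q : Set} (p : Dec P) (q : Dec Q) → (P → Q) → 𝟙 p ≤ 𝟙 q
  𝟙-mono (no _)  q       f = z≤n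
  𝟙-mono (yes p) (yes q) f = ≤-refl
  𝟙-mono (yes p) (no ¬q) f = contradiction (f p) ¬q

  ∑ : List A → (A → ℕ) → ℕ
  ∑ []       f = 0
  ∑ (x ∷ xs) f = f x + ∑ xs f

  ∑-mono : ∀ (xs : List A) {f g : A → ℕ} → (∀ x → x ∈ˡ xs → f x ≤ g x) → ∑ xs f ≤ ∑ xs g
  ∑-mono []       h = z≤n
  ∑-mono (x ∷ xs) h = +-mono-≤ (h x (here refl)) (∑-mono xs λ y y∈ → h y (there y∈))

  ∑-cong : ∀ (xs : List A) {f g : A → ℕ} → (∀ x → x ∈ˡ xs → f x ≡ g x) → ∑ xs f ≡ ∑ xs g
  ∑-cong []       h = refl
  ∑-cong (x ∷ xs) h = cong₂ _+_ (h x (here refl)) (∑-cong xs λ y y∈ → h y (there y∈))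

  ∑-+ : ∀ (xs : List A) f g → ∑ xs (λ x → f x + g x) ≡ ∑ xs f + ∑ xs g
  ∑-+ []       f g = refl
  ∑-+ (x ∷ xs) f g = trans (cong (f x + g x +_) (∑-+ xs f g)) (eq (f x) (g x) _ _)
    where
    eq : ∀ a b c d → a + b + (c + d) ≡ a + c + (b + d)
    eq = solve-∀

  ∑-*ˡ : ∀ c (xs : List A) f → c * ∑ xs f ≡ ∑ xs (λ x → c * f x)
  ∑-*ˡ c []       f = *-zeroʳ c
  ∑-*ˡ c (x ∷ xs) f = trans (*-distribˡ-+ c (f x) _) (cong (c * f x +_) (∑-*ˡ c xs f))

  ∑-const : ∀ (xs : List A) c → ∑ xs (λ _ → c) ≡ length xs * c
  ∑-const []       c = refl
  ∑-const (x ∷ xs) c = cong (c +_) (∑-const xs c)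

  ∑-swap : ∀ (xs : List A) (ys : List A′) (f : A → A′ → ℕ) →
           ∑ xs (λ x → ∑ ys (f x)) ≡ ∑ ys (λ y → ∑ xs (λ x → f x y))
  ∑-swap []       ys f = sym (trans (∑-const ys 0) (*-zeroʳ (length ys)))
  ∑-swap (x ∷ xs) ys f = trans (cong (∑ ys (f x) +_) (∑-swap xs ys f)) (sym (∑-+ ys (f x) _))

  ∑-map : ∀ (g : A → A′) xs f → ∑ (map g xs) f ≡ ∑ xs (f ∘ g)
  ∑-map g []       f = refl
  ∑-map g (x ∷ xs) f = cong (f (g x) +_) (∑-map g xs f)

  ∑-filter : ∀ {P : A → Set} (P? : Decidable P) xs f → ∑ (filter P? xs) f ≡ ∑ xs (λ x → 𝟙 (P? x) * f x)
  ∑-filter P? []       f = refl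
  ∑-filter P? (x ∷ xs) f with P? x
  ... | yes _ = cong₂ _+_ (sym (*-identityˡ (f x))) (∑-filter P? xs f)
  ... | no  _ = ∑-filter P? xs f

  length-filter-∑ : ∀ {P : A → Set} (P? : Decidable P) xs → length (filter P? xs) ≡ ∑ xs (𝟙 ∘ P?)
  length-filter-∑ P? []       = refl
  length-filter-∑ P? (x ∷ xs) with P? x
  ... | yes _ = cong suc (length-filter-∑ P? xs)
  ... | no  _ = length-filter-∑ P? xs

  ∑-allFin-suc : ∀ (f : Fin (suc n) → ℕ) → ∑ (allFin (suc n)) f ≡ f zero + ∑ (allFin n) (f ∘ suc)
  ∑-allFin-suc {n} f = cong (f zero +_)
    (trans (cong (λ xs → ∑ xs f) (sym (map-tabulate {n = n} (λ i → i) suc))) (∑-map suc (allFin n) f))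

  bit : Bool → ℕ
  bit true  = 1
  bit false = 0

  χ χ̄ : Fin n → Subset n → ℕ
  χ u I = bit (lookup I u)
  χ̄ u I = bit (not (lookup I u))

  ∑-χ : ∀ (I : Subset n) → ∑ (allFin n) (λ u → χ u I) ≡ ∣ I ∣
  ∑-χ []            = refl
  ∑-χ (inside  ∷ I) = trans (∑-allFin-suc λ u → χ u (inside ∷ I)) (cong suc (∑-χ I))
  ∑-χ (outside ∷ I) = trans (∑-allFin-suc λ u → χ u (outside ∷ I)) (∑-χ I)

  χ+χ̄ : ∀ (u : Fin n) I → χ u I + χ̄ u I ≡ 1
  χ+χ̄ u I with lookup I u
  ... | true  = refl
  ... | false = refl

  -- The weighted measure on subsets.

  opaque
    -- The homogeneous partition function: `I` has weight `a ^ ∣ I ∣ * b ^ (n ∸ ∣ I ∣)`, which for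
    -- `b > 0` is `b ^ n` times λ^|I| at λ = a / b, so all estimates stay in ℕ. It is opaque so that
    -- it unfolds only through `μ-[]` and `μ-∷`.
    μ : ℕ → ℕ → (Subset n → ℕ) → ℕ
    μ {zero}  a b f = f []
    μ {suc n} a b f = a * μ a b (f ∘ (inside ∷_)) + b * μ a b (f ∘ (outside ∷_))

    μ-[] : ∀ {a b} {f : Subset 0 → ℕ} → μ a b f ≡ f []
    μ-[] = refl

    μ-∷ : ∀ {a b} {f : Subset (suc n) → ℕ} →
          μ a b f ≡ a * μ a b (λ I → f (inside ∷ I)) + b * μ a b (λ I → f (outside ∷ I))
    μ-∷ = refl

  *-distribˡ-weights : ∀ a b c x y → c * (a * x + b * y) ≡ a * (c * x) + b * (c * y)
  *-distribˡ-weights = solve-∀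

  module _ {a b : ℕ} where

    μ-mono : {f g : Subset n → ℕ} → (∀ I → f I ≤ g I) → μ a b f ≤ μ a b g
    μ-mono {zero}          h = subst₂ _≤_ (sym μ-[]) (sym μ-[]) (h [])
    μ-mono {suc n} {f} {g} h rewrite μ-∷ {a = a} {b} {f} | μ-∷ {a = a} {b} {g} =
      +-mono-≤ (*-monoʳ-≤ a (μ-mono (h ∘ (inside ∷_)))) (*-monoʳ-≤ b (μ-mono (h ∘ (outside ∷_))))

    μ-cong : {f g : Subset n → ℕ} → (∀ I → f I ≡ g I) → μ a b f ≡ μ a b g
    μ-cong h = ≤-antisym (μ-mono (≤-reflexive ∘ h)) (μ-mono (≤-reflexive ∘ sym ∘ h))

    μ-+ : (f g : Subset n → ℕ) → μ a b (λ I → f I + g I) ≡ μ a b f + μ a b g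
    μ-+ {zero}  f g = trans μ-[] (sym (cong₂ _+_ μ-[] μ-[]))
    μ-+ {suc n} f g
      rewrite μ-∷ {a = a} {b} {f} | μ-∷ {a = a} {b} {g} | μ-∷ {a = a} {b} {λ I → f I + g I}
            | μ-+ (f ∘ (inside ∷_)) (g ∘ (inside ∷_)) | μ-+ (f ∘ (outside ∷_)) (g ∘ (outside ∷_))
      = eq a b _ _ _ _
      where
      eq : ∀ a b x y z w → a * (x + y) + b * (z + w) ≡ a * x + b * z + (a * y + b * w)
      eq = solve-∀

    μ-*ˡ : ∀ c (f : Subset n → ℕ) → c * μ a b f ≡ μ a b (λ I → c * f I)
    μ-*ˡ {zero}  c f = trans (cong (c *_) μ-[]) (sym μ-[])
    μ-*ˡ {suc n} c f
      rewrite μ-∷ {a = a} {b} {f} | μ-∷ {a = a} {b} {λ I → c * f I}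
            | sym (μ-*ˡ c (f ∘ (inside ∷_))) | sym (μ-*ˡ c (f ∘ (outside ∷_)))
      = *-distribˡ-weights a b c _ _

    μ-0 : μ {n} a b (λ _ → 0) ≡ 0
    μ-0 = sym (μ-*ˡ 0 λ _ → 0)

    μ-∑ : ∀ (xs : List A) (f : A → Subset n → ℕ) → ∑ xs (λ x → μ a b (f x)) ≡ μ a b (λ I → ∑ xs (λ x → f x I))
    μ-∑ []       f = sym μ-0
    μ-∑ (x ∷ xs) f = trans (cong (μ a b (f x) +_) (μ-∑ xs f)) (sym (μ-+ (f x) _))

    μ-split : ∀ (u : Fin n) (f : Subset n → ℕ) →
              μ a b f ≡ μ a b (λ I → χ u I * f I) + μ a b (λ I → χ̄ u I * f I)
    μ-split u f = trans (μ-cong λ I → trans (sym (*-identityˡ (f I)))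
        (trans (cong (_* f I) (sym (χ+χ̄ u I))) (*-distribʳ-+ (f I) (χ u I) (χ̄ u I))))
      (μ-+ _ _)

    -- The weight of a set containing u is a / b times that of the set without u.
    μ-remove : ∀ (u : Fin n) {f g : Subset n → ℕ} →
               (∀ I → u ∈ I → f I ≤ g (I [ u ]≔ outside)) →
               b * μ a b (λ I → χ u I * f I) ≤ a * μ a b (λ I → χ̄ u I * g I)
    μ-remove {suc n} zero {f} {g} h
      rewrite μ-∷ {a = a} {b} {λ I → χ zero I * f I} | μ-∷ {a = a} {b} {λ I → χ̄ zero I * g I}
            | μ-0 {n} = begin
      b * (a * μ a b (λ I → 1 * f (inside ∷ I)) + b * 0)
        ≤⟨ *-monoʳ-≤ b (+-monoˡ-≤ (b * 0) (*-monoʳ-≤ a (μ-mono λ I → *-monoʳ-≤ 1 (h (inside ∷ I) here)))) ⟩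
      b * (a * μ a b (λ I → 1 * g (outside ∷ I)) + b * 0)
        ≡⟨ eq a b _ ⟩
      a * (a * 0 + b * μ a b (λ I → 1 * g (outside ∷ I))) ∎
      where
      eq : ∀ a b x → b * (a * x + b * 0) ≡ a * (a * 0 + b * x)
      eq = solve-∀
    μ-remove (suc u) {f} {g} h
      rewrite μ-∷ {a = a} {b} {λ I → χ (suc u) I * f I} | μ-∷ {a = a} {b} {λ I → χ̄ (suc u) I * g I}
      = subst₂ _≤_ (sym (*-distribˡ-weights a b b _ _)) (sym (*-distribˡ-weights a b a _ _))
          (+-mono-≤ (*-monoʳ-≤ a (μ-remove u {g = g ∘ (inside ∷_)} λ I u∈ → h (inside ∷ I) (there u∈)))
                    (*-monoʳ-≤ b (μ-remove u {g = g ∘ (outside ∷_)} λ I u∈ → h (outside ∷ I) (there u∈))))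

    μ-insert : ∀ (u : Fin n) {f g : Subset n → ℕ} →
               (∀ I → u ∉ I → f I ≤ g (I [ u ]≔ inside)) →
               a * μ a b (λ I → χ̄ u I * f I) ≤ b * μ a b (λ I → χ u I * g I)
    μ-insert {suc n} zero {f} {g} h
      rewrite μ-∷ {a = a} {b} {λ I → χ̄ zero I * f I} | μ-∷ {a = a} {b} {λ I → χ zero I * g I}
            | μ-0 {n} = begin
      a * (a * 0 + b * μ a b (λ I → 1 * f (outside ∷ I)))
        ≤⟨ *-monoʳ-≤ a (+-monoʳ-≤ (a * 0) (*-monoʳ-≤ b (μ-mono λ I → *-monoʳ-≤ 1 (h (outside ∷ I) λ ())))) ⟩
      a * (a * 0 + b * μ a b (λ I → 1 * g (inside ∷ I)))
        ≡⟨ eq a b _ ⟩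
      b * (a * μ a b (λ I → 1 * g (inside ∷ I)) + b * 0) ∎
      where
      eq : ∀ a b x → a * (a * 0 + b * x) ≡ b * (a * x + b * 0)
      eq = solve-∀
    μ-insert (suc u) {f} {g} h
      rewrite μ-∷ {a = a} {b} {λ I → χ̄ (suc u) I * f I} | μ-∷ {a = a} {b} {λ I → χ (suc u) I * g I}
      = subst₂ _≤_ (sym (*-distribˡ-weights a b a _ _)) (sym (*-distribˡ-weights a b b _ _))
          (+-mono-≤ (*-monoʳ-≤ a (μ-insert u {g = g ∘ (inside ∷_)} λ I u∉ → h (inside ∷ I) λ { (there u∈) → u∉ u∈ }))
                    (*-monoʳ-≤ b (μ-insert u {g = g ∘ (outside ∷_)} λ I u∉ → h (outside ∷ I) λ { (there u∈) → u∉ u∈ })))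

    -- One coordinate of the Harris inequality: pairing each set without `u` with the set that has
    -- `u` added changes weights in the ratio `b` to `a` and does not lower `f`.
    μ-increasing : ∀ (u : Fin n) {f : Subset n → ℕ} → (∀ I → f I ≤ f (I [ u ]≔ inside)) →
                   a * μ a b f ≤ (a + b) * μ a b (λ I → χ u I * f I)
    μ-increasing u {f} h = begin
      a * μ a b f                        ≡⟨ cong (a *_) (μ-split u f) ⟩
      a * (x + μ a b (λ I → χ̄ u I * f I)) ≡⟨ *-distribˡ-+ a x _ ⟩
      a * x + a * μ a b (λ I → χ̄ u I * f I) ≤⟨ +-monoʳ-≤ (a * x) (μ-insert u λ I _ → h I) ⟩
      a * x + b * x                      ≡⟨ *-distribʳ-+ x a b ⟨
      (a + b) * x                        ∎
      where x = μ a b (λ I → χ u I * f I)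

    -- The left side is charged twice: with coefficient `a` to the same sets under `g`, and with
    -- coefficient `b` to the sets with `u` deleted, via `μ-remove`. Together these make up all of
    -- `μ a b g`.
    μ-contains : ∀ (u : Fin n) {f g : Subset n → ℕ} →
                 (∀ I → u ∈ I → f I ≤ g I) → (∀ I → u ∈ I → f I ≤ g (I [ u ]≔ outside)) →
                 (a + b) * μ a b (λ I → χ u I * f I) ≤ a * μ a b g
    μ-contains {n} u {f} {g} h₁ h₂ = begin
      (a + b) * x     ≡⟨ *-distribʳ-+ x a b ⟩
      a * x + b * x   ≤⟨ +-mono-≤ (*-monoʳ-≤ a (μ-mono le)) (μ-remove u h₂) ⟩
      a * μ a b (λ I → χ u I * g I) + a * μ a b (λ I → χ̄ u I * g I) ≡⟨ *-distribˡ-+ a _ _ ⟨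
      a * (μ a b (λ I → χ u I * g I) + μ a b (λ I → χ̄ u I * g I)) ≡⟨ cong (a *_) (μ-split u g) ⟨
      a * μ a b g     ∎
      where
      x = μ a b (λ I → χ u I * f I)
      le : ∀ I → χ u I * f I ≤ χ u I * g I
      le I with lookup I u in eq
      ... | false = z≤n
      ... | true  = *-monoʳ-≤ 1 (h₁ I (lookup⇒[]= u I eq))

  -- Convexity in the weight of a vertex: f(a) ≤ f(a − 1) + f′(a), multiplied by a.
  μ-convex : ∀ a b (f : Subset n → ℕ) →
             suc a * μ (suc a) b f ≤ suc a * μ a b f + μ (suc a) b (λ I → ∣ I ∣ * f I)
  μ-convex {zero}  a b f = ≤-trans (m≤m+n _ _)
    (≤-reflexive (cong₂ _+_ (cong (suc a *_) (trans μ-[] (sym μ-[]))) refl))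
  μ-convex {suc n} a b f
    rewrite μ-∷ {a = suc a} {b} {f} | μ-∷ {a = a} {b} {f} | μ-∷ {a = suc a} {b} {λ I → ∣ I ∣ * f I}
          | μ-+ {a = suc a} {b} (f ∘ (inside ∷_)) (λ I → ∣ I ∣ * f (inside ∷ I)) = begin
    a′ * (a′ * x + b * y)
      ≡⟨ eq₁ a b x y ⟩
    a * (a′ * x) + a′ * x + b * (a′ * y)
      ≤⟨ +-mono-≤ (+-monoˡ-≤ (a′ * x) (*-monoʳ-≤ a (μ-convex a b (f ∘ (inside ∷_)))))
                  (*-monoʳ-≤ b (μ-convex a b (f ∘ (outside ∷_)))) ⟩
    a * (a′ * x⁻ + x·) + a′ * x + b * (a′ * y⁻ + y·)
      ≤⟨ ≤-from-+ x· (eq₂ a b x x⁻ x· y⁻ y·) ⟩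
    a′ * (a * x⁻ + b * y⁻) + (a′ * (x + x·) + b * y·) ∎
    where
    a′ = suc a
    x = μ a′ b (f ∘ (inside ∷_))
    y = μ a′ b (f ∘ (outside ∷_))
    x⁻ = μ a b (f ∘ (inside ∷_))
    y⁻ = μ a b (f ∘ (outside ∷_))
    x· = μ a′ b (λ I → ∣ I ∣ * f (inside ∷ I))
    y· = μ a′ b (λ I → ∣ I ∣ * f (outside ∷ I))
    eq₁ : ∀ a b x y → suc a * (suc a * x + b * y) ≡ a * (suc a * x) + suc a * x + b * (suc a * y)
    eq₁ = solve-∀
    eq₂ : ∀ a b x x⁻ x· y⁻ y· →
          a * (suc a * x⁻ + x·) + suc a * x + b * (suc a * y⁻ + y·) + x· ≡
          suc a * (a * x⁻ + b * y⁻) + (suc a * (x + x·) + b * y·)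
    eq₂ = solve-∀

  -- Independent sets and blocked vertices

  ∏ : List A → (A → ℕ) → ℕ
  ∏ []       f = 1
  ∏ (x ∷ xs) f = f x * ∏ xs f

  ∏-mono : ∀ (xs : List A) {f g : A → ℕ} → (∀ x → x ∈ˡ xs → f x ≤ g x) → ∏ xs f ≤ ∏ xs g
  ∏-mono []       h = ≤-refl
  ∏-mono (x ∷ xs) h = *-mono-≤ (h x (here refl)) (∏-mono xs λ y y∈ → h y (there y∈))

  ∏-const : ∀ (xs : List A) c → ∏ xs (λ _ → c) ≡ c ^ length xs
  ∏-const []       c = refl
  ∏-const (x ∷ xs) c = cong (c *_) (∏-const xs c)

  infixl 7 _⊕_ _⊖_

  _⊕_ _⊖_ : Subset n → Fin n → Subset n
  I ⊕ u = I [ u ]≔ inside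
  I ⊖ u = I [ u ]≔ outside

  x∈[]≔⁺ : ∀ {I : Subset n} {x u s} → x ≢ u → x ∈ I → x ∈ I [ u ]≔ s
  x∈[]≔⁺ {I = I} {x} {u} x≢u x∈ = []≔-minimal I x u x≢u x∈

  x∈[]≔⁻ : ∀ {I : Subset n} {x u s} → x ≢ u → x ∈ I [ u ]≔ s → x ∈ I
  x∈[]≔⁻ {I = I} {x} {u} {s} x≢u x∈ =
    lookup⇒[]= x I (trans (sym (lookup∘update′ x≢u I s)) ([]=⇒lookup x∈))

  x∉I⊖x : ∀ (I : Subset n) x → x ∉ I ⊖ x
  x∉I⊖x I x x∈ with trans (sym (lookup∘update x I outside)) ([]=⇒lookup x∈)
  ... | ()

  ∈⊖⁻ : ∀ {I : Subset n} {x u} → x ∈ I ⊖ u → x ∈ I × x ≢ u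
  ∈⊖⁻ {I = I} {x} {u} x∈ = x∈[]≔⁻ x≢u x∈ , x≢u
    where
    x≢u : x ≢ u
    x≢u refl = x∉I⊖x I u x∈

  ⊖-⊆ : ∀ {I : Subset n} {u} → I ⊖ u ⊆ I
  ⊖-⊆ = proj₁ ∘ ∈⊖⁻

  ⊆-⊕ : ∀ {I : Subset n} {u} → I ⊆ I ⊕ u
  ⊆-⊕ {I = I} {u} {x} x∈ with x ≟ u
  ... | yes refl = []≔-updates I u
  ... | no x≢u   = x∈[]≔⁺ x≢u x∈

  ∣⊖∣ : ∀ {I : Subset n} {u} → u ∈ I → ∣ I ∣ ≡ suc ∣ I ⊖ u ∣
  ∣⊖∣ here                          = refl
  ∣⊖∣ {I = inside  ∷ I} (there u∈) = cong suc (∣⊖∣ u∈)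
  ∣⊖∣ {I = outside ∷ I} (there u∈) = ∣⊖∣ u∈

  χ-mono : ∀ (u : Fin n) {I J} → (u ∈ I → u ∈ J) → χ u I ≤ χ u J
  χ-mono u {I} {J} h with lookup I u in eq
  ... | false = z≤n
  ... | true rewrite []=⇒lookup (h (lookup⇒[]= u I eq)) = ≤-refl

  χ≤1 : ∀ (u : Fin n) I → χ u I ≤ 1
  χ≤1 u I with lookup I u
  ... | false = z≤n
  ... | true  = ≤-refl

  χ≡𝟙 : ∀ (u : Fin n) I → χ u I ≡ 𝟙 (u ∈? I)
  χ≡𝟙 u I with u ∈? I | lookup I u in eq
  ... | yes _  | true  = refl
  ... | no u∉  | true  = contradiction (lookup⇒[]= u I eq) u∉
  ... | yes u∈ | false = contradiction (trans (sym eq) ([]=⇒lookup u∈)) λ ()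
  ... | no _   | false = refl

  elements : Subset n → List (Fin n)
  elements {n} p = filter (_∈? p) (allFin n)

  ∈-elements⁻ : ∀ {p : Subset n} {u} → u ∈ˡ elements p → u ∈ p
  ∈-elements⁻ {p = p} u∈ = proj₂ (∈-filter⁻ (_∈? p) {xs = allFin _} u∈)

  ∈-elements⁺ : ∀ {p : Subset n} {u} → u ∈ p → u ∈ˡ elements p
  ∈-elements⁺ {p = p} u∈ = ∈-filter⁺ (_∈? p) (∈-allFin _) u∈

  length-elements : ∀ (p : Subset n) → length (elements p) ≡ ∣ p ∣
  length-elements {n} p = trans (length-filter-∑ (_∈? p) (allFin n))
    (trans (∑-cong (allFin n) λ u _ → sym (χ≡𝟙 u p)) (∑-χ p))

  module _ {a b : ℕ} where

    -- Iterates `μ-increasing`: the occupancy product collected so far is itself increasing, so it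
    -- joins `f` in the weight for the next vertex.
    μ-increasing* : ∀ us {f : Subset n → ℕ} → (∀ u → u ∈ˡ us → ∀ I → f I ≤ f (I ⊕ u)) →
                    a ^ length us * μ a b f ≤ (a + b) ^ length us * μ a b (λ I → ∏ us (λ u → χ u I) * f I)
    μ-increasing* []       {f} h = *-monoʳ-≤ 1 (μ-mono λ I → ≤-reflexive (sym (*-identityˡ (f I))))
    μ-increasing* (u ∷ us) {f} h = begin
      a * a ^ l * μ a b f                      ≡⟨ *-assoc a (a ^ l) _ ⟩
      a * (a ^ l * μ a b f)                    ≤⟨ *-monoʳ-≤ a (μ-increasing* us λ w w∈ → h w (there w∈)) ⟩
      a * (s ^ l * μ a b g)                    ≡⟨ eq a (s ^ l) _ ⟩
      s ^ l * (a * μ a b g)                    ≤⟨ *-monoʳ-≤ (s ^ l) (μ-increasing {a} {b} u g-incr) ⟩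
      s ^ l * (s * μ a b (λ I → χ u I * g I))  ≡⟨ cong (λ z → s ^ l * (s * z)) (μ-cong λ I → sym (*-assoc (χ u I) _ (f I))) ⟩
      s ^ l * (s * z)                          ≡⟨ eq′ s (s ^ l) z ⟩
      s * s ^ l * z                            ∎
      where
      s = a + b
      l = length us
      g = λ I → ∏ us (λ u → χ u I) * f I
      z = μ a b (λ I → χ u I * ∏ us (λ u → χ u I) * f I)
      g-incr : ∀ I → g I ≤ g (I ⊕ u)
      g-incr I = *-mono-≤ (∏-mono us λ w _ → χ-mono w {I} ⊆-⊕) (h u (here refl) I)
      eq : ∀ a x y → a * (x * y) ≡ x * (a * y)
      eq = solve-∀
      eq′ : ∀ s x y → x * (s * y) ≡ s * x * y
      eq′ = solve-∀

  AgreeOff : Fin n → Subset n → Subset n → Set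
  AgreeOff w I J = ∀ {x} → x ≢ w → (x ∈ I → x ∈ J) × (x ∈ J → x ∈ I)

  agreeOff-[]≔ : ∀ {I : Subset n} {w s} → AgreeOff w I (I [ w ]≔ s)
  agreeOff-[]≔ x≢w = x∈[]≔⁺ x≢w , x∈[]≔⁻ x≢w

  agreeOff-sym : ∀ {I J : Subset n} {w} → AgreeOff w I J → AgreeOff w J I
  agreeOff-sym h x≢w = proj₂ (h x≢w) , proj₁ (h x≢w)

  choose : {P : Set} → ℕ → ℕ → Dec P → ℕ
  choose x y (yes _) = x
  choose x y (no _)  = y

  choose-cong : ∀ {P Q : Set} {x y} (p : Dec P) (q : Dec Q) → (P → Q) → (Q → P) → choose x y p ≡ choose x y q
  choose-cong (yes p) (yes q) f g = refl
  choose-cong (yes p) (no ¬q) f g = contradiction (f p) ¬q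
  choose-cong (no ¬p) (yes q) f g = contradiction (g q) ¬p
  choose-cong (no ¬p) (no ¬q) f g = refl

  module _ {n : ℕ} (G : Hypergraph n) where

    -- A containment form of weak independence in which `r` does not occur; `i≤μ` links it to the
    -- sets being counted, through uniformity.
    Independent : Subset n → Set
    Independent I = All (λ e → ¬ e ⊆ I) (edges G)

    independent? : ∀ I → Dec (Independent I)
    independent? I = all? (λ e → ¬? (e ⊆? I)) (edges G)

    ind : Subset n → ℕ
    ind I = 𝟙 (independent? I)

    module _ (v : Fin n) where

      -- Testing `f ⊖ u`, for edges avoiding `v` only, makes the outcome independent of whether `u`
      -- or `v` lies in `I`.
      Unblocked : Subset n → Fin n → Set
      Unblocked I u = All (λ f → u ∈ f → v ∉ f → ¬ f ⊖ u ⊆ I) (edges G)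

      unblocked? : ∀ I u → Dec (Unblocked I u)
      unblocked? I u = all? (λ f → u ∈? f →-dec (¬? (v ∈? f) →-dec ¬? (f ⊖ u ⊆? I))) (edges G)

      Free : Subset n → Subset n → Set
      Free I e = All (Unblocked I) (elements (e ⊖ v))

      free? : ∀ I e → Dec (Free I e)
      free? I e = all? (unblocked? I) (elements (e ⊖ v))

      edgesAt : List (Subset n)
      edgesAt = filter (v ∈?_) (edges G)

      ∈-edgesAt⁻ : ∀ {e} → e ∈ˡ edgesAt → e ∈ˡ edges G × v ∈ e
      ∈-edgesAt⁻ = ∈-filter⁻ (v ∈?_) {xs = edges G}

      ∈⊖⇒neighbours : ∀ {e u} → e ∈ˡ edgesAt → u ∈ e ⊖ v → Neighbours G u v
      ∈⊖⇒neighbours e∈ u∈ with ∈-edgesAt⁻ e∈ | ∈⊖⁻ u∈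
      ... | e∈E , v∈e | u∈e , u≢v = u≢v , _ , e∈E , u∈e , v∈e

      module _ (no-cross : NoCrossEdges G) where

        -- The absence of cross-edges enters here. An edge `f` that avoids `v` and contains its
        -- neighbour `u` cannot contain another neighbour of `v`; moreover `u` is deleted from
        -- `f ⊖ u`, and `v` is not in `f`. So no change at `w` affects the test.
        unblocked-resp : ∀ {I J w u} → w ≡ v ⊎ Neighbours G w v → Neighbours G u v → AgreeOff w I J →
                         Unblocked I u → Unblocked J u
        unblocked-resp {I} {J} {w} {u} w-near u-near agree ub = All.tabulate λ {f} f∈ u∈f v∉f f⊆J →
          All.lookup ub f∈ u∈f v∉f λ {x} x∈ → go f∈ u∈f v∉f f⊆J w-near x∈ (x ≟ w)
          where
          go : ∀ {f x} → f ∈ˡ edges G → u ∈ f → v ∉ f → f ⊖ u ⊆ J → w ≡ v ⊎ Neighbours G w v →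
               x ∈ f ⊖ u → Dec (x ≡ w) → x ∈ I
          go f∈ u∈f v∉f f⊆J _ x∈ (no x≢w) = proj₂ (agree x≢w) (f⊆J x∈)
          go f∈ u∈f v∉f f⊆J (inj₁ refl) x∈ (yes refl) = contradiction (⊖-⊆ x∈) v∉f
          go f∈ u∈f v∉f f⊆J (inj₂ w-nb) x∈ (yes refl) with ∈⊖⁻ x∈
          ... | w∈f , w≢u = contradiction (f∈ , v∉f , _ , _ , w≢u , w-nb , u-near , w∈f , u∈f) (no-cross v _)

        free-resp : ∀ {I J w e} → w ≡ v ⊎ Neighbours G w v → e ∈ˡ edgesAt → AgreeOff w I J →
                    Free I e → Free J e
        free-resp w-near e∈ agree fr = All.tabulate λ u∈ →
          unblocked-resp w-near (∈⊖⇒neighbours e∈ (∈-elements⁻ u∈)) agree (All.lookup fr u∈)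

      unblocked-∈ : ∀ {I u} → Independent I → u ∈ I → Unblocked I u
      unblocked-∈ {I} {u} indI u∈I = All.tabulate λ {f} f∈ _ _ f⊆I → All.lookup indI f∈ λ {x} x∈ → go f⊆I x∈ (x ≟ u)
        where
        go : ∀ {f x} → f ⊖ u ⊆ I → x ∈ f → Dec (x ≡ u) → x ∈ I
        go f⊆I x∈ (yes refl) = u∈I
        go f⊆I x∈ (no x≢u)   = f⊆I (x∈[]≔⁺ x≢u x∈)

      unblocked-⊖ : ∀ {I u} → Unblocked I u → Unblocked (I ⊖ u) u
      unblocked-⊖ ub = All.map (λ h u∈ v∉ f⊆ → h u∈ v∉ λ x∈ → ⊖-⊆ (f⊆ x∈)) ub

      -- An edge inside `I ⊕ u` but not inside `I` contains `u`, and avoids `v` because `v` is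
      -- neither in `I` nor equal to `u`. Such an edge would block `u`.
      independent-⊕ : ∀ {I u} → v ∉ I → u ≢ v → Unblocked I u → Independent I → Independent (I ⊕ u)
      independent-⊕ {I} {u} v∉I u≢v ub indI = All.tabulate λ {f} f∈ f⊆ → go f∈ f⊆ (u ∈? f)
        where
        go : ∀ {f} → f ∈ˡ edges G → f ⊆ I ⊕ u → ¬ Dec (u ∈ f)
        go f∈ f⊆ (no u∉f)  = All.lookup indI f∈ λ {x} x∈ → x∈[]≔⁻ (λ { refl → u∉f x∈ }) (f⊆ x∈)
        go f∈ f⊆ (yes u∈f) = All.lookup ub f∈ u∈f
          (λ v∈f → v∉I (x∈[]≔⁻ (u≢v ∘ sym) (f⊆ v∈f)))
          λ x∈ → let x∈f , x≢u = ∈⊖⁻ x∈ in x∈[]≔⁻ x≢u (f⊆ x∈f)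

    independent-⊖ : ∀ {I u} → Independent I → Independent (I ⊖ u)
    independent-⊖ = All.map λ h f⊆ → h λ x∈ → ⊖-⊆ (f⊆ x∈)

    module _ {a b : ℕ} where

      -- An independent set contains u only if u is unblocked, and then u is free to be removed.
      μ-ind-∈ : ∀ v u → (a + b) * μ a b (λ I → χ u I * ind I) ≤ a * μ a b (λ I → 𝟙 (unblocked? v I u) * ind I)
      μ-ind-∈ v u = μ-contains {a} {b} u stay remove
        where
        stay : ∀ I → u ∈ I → ind I ≤ 𝟙 (unblocked? v I u) * ind I
        stay I u∈ with independent? I | unblocked? v I u
        ... | no _  | _      = z≤n
        ... | yes p | yes _  = ≤-refl
        ... | yes p | no ¬ub = contradiction (unblocked-∈ v p u∈) ¬ub
        remove : ∀ I → u ∈ I → ind I ≤ 𝟙 (unblocked? v (I ⊖ u) u) * ind (I ⊖ u)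
        remove I u∈ with independent? I | unblocked? v (I ⊖ u) u | independent? (I ⊖ u)
        ... | no _  | _      | _      = z≤n
        ... | yes p | yes _  | yes _  = ≤-refl
        ... | yes p | no ¬ub | _      = contradiction (unblocked-⊖ v {I} (unblocked-∈ v p u∈)) ¬ub
        ... | yes p | yes _  | no ¬p  = contradiction (independent-⊖ p) ¬p

      -- The edges at a vacant vertex.

      module _ (k : ℕ) (uniform : Uniform G (suc k)) (linear : Linear G) (no-cross : NoCrossEdges G)
               (C : ℕ) (C+a^k : C + a ^ k ≡ (a + b) ^ k) (v : Fin n) where

        private
          Q = (a + b) ^ k
          es = edgesAt v

        length-link : ∀ {e} → e ∈ˡ es → length (elements (e ⊖ v)) ≡ k
        length-link {e} e∈ with ∈-edgesAt⁻ v e∈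
        ... | e∈E , v∈e = trans (length-elements (e ⊖ v)) (suc-injective (trans (sym (∣⊖∣ v∈e)) (uniform e e∈E)))

        -- Scaled by `Q` to avoid fractions, like `factor` below, which is `Q` times 1 - q^k =
        -- `C / Q` for a free edge and `Q` times the trivial bound 1 otherwise.
        notContained : Subset n → Subset n → ℕ
        notContained I e = Q * 𝟙 (¬? (e ⊖ v ⊆? I))

        factor : Subset n → Subset n → ℕ
        factor I e = choose C Q (free? v I e)

        base : Subset n → ℕ
        base I = χ̄ v I * ind I

        -- Given v ∉ I, each vertex of e ⊖ v with e free lies in I with conditional probability at least
        -- a / (a + b), since adding it keeps I independent; so I misses one of the k with probability at most C / Q.
        μ-edge : ∀ {e} → e ∈ˡ es → (f : Subset n → ℕ) →
                 (∀ {I u} → u ∈ e ⊖ v → Free v I e → f I ≤ f (I ⊕ u)) →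
                 μ a b (λ I → notContained I e * f I) ≤ μ a b (λ I → factor I e * f I)
        -- `Q * y`, from the sets containing the whole link of a free edge, is added to both sides;
        -- the lower bound `all-in` for this part then bounds the complement from above without
        -- subtraction.
        μ-edge {e} e∈ f f-incr = +-cancelʳ-≤ (Q * y) _ _ (begin
          μ a b (λ I → notContained I e * f I) + Q * y
            ≡⟨ cong (μ a b (λ I → notContained I e * f I) +_) (μ-*ˡ Q _) ⟩
          μ a b (λ I → notContained I e * f I) + μ a b (λ I → Q * (𝟙 (e ⊖ v ⊆? I) * g I))
            ≡⟨ μ-+ _ _ ⟨
          μ a b (λ I → notContained I e * f I + Q * (𝟙 (e ⊖ v ⊆? I) * g I))
            ≤⟨ μ-mono pointwise ⟩
          μ a b (λ I → factor I e * f I + a ^ k * g I)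
            ≡⟨ μ-+ _ _ ⟩
          μ a b (λ I → factor I e * f I) + μ a b (λ I → a ^ k * g I)
            ≡⟨ cong (μ a b (λ I → factor I e * f I) +_) (μ-*ˡ (a ^ k) g) ⟨
          μ a b (λ I → factor I e * f I) + a ^ k * μ a b g
            ≤⟨ +-monoʳ-≤ (μ a b (λ I → factor I e * f I)) all-in ⟩
          μ a b (λ I → factor I e * f I) + Q * y ∎)
          where
          us = elements (e ⊖ v)
          g = λ I → 𝟙 (free? v I e) * f I
          y = μ a b (λ I → 𝟙 (e ⊖ v ⊆? I) * g I)

          g-incr : ∀ u → u ∈ˡ us → ∀ I → g I ≤ g (I ⊕ u)
          g-incr u u∈ I with free? v I e | free? v (I ⊕ u) e
          ... | no _   | _      = z≤n
          ... | yes fr | yes _  = *-monoʳ-≤ 1 (f-incr (∈-elements⁻ u∈) fr)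
          ... | yes fr | no ¬fr = contradiction
            (free-resp v no-cross (inj₂ (∈⊖⇒neighbours v e∈ (∈-elements⁻ u∈))) e∈ agreeOff-[]≔ fr) ¬fr

          ∏≤𝟙 : ∀ I → ∏ us (λ u → χ u I) ≤ 𝟙 (e ⊖ v ⊆? I)
          ∏≤𝟙 I with e ⊖ v ⊆? I
          ... | yes _ = ≤-trans (∏-mono us λ u _ → χ≤1 u I)
                          (≤-reflexive (trans (∏-const us 1) (^-zeroˡ (length us))))
          ... | no ⊈  = ≤-reflexive (∏≡0 us λ h → ⊈ λ u∈ → h _ (∈-elements⁺ u∈))
            where
            ∏≡0 : ∀ us → ¬ (∀ u → u ∈ˡ us → u ∈ I) → ∏ us (λ u → χ u I) ≡ 0
            ∏≡0 []       h = contradiction (λ _ ()) h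
            ∏≡0 (u ∷ us) h with lookup I u in eq
            ... | false = refl
            ... | true  = trans (*-identityˡ _) (∏≡0 us λ h′ → h λ
              { _ (here refl) → lookup⇒[]= u I eq
              ; w (there w∈) → h′ w w∈ })

          all-in : a ^ k * μ a b g ≤ Q * y
          all-in = ≤-trans
            (subst (λ l → a ^ l * μ a b g ≤ (a + b) ^ l * μ a b (λ I → ∏ us (λ u → χ u I) * g I))
              (length-link e∈) (μ-increasing* us g-incr))
            (*-monoʳ-≤ Q (μ-mono λ I → *-monoˡ-≤ (g I) (∏≤𝟙 I)))

          pointwise : ∀ I → notContained I e * f I + Q * (𝟙 (e ⊖ v ⊆? I) * g I) ≤ factor I e * f I + a ^ k * g I
          pointwise I with free? v I e | e ⊖ v ⊆? I
          ... | yes _ | yes _ = ≤-reflexive (trans (cong (λ q → q * 0 * f I + q * (1 * (1 * f I))) (sym C+a^k)) (eq C (a ^ k) (f I)))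
            where
            eq : ∀ C P x → (C + P) * 0 * x + (C + P) * (1 * (1 * x)) ≡ C * x + P * (1 * x)
            eq = solve-∀
          ... | yes _ | no _  = ≤-reflexive (trans (cong (λ q → q * 1 * f I + q * 0) (sym C+a^k)) (eq C (a ^ k) (f I)))
            where
            eq : ∀ C P x → (C + P) * 1 * x + (C + P) * 0 ≡ C * x + P * (1 * x)
            eq = solve-∀
          ... | no _  | yes _ = ≤-from-+ (Q * f I) (eq Q (f I) (a ^ k))
            where
            eq : ∀ Q x P → Q * 0 * x + Q * 0 + Q * x ≡ Q * x + P * 0
            eq = solve-∀
          ... | no _  | no _  = ≤-reflexive (eq Q (f I) (a ^ k))
            where
            eq : ∀ Q x P → Q * 1 * x + Q * 0 ≡ Q * x + P * 0
            eq = solve-∀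

        base-incr : ∀ {e I u} → u ∈ e ⊖ v → Free v I e → base I ≤ base (I ⊕ u)
        base-incr {e} {I} {u} u∈ fr
          rewrite lookup∘update′ (proj₂ (∈⊖⁻ {I = e} u∈) ∘ sym) I inside with lookup I v in eq
        ... | true  = z≤n
        ... | false = *-monoʳ-≤ 1 (𝟙-mono (independent? I) (independent? (I ⊕ u))
          (independent-⊕ v (λ v∈ → contradiction (trans (sym eq) ([]=⇒lookup v∈)) λ ())
            (proj₂ (∈⊖⁻ {I = e} u∈)) (All.lookup fr (∈-elements⁺ u∈))))

        -- By linearity distinct edges at `v` share only `v`, so `u` lies outside the link of `f`
        -- and adding it cannot complete that link.
        notContained-⊕ : ∀ {e f u} I → e ∈ˡ es → f ∈ˡ es → e ≢ f → u ∈ e ⊖ v →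
                         notContained I f ≤ notContained (I ⊕ u) f
        notContained-⊕ {e} {f} {u} I e∈ f∈ e≢f u∈ = *-monoʳ-≤ Q (𝟙-mono (¬? (f ⊖ v ⊆? I)) (¬? (f ⊖ v ⊆? I ⊕ u))
          λ ⊈ ⊆⊕ → ⊈ λ {x} x∈ → x∈[]≔⁻ (λ { refl → e≢f (common (proj₁ (∈⊖⁻ {I = f} x∈))) }) (⊆⊕ x∈))
          where
          common : u ∈ f → e ≡ f
          common u∈f with ∈-edgesAt⁻ v e∈ | ∈-edgesAt⁻ v f∈ | ∈⊖⁻ {I = e} u∈
          ... | e∈E , v∈e | f∈E , v∈f | u∈e , u≢v = linear u v u≢v e f e∈E f∈E u∈e v∈e u∈f v∈f

        factor-resp : ∀ {I J w e} → w ≡ v ⊎ Neighbours G w v → e ∈ˡ es → AgreeOff w I J → factor I e ≡ factor J e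
        factor-resp {I} {J} {e = e} near e∈ agree = choose-cong (free? v I e) (free? v J e)
          (free-resp v no-cross near e∈ agree) (free-resp v no-cross near e∈ (agreeOff-sym agree))

        -- The edges are replaced one at a time. Adding a link vertex of the current edge does not
        -- lower the indicators still to be replaced, by linearity, and leaves the factors already
        -- moved into `R` unchanged, as there are no cross-edges. So `μ-edge` applies with all the
        -- rest as its `f`.
        μ-edges : ∀ xs → Unique xs → (∀ {e} → e ∈ˡ xs → e ∈ˡ es) → (R : Subset n → ℕ) →
                  (∀ {e I u} → e ∈ˡ xs → u ∈ e ⊖ v → R I ≤ R (I ⊕ u)) →
                  μ a b (λ I → base I * R I * ∏ xs (notContained I)) ≤ μ a b (λ I → base I * R I * ∏ xs (factor I))
        μ-edges []       _                xs⊆ R R-incr = ≤-refl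
        μ-edges (e ∷ xs) (e∉xs ∷ xs-uniq) xs⊆ R R-incr = begin
          μ a b (λ I → base I * R I * (notContained I e * ∏ xs (notContained I)))
            ≡⟨ μ-cong (λ I → eq₁ (base I) (R I) (notContained I e) _) ⟩
          μ a b (λ I → notContained I e * (base I * R I * ∏ xs (notContained I)))
            ≤⟨ μ-edge (xs⊆ (here refl)) _ (λ {I} u∈ fr → *-mono-≤ (*-mono-≤ (base-incr u∈ fr) (R-incr (here refl) u∈))
                 (∏-mono xs λ f f∈ → notContained-⊕ I (xs⊆ (here refl)) (xs⊆ (there f∈)) (All.lookup e∉xs f∈) u∈)) ⟩
          μ a b (λ I → factor I e * (base I * R I * ∏ xs (notContained I)))
            ≡⟨ μ-cong (λ I → eq₂ (base I) (R I) (factor I e) _) ⟩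
          μ a b (λ I → base I * (R I * factor I e) * ∏ xs (notContained I))
            ≤⟨ μ-edges xs xs-uniq (xs⊆ ∘ there) (λ I → R I * factor I e) (λ {f} {I} {u} f∈ u∈ → *-mono-≤ (R-incr (there f∈) u∈)
                 (≤-reflexive (factor-resp (inj₂ (∈⊖⇒neighbours v (xs⊆ (there f∈)) u∈)) (xs⊆ (here refl)) agreeOff-[]≔))) ⟩
          μ a b (λ I → base I * (R I * factor I e) * ∏ xs (factor I))
            ≡⟨ μ-cong (λ I → eq₃ (base I) (R I) (factor I e) _) ⟩
          μ a b (λ I → base I * R I * (factor I e * ∏ xs (factor I))) ∎
          where
          eq₁ : ∀ b r x y → b * r * (x * y) ≡ x * (b * r * y)
          eq₁ = solve-∀
          eq₂ : ∀ b r x y → x * (b * r * y) ≡ b * (r * x) * y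
          eq₂ = solve-∀
          eq₃ : ∀ b r x y → b * (r * x) * y ≡ b * r * (x * y)
          eq₃ = solve-∀

  -- Elementary inequalities

  ^-distribʳ-* : ∀ k a b → (a * b) ^ k ≡ a ^ k * b ^ k
  ^-distribʳ-* zero    a b = refl
  ^-distribʳ-* (suc k) a b = trans (cong (a * b *_) (^-distribʳ-* k a b)) (eq a b (a ^ k) (b ^ k))
    where
    eq : ∀ a b x y → a * b * (x * y) ≡ a * x * (b * y)
    eq = solve-∀

  module _ (C P : ℕ) where

    private
      Q = C + P

    -- The difference `Q ^ m − C ^ m` without subtraction, as `P` times the sum of
    -- `Q ^ i * C ^ (m − 1 − i)` over `i < m`.
    gap : ℕ → ℕ
    gap zero    = 0
    gap (suc m) = P * Q ^ m + C * gap m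

    ^≡^+gap : ∀ m → Q ^ m ≡ C ^ m + gap m
    ^≡^+gap zero    = refl
    ^≡^+gap (suc m) = trans (*-distribʳ-+ (Q ^ m) C P)
      (trans (cong (λ x → C * x + P * Q ^ m) (^≡^+gap m)) (eq C (C ^ m) (gap m) (P * Q ^ m)))
      where
      eq : ∀ c y e x → c * (y + e) + x ≡ c * y + (x + c * e)
      eq = solve-∀

    -- Expanding `gap m` as a geometric sum and pairing index `i` with `m − 1 − i`, the right side
    -- becomes `P` times `m` sums of two terms whose product is `(Q * C) ^ (2 * m)`; AM-GM bounds
    -- each from below by `2 * (Q * C) ^ m`. In the induction the surplus of a step is
    -- `P * E′ * E′`.
    gap-lower : ∀ m → 2 * m * C ^ m * P * Q ^ m ≤ gap m * (Q * Q ^ m + C * C ^ m)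
    gap-lower zero    = z≤n
    gap-lower (suc m) with Q ^ m | ^≡^+gap m | gap-lower m
    ... | _ | refl | ih = begin
      2 * suc m * (C * Y) * P * (Q * (Y + E))                     ≡⟨ eq₁ m Q C P Y (Y + E) ⟩
      C * Q * (2 * m * Y * P * (Y + E)) + 2 * C * Y * P * Q * (Y + E)
        ≤⟨ +-monoˡ-≤ _ (*-monoʳ-≤ (C * Q) ih) ⟩
      C * Q * (E * (Q * (Y + E) + C * Y)) + 2 * C * Y * P * Q * (Y + E)
        ≤⟨ ≤-from-+ (P * E′ * E′) (eq₂ C P Y E) ⟩
      E′ * (Q * (Q * (Y + E)) + C * (C * Y)) ∎
      where
      Y = C ^ m
      E = gap m
      E′ = P * (Y + E) + C * E
      eq₁ : ∀ m Q C P Y W → 2 * suc m * (C * Y) * P * (Q * W) ≡ C * Q * (2 * m * Y * P * W) + 2 * C * Y * P * Q * W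
      eq₁ = solve-∀
      eq₂ : ∀ C P Y E →
        C * (C + P) * (E * ((C + P) * (Y + E) + C * Y)) + 2 * C * Y * P * (C + P) * (Y + E)
          + P * (P * (Y + E) + C * E) * (P * (Y + E) + C * E) ≡
        (P * (Y + E) + C * E) * ((C + P) * ((C + P) * (Y + E)) + C * (C * Y))
      eq₂ = solve-∀

    -- With c = C / Q these lemmas say that (1 − c ^ m) / (1 + c ^ m) = tanh (m log (1/c) / 2),
    -- divided by m, is decreasing in m.
    tanh-step : ∀ m → m * gap (suc m) * (Q ^ m + C ^ m) ≤ suc m * gap m * (Q ^ suc m + C ^ suc m)
    tanh-step m with Q ^ m | ^≡^+gap m | gap-lower m
    ... | _ | refl | h = begin
      m * (P * (Y + E) + C * E) * (Y + E + Y)            ≡⟨ eq₁ m C P Y E ⟩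
      m * E * F′ + 2 * m * Y * P * (Y + E)               ≤⟨ +-monoʳ-≤ (m * E * F′) h ⟩
      m * E * F′ + E * F′                                ≡⟨ eq₂ m E F′ ⟩
      suc m * E * F′ ∎
      where
      Y = C ^ m
      E = gap m
      F′ = (C + P) * (Y + E) + C * Y
      eq₁ : ∀ m C P Y E → m * (P * (Y + E) + C * E) * (Y + E + Y) ≡
                          m * E * ((C + P) * (Y + E) + C * Y) + 2 * m * Y * P * (Y + E)
      eq₁ = solve-∀
      eq₂ : ∀ m E F → m * E * F + E * F ≡ suc m * E * F
      eq₂ = solve-∀

    module _ .{{_ : NonZero Q}} where

      tanh-mono : ∀ m j → m * gap (m + j) * (Q ^ m + C ^ m) ≤ (m + j) * gap m * (Q ^ (m + j) + C ^ (m + j))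
      tanh-mono zero      j       = z≤n
      tanh-mono m@(suc _) zero    =
        subst (λ d → m * gap d * (Q ^ m + C ^ m) ≤ d * gap m * (Q ^ d + C ^ d)) (sym (+-identityʳ m)) ≤-refl
      tanh-mono m@(suc _) (suc j) =
        subst (λ d → m * gap d * (Q ^ m + C ^ m) ≤ d * gap m * (Q ^ d + C ^ d)) (sym (+-suc m j))
        (*-cancelʳ-≤ _ _ (d * F d) {{m*n≢0 d (F d) {{_}} {{F≢0}}}} (begin
        m * gap (suc d) * F m * (d * F d)             ≡⟨ eq₁ m (gap (suc d)) (F m) d (F d) ⟩
        m * F m * (d * gap (suc d) * F d)             ≤⟨ *-monoʳ-≤ (m * F m) (tanh-step d) ⟩
        m * F m * (suc d * gap d * F (suc d))         ≡⟨ eq₂ m (F m) d (gap d) (F (suc d)) ⟩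
        m * gap d * F m * (suc d * F (suc d))         ≤⟨ *-monoˡ-≤ (suc d * F (suc d)) (tanh-mono m j) ⟩
        d * gap m * F d * (suc d * F (suc d))         ≡⟨ eq₃ d (gap m) (F d) (F (suc d)) ⟩
        suc d * gap m * F (suc d) * (d * F d)         ∎))
        where
        d = m + j
        F = λ m → Q ^ m + C ^ m
        F≢0 : NonZero (F d)
        F≢0 = >-nonZero (<-≤-trans (m^n>0 Q d) (m≤m+n (Q ^ d) (C ^ d)))
        eq₁ : ∀ m g f d h → m * g * f * (d * h) ≡ m * f * (d * g * h)
        eq₁ = solve-∀
        eq₂ : ∀ m f d g h → m * f * (suc d * g * h) ≡ m * g * f * (suc d * h)
        eq₂ = solve-∀
        eq₃ : ∀ d g f h → d * g * f * (suc d * h) ≡ suc d * g * h * (d * f)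
        eq₃ = solve-∀

      -- With `d = m + j` and `c = C / Q` this reads (d + m)(c^m - c^d) ≤ d - m. Clearing
      -- denominators in the tanh comparison gives the sharper right side (d - m)(1 - c^(d + m));
      -- the term `j * Y * U` dropped in `scaled` is the difference.
      free-edges-bound : ∀ m j → (2 * m + j) * (C ^ m * Q ^ j) ≤ j * Q ^ (m + j) + (2 * m + j) * C ^ (m + j)
      free-edges-bound m j = *-cancelˡ-≤ (Q ^ m) {{m^n≢0 Q m}} (begin
        Q ^ m * ((2 * m + j) * (C ^ m * Q ^ j))     ≡⟨ eq₁ (Q ^ m) (2 * m + j) (C ^ m) (Q ^ j) ⟩
        (2 * m + j) * C ^ m * (Q ^ m * Q ^ j)       ≡⟨ cong ((2 * m + j) * C ^ m *_) (^-distribˡ-+-* Q m j) ⟨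
        (2 * m + j) * C ^ m * Q ^ (m + j)           ≤⟨ scaled (tanh-mono m j) (^≡^+gap m) (^≡^+gap (m + j)) ⟩
        j * Q ^ m * Q ^ (m + j) + (2 * m + j) * C ^ (m + j) * Q ^ m ≡⟨ eq₂ j (Q ^ m) (Q ^ (m + j)) (2 * m + j) (C ^ (m + j)) ⟩
        Q ^ m * (j * Q ^ (m + j) + (2 * m + j) * C ^ (m + j)) ∎)
        where
        eq₁ : ∀ w x y q → w * (x * (y * q)) ≡ x * y * (w * q)
        eq₁ = solve-∀
        eq₂ : ∀ j w v x u → j * w * v + x * u * w ≡ w * (j * v + x * u)
        eq₂ = solve-∀
        eq₃ : ∀ m j Y E U D →
              (2 * m + j) * Y * (U + D) + (j * Y * U + (m + j) * E * (U + D + U)) ≡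
              j * (Y + E) * (U + D) + (2 * m + j) * U * (Y + E) + m * D * (Y + E + Y)
        eq₃ = solve-∀
        scaled : ∀ {W Y E V U D} → m * D * (W + Y) ≤ (m + j) * E * (V + U) → W ≡ Y + E → V ≡ U + D →
                 (2 * m + j) * Y * V ≤ j * W * V + (2 * m + j) * U * W
        scaled {Y = Y} {E} {U = U} {D} h refl refl = +-cancelʳ-≤ (m * D * (Y + E + Y)) _ _ (begin
          (2 * m + j) * Y * (U + D) + m * D * (Y + E + Y)
            ≤⟨ +-monoʳ-≤ ((2 * m + j) * Y * (U + D)) (≤-trans h (m≤n+m _ (j * Y * U))) ⟩
          (2 * m + j) * Y * (U + D) + (j * Y * U + (m + j) * E * (U + D + U))
            ≡⟨ eq₃ m j Y E U D ⟩
          j * (Y + E) * (U + D) + (2 * m + j) * U * (Y + E) + m * D * (Y + E + Y) ∎)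

  -- For t = P / Q this is (1 + d t / 2)^2 ≤ (1 + t)^d, the Bernoulli inequality with exponent d / 2
  -- squared. The induction starts from equality at `d = 2`.
  ^-quadratic : ∀ Q P e → let d = 2 + e in Q ^ d * ((2 * Q + d * P) * (2 * Q + d * P)) ≤ 4 * (Q + P) ^ d * (Q * Q)
  ^-quadratic Q P zero    = ≤-reflexive (eq Q P)
    where
    eq : ∀ Q P → Q * (Q * 1) * ((2 * Q + 2 * P) * (2 * Q + 2 * P)) ≡ 4 * ((Q + P) * ((Q + P) * 1)) * (Q * Q)
    eq = solve-∀
  ^-quadratic Q P (suc e) = begin
    Q * Q ^ d * (T′ * T′)                  ≤⟨ ≤-from-+ (Q ^ d * P * (Q * P * (3 + 2 * e) + (d * P) * (d * P))) (eq₁ Q (Q ^ d) P e) ⟩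
    (Q + P) * (Q ^ d * (T * T))            ≤⟨ *-monoʳ-≤ (Q + P) (^-quadratic Q P e) ⟩
    (Q + P) * (4 * (Q + P) ^ d * (Q * Q))  ≡⟨ eq₂ (Q + P) ((Q + P) ^ d) (Q * Q) ⟩
    4 * ((Q + P) * (Q + P) ^ d) * (Q * Q)  ∎
    where
    d = 2 + e
    T = 2 * Q + d * P
    T′ = 2 * Q + suc d * P
    eq₁ : ∀ Q x P e → Q * x * ((2 * Q + (3 + e) * P) * (2 * Q + (3 + e) * P))
            + x * P * (Q * P * (3 + 2 * e) + ((2 + e) * P) * ((2 + e) * P)) ≡
          (Q + P) * (x * ((2 * Q + (2 + e) * P) * (2 * Q + (2 + e) * P)))
    eq₁ = solve-∀
    eq₂ : ∀ q x y → q * (4 * x * y) ≡ 4 * (q * x) * y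
    eq₂ = solve-∀

  -- With q = a / (a + b) this reads (1 − q ^ k) ^ d = O (1 / (M q) ^ 2).
  decay : ∀ a b M k d C .{{_ : NonZero b}} .{{_ : NonZero k}} → a ≤ b → M ^ k ≤ d → C + a ^ k ≡ (a + b) ^ k →
          C ^ d * ((b + M * a) * (2 * b + M * a)) ≤ 16 * (b * b) * ((a + b) ^ k) ^ d
  -- If M q ≤ 1, the bracket is at most 12 b^2 and `C ≤ Q` suffices. If M q ≥ 1, then 1 - x ≤ 1 / (1
  -- + x) for x = q^k reduces the claim to quadratic growth of (1 + x)^d.
  decay a b M k@(suc k′) d C a≤b M^k≤d C+P≡Q with ≤-total (M * a) (a + b)
  ... | inj₁ Ma≤s = begin
      C ^ d * ((b + M * a) * (2 * b + M * a))  ≤⟨ *-mono-≤ (^-monoˡ-≤ d C≤Q) (*-mono-≤ (+-monoʳ-≤ b Ma≤2b) (+-monoʳ-≤ (2 * b) Ma≤2b)) ⟩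
      Q ^ d * ((b + (b + b)) * (2 * b + (b + b)))  ≤⟨ ≤-from-+ (Q ^ d * 4 * (b * b)) (eq (Q ^ d) b) ⟩
      16 * (b * b) * Q ^ d                     ∎
    where
    Q = (a + b) ^ k
    C≤Q : C ≤ Q
    C≤Q = ≤-trans (m≤m+n C (a ^ k)) (≤-reflexive C+P≡Q)
    Ma≤2b : M * a ≤ b + b
    Ma≤2b = ≤-trans Ma≤s (+-monoˡ-≤ b a≤b)
    eq : ∀ q b → q * ((b + (b + b)) * (2 * b + (b + b))) + q * 4 * (b * b) ≡ 16 * (b * b) * q
    eq = solve-∀
  ... | inj₂ s≤Ma = *-cancelʳ-≤ _ _ (Q * Q * Q ^ d) {{m*n≢0 (Q * Q) (Q ^ d) {{m*n≢0 Q Q}} {{m^n≢0 Q d}}}} (begin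
      C ^ d * ((b + x) * (2 * b + x)) * (Q * Q * Q ^ d)
        ≤⟨ *-monoˡ-≤ (Q * Q * Q ^ d) (*-monoʳ-≤ (C ^ d) (*-mono-≤ (+-monoˡ-≤ x b≤2s) (+-monoˡ-≤ x (*-monoʳ-≤ 2 b≤s)))) ⟩
      C ^ d * ((2 * s + x) * (2 * s + x)) * (Q * Q * Q ^ d)
        ≡⟨ eq₁ (C ^ d) (2 * s + x) Q (Q ^ d) ⟩
      C ^ d * Q ^ d * ((2 * s + x) * Q * ((2 * s + x) * Q))
        ≤⟨ *-monoʳ-≤ (C ^ d * Q ^ d) (*-mono-≤ cmp cmp) ⟩
      C ^ d * Q ^ d * ((2 * Q + d * P) * s * ((2 * Q + d * P) * s))
        ≡⟨ eq₂ (C ^ d) (Q ^ d) (2 * Q + d * P) s ⟩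
      C ^ d * (s * s) * (Q ^ d * ((2 * Q + d * P) * (2 * Q + d * P)))
        ≤⟨ *-monoʳ-≤ (C ^ d * (s * s)) (growth d 2≤d) ⟩
      C ^ d * (s * s) * (4 * (Q + P) ^ d * (Q * Q))
        ≡⟨ eq₃ (C ^ d) (s * s) ((Q + P) ^ d) (Q * Q) ⟩
      4 * (s * s) * (Q * Q) * (C ^ d * (Q + P) ^ d)
        ≡⟨ cong (4 * (s * s) * (Q * Q) *_) (^-distribʳ-* d C (Q + P)) ⟨
      4 * (s * s) * (Q * Q) * (C * (Q + P)) ^ d
        ≤⟨ *-mono-≤ (*-monoˡ-≤ (Q * Q) (*-monoʳ-≤ 4 (*-mono-≤ s≤2b s≤2b))) (^-monoˡ-≤ d C[Q+P]≤Q²) ⟩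
      4 * (2 * b * (2 * b)) * (Q * Q) * (Q * Q) ^ d
        ≡⟨ cong (4 * (2 * b * (2 * b)) * (Q * Q) *_) (^-distribʳ-* d Q Q) ⟩
      4 * (2 * b * (2 * b)) * (Q * Q) * (Q ^ d * Q ^ d)
        ≡⟨ eq₄ b Q (Q ^ d) ⟩
      16 * (b * b) * Q ^ d * (Q * Q * Q ^ d) ∎)
    where
    s = a + b
    x = M * a
    P = a ^ k
    Q = s ^ k
    instance
      s≢0 : NonZero s
      s≢0 = >-nonZero (<-≤-trans (>-nonZero⁻¹ b) (m≤n+m b a))
      Q≢0 : NonZero Q
      Q≢0 = m^n≢0 s k
    b≤s : b ≤ s
    b≤s = m≤n+m b a
    b≤2s : b ≤ 2 * s
    b≤2s = ≤-trans b≤s (m≤m+n s _)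
    s≤2b : s ≤ 2 * b
    s≤2b = ≤-trans (+-monoˡ-≤ b a≤b) (≤-reflexive (cong (b +_) (sym (+-identityʳ b))))
    -- Here `M * a ≥ a + b > a` forces `M ≥ 2`, hence `d ≥ M ^ k ≥ 2`, the range of `^-quadratic`.
    2≤M : 2 ≤ M
    2≤M = ≰⇒> λ M≤1 → <⇒≱ (≤-trans (s≤s (≤-trans (*-monoˡ-≤ a M≤1) (≤-reflexive (*-identityˡ a))))
                                (≤-trans (m<m+n a (>-nonZero⁻¹ b)) ≤-refl)) s≤Ma
    2≤d : 2 ≤ d
    2≤d = ≤-trans 2≤M (≤-trans (≤-reflexive (sym (*-identityʳ M)))
            (≤-trans (^-monoʳ-≤ M {{>-nonZero (≤-trans (s≤s z≤n) 2≤M)}} (s≤s (z≤n {k′}))) M^k≤d))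
    growth : ∀ d → 2 ≤ d → Q ^ d * ((2 * Q + d * P) * (2 * Q + d * P)) ≤ 4 * (Q + P) ^ d * (Q * Q)
    growth (suc (suc e)) _ = ^-quadratic Q P e
    growth (suc zero) (s≤s ())
    -- Since M q ≥ 1, M q ≤ (M q)^k ≤ d q^k; the inequality is this one with denominators cleared.
    cmp : (2 * s + x) * Q ≤ (2 * Q + d * P) * s
    cmp = begin
      (2 * s + x) * (s * s ^ k′)          ≡⟨ eq s x (s ^ k′) ⟩
      2 * (s * s ^ k′) * s + x * s ^ k′ * s ≤⟨ +-monoʳ-≤ (2 * (s * s ^ k′) * s) (*-monoˡ-≤ s (begin
        x * s ^ k′     ≤⟨ *-monoʳ-≤ x (^-monoˡ-≤ k′ s≤Ma) ⟩
        x ^ k          ≡⟨ ^-distribʳ-* k M a ⟩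
        M ^ k * P      ≤⟨ *-monoˡ-≤ P M^k≤d ⟩
        d * P          ∎)) ⟩
      2 * Q * s + d * P * s               ≡⟨ *-distribʳ-+ s (2 * Q) (d * P) ⟨
      (2 * Q + d * P) * s                 ∎
      where
      eq : ∀ s x y → (2 * s + x) * (s * y) ≡ 2 * (s * y) * s + x * y * s
      eq = solve-∀
    C[Q+P]≤Q² : C * (Q + P) ≤ Q * Q
    C[Q+P]≤Q² = subst (λ q → C * (q + P) ≤ q * q) C+P≡Q (≤-from-+ (P * P) (eq C P))
      where
      eq : ∀ C P → C * (C + P + P) + P * P ≡ (C + P) * (C + P)
      eq = solve-∀
    eq₁ : ∀ c t Q q → c * (t * t) * (Q * Q * q) ≡ c * q * (t * Q * (t * Q))
    eq₁ = solve-∀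
    eq₂ : ∀ c q t s → c * q * (t * s * (t * s)) ≡ c * (s * s) * (q * (t * t))
    eq₂ = solve-∀
    eq₃ : ∀ c s p q → c * s * (4 * p * q) ≡ 4 * s * q * (c * p)
    eq₃ = solve-∀
    eq₄ : ∀ b Q q → 4 * (2 * b * (2 * b)) * (Q * Q) * (q * q) ≡ 16 * (b * b) * q * (Q * Q * q)
    eq₄ = solve-∀

  -- By convexity the slope of the power at the right end `z + δ` bounds its increase.
  ^-increment : ∀ z δ e → (z + δ) ^ suc e ≤ z ^ suc e + suc e * δ * (z + δ) ^ e
  ^-increment z δ zero    = ≤-reflexive (eq z δ)
    where
    eq : ∀ z δ → (z + δ) * 1 ≡ z * 1 + (δ + 0) * 1
    eq = solve-∀
  ^-increment z δ (suc e) = begin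
    (z + δ) * y                                    ≡⟨ *-distribʳ-+ y z δ ⟩
    z * y + δ * y                                  ≤⟨ +-monoˡ-≤ (δ * y) (*-monoʳ-≤ z (^-increment z δ e)) ⟩
    z * (z ^ suc e + suc e * δ * (z + δ) ^ e) + δ * y ≡⟨ eq₁ z (z ^ suc e) (suc e * δ) ((z + δ) ^ e) (δ * y) ⟩
    z * z ^ suc e + (suc e * δ * (z * (z + δ) ^ e) + δ * y)
      ≤⟨ +-monoʳ-≤ (z * z ^ suc e) (+-monoˡ-≤ (δ * y) (*-monoʳ-≤ (suc e * δ) (*-monoˡ-≤ ((z + δ) ^ e) (m≤m+n z δ)))) ⟩
    z * z ^ suc e + (suc e * δ * y + δ * y)        ≡⟨ eq₂ (z * z ^ suc e) e δ y ⟩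
    z * z ^ suc e + suc (suc e) * δ * y            ∎
    where
    y = (z + δ) ^ suc e
    eq₁ : ∀ z x d y w → z * (x + d * y) + w ≡ z * x + (d * (z * y) + w)
    eq₁ = solve-∀
    eq₂ : ∀ x e d y → x + (suc e * d * y + d * y) ≡ x + suc (suc e) * d * y
    eq₂ = solve-∀

  -- If log z increases by at most T / (e X), then e log z increases by at most T / X.
  power-step : ∀ e X T z z′ .{{_ : NonZero e}} → e * X * z′ ≤ e * X * z + T * z′ → X * z′ ^ e ≤ X * z ^ e + T * z′ ^ e
  power-step e@(suc e′) X T z z′ h with ≤-total z′ z
  ... | inj₁ z′≤z = ≤-trans (*-monoʳ-≤ X (^-monoˡ-≤ e z′≤z)) (m≤m+n _ _)
  ... | inj₂ z≤z′ with m≤n⇒∃[o]m+o≡n z≤z′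
  ... | δ , refl = begin
    X * y ^ e                               ≤⟨ *-monoʳ-≤ X (^-increment z δ e′) ⟩
    X * (z ^ e + e * δ * y ^ e′)            ≡⟨ eq₁ X (z ^ e) e δ (y ^ e′) ⟩
    X * z ^ e + e * X * δ * y ^ e′          ≤⟨ +-monoʳ-≤ (X * z ^ e) (*-monoˡ-≤ (y ^ e′) eXδ≤) ⟩
    X * z ^ e + T * y * y ^ e′              ≡⟨ cong (X * z ^ e +_) (*-assoc T y (y ^ e′)) ⟩
    X * z ^ e + T * y ^ e                   ∎
    where
    y = z + δ
    eXδ≤ : e * X * δ ≤ T * y
    eXδ≤ = +-cancelˡ-≤ (e * X * z) _ _ (≤-trans (≤-reflexive (sym (*-distribˡ-+ (e * X) z δ))) h)
    eq₁ : ∀ X x e d y → X * (x + e * d * y) ≡ X * x + e * X * d * y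
    eq₁ = solve-∀

  -- Bernoulli gives (1 + D / p)^f ≥ 1 + f D / p; weakening `p` to a larger `L` lets a step be
  -- measured by the values at its right end.
  bernoulli : ∀ p D L f → p ≤ L → p ^ f * (L + f * D) ≤ (p + D) ^ f * L
  bernoulli p D L zero    p≤L = ≤-reflexive (cong (1 *_) (+-identityʳ L))
  bernoulli p D L (suc f) p≤L = begin
    p * p ^ f * (L + suc f * D)              ≡⟨ eq₁ p (p ^ f) L f D ⟩
    p ^ f * (p * L + p * (f * D) + p * D)    ≤⟨ *-monoʳ-≤ (p ^ f) (+-monoʳ-≤ _ (*-monoˡ-≤ D p≤L)) ⟩
    p ^ f * (p * L + p * (f * D) + L * D)    ≤⟨ ≤-from-+ (p ^ f * (f * D * D)) (eq₂ p (p ^ f) L f D) ⟩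
    (p + D) * (p ^ f * (L + f * D))          ≤⟨ *-monoʳ-≤ (p + D) (bernoulli p D L f p≤L) ⟩
    (p + D) * ((p + D) ^ f * L)              ≡⟨ *-assoc (p + D) _ L ⟨
    (p + D) * (p + D) ^ f * L                ∎
    where
    eq₁ : ∀ p y L f D → p * y * (L + suc f * D) ≡ y * (p * L + p * (f * D) + p * D)
    eq₁ = solve-∀
    eq₂ : ∀ p y L f D → y * (p * L + p * (f * D) + L * D) + y * (f * D * D) ≡ (p + D) * (y * (L + f * D))
    eq₂ = solve-∀

  -- (1 + (T + g) / X) (1 − T / X) ≥ 1 as soon as T (T + g) ≤ X g.
  compare-step : ∀ X T g ζ ζ′ w w′ .{{_ : NonZero X}} .{{_ : NonZero g}} →
                 X * ζ′ ≤ X * ζ + T * ζ′ → w * (X + (T + g)) ≤ w′ * X → T * (T + g) ≤ X * g →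
                 ζ′ * w ≤ ζ * w′
  compare-step X T g ζ ζ′ w w′ hζ hw hT with ≤-total T X
  ... | inj₂ X≤T = contradiction hT (<⇒≱ (<-≤-trans (*-monoʳ-< X (m<n+m g (>-nonZero⁻¹ T {{>-nonZero (<-≤-trans (>-nonZero⁻¹ X) X≤T)}})))
                                            (*-monoˡ-≤ (T + g) X≤T)))
  ... | inj₁ T≤X with m≤n⇒∃[o]m+o≡n T≤X
  ... | X₀ , refl = *-cancelʳ-≤ _ _ (X * X) {{m*n≢0 X X}} (begin
    ζ′ * w * (X * X)                       ≤⟨ *-monoʳ-≤ (ζ′ * w) square ⟩
    ζ′ * w * (X₀ * (X + (T + g)))          ≡⟨ eq₁ ζ′ w X₀ (X + (T + g)) ⟩
    X₀ * ζ′ * (w * (X + (T + g)))          ≤⟨ *-mono-≤ hζ′ hw ⟩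
    X * ζ * (w′ * X)                       ≡⟨ eq₂ X ζ w′ ⟩
    ζ * w′ * (X * X)                       ∎)
    where
    hζ′ : X₀ * ζ′ ≤ X * ζ
    hζ′ = +-cancelʳ-≤ (T * ζ′) _ _ (≤-trans (≤-reflexive (eq₄ X₀ T ζ′)) hζ)
      where
      eq₄ : ∀ X₀ T z → X₀ * z + T * z ≡ (T + X₀) * z
      eq₄ = solve-∀
    square : X * X ≤ X₀ * (X + (T + g))
    square = +-cancelʳ-≤ (T * (T + g)) _ _ (begin
      X * X + T * (T + g)                     ≤⟨ +-monoʳ-≤ (X * X) hT ⟩
      X * X + X * g                           ≡⟨ eq₃ X₀ T g ⟩
      X₀ * (X + (T + g)) + T * (T + g)        ∎)
      where
      eq₃ : ∀ X₀ T g → (T + X₀) * (T + X₀) + (T + X₀) * g ≡ X₀ * (T + X₀ + (T + g)) + T * (T + g)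
      eq₃ = solve-∀
    eq₁ : ∀ z w x y → z * w * (x * y) ≡ x * z * (w * y)
    eq₁ = solve-∀
    eq₂ : ∀ X z w → X * z * (w * X) ≡ z * w * (X * X)
    eq₂ = solve-∀

  -- The occupancy fraction

  ∑-elements : ∀ (p : Subset n) (f : Fin n → ℕ) → ∑ (elements p) f ≡ ∑ (allFin n) (λ u → χ u p * f u)
  ∑-elements {n} p f = trans (∑-filter (_∈? p) (allFin n) f)
    (∑-cong (allFin n) λ u _ → cong (_* f u) (sym (χ≡𝟙 u p)))

  ∑χ-⊖ : ∀ {e : Subset n} {v} → v ∈ e → ∀ (f : Fin n → ℕ) →
         f v + ∑ (allFin n) (λ u → χ u (e ⊖ v) * f u) ≡ ∑ (allFin n) (λ u → χ u e * f u)
  ∑χ-⊖ {suc n} {_ ∷ e} {zero} here f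
    rewrite ∑-allFin-suc (λ u → χ u (outside ∷ e) * f u) | ∑-allFin-suc (λ u → χ u (inside ∷ e) * f u)
    = cong (_+ ∑ (allFin n) (λ u → χ u e * f (suc u))) (sym (+-identityʳ (f zero)))
  ∑χ-⊖ {suc n} {s ∷ e} {suc v} (there v∈) f
    rewrite ∑-allFin-suc (λ u → χ u (s ∷ (e ⊖ v)) * f u) | ∑-allFin-suc (λ u → χ u (s ∷ e) * f u)
          | sym (∑χ-⊖ v∈ (f ∘ suc))
    = eq (f (suc v)) (χ zero (s ∷ e) * f zero) (∑ (allFin n) (λ u → χ u (e ⊖ v) * f (suc u)))
    where
    eq : ∀ x y z → x + (y + z) ≡ y + (x + z)
    eq = solve-∀

  ∑-elements-⊖ : ∀ {e : Subset n} {v} → v ∈ e → ∀ (f : Fin n → ℕ) → f v + ∑ (elements (e ⊖ v)) f ≡ ∑ (elements e) f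
  ∑-elements-⊖ {e = e} {v} v∈ f = trans (cong (f v +_) (∑-elements (e ⊖ v) f)) (trans (∑χ-⊖ v∈ f) (sym (∑-elements e f)))

  𝟙+𝟙¬ : ∀ {P : Set} (p : Dec P) → 𝟙 p + 𝟙 (¬? p) ≡ 1
  𝟙+𝟙¬ (yes _) = refl
  𝟙+𝟙¬ (no _)  = refl

  𝟙≤1 : ∀ {P : Set} (p : Dec P) → 𝟙 p ≤ 1
  𝟙≤1 (yes _) = ≤-refl
  𝟙≤1 (no _)  = z≤n

  -- One failing entry costs at least one in the count; `suc` on the left replaces a subtraction on
  -- the right. It bounds the unblocked vertices of a link by `k − 1` unless the edge is free.
  ∑𝟙-all : ∀ {P : A → Set} (P? : Decidable P) xs → suc (∑ xs (𝟙 ∘ P?)) ≤ length xs + 𝟙 (all? P? xs)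
  ∑𝟙-all P? []       = ≤-refl
  ∑𝟙-all P? (x ∷ xs) with P? x
  ... | no _  = s≤s (≤-trans (∑-mono xs λ y _ → 𝟙≤1 (P? y)) (≤-trans (≤-reflexive (trans (∑-const xs 1) (*-identityʳ (length xs)))) (m≤m+n _ _)))
  ... | yes p = s≤s (≤-trans (∑𝟙-all P? xs)
                      (+-monoʳ-≤ (length xs) (𝟙-mono (all? P? xs) _ (p All.∷_))))

  ∏-choose : ∀ {P : A → Set} (P? : Decidable P) xs x y →
             ∏ xs (λ e → choose x y (P? e)) ≡ x ^ ∑ xs (𝟙 ∘ P?) * y ^ ∑ xs (λ e → 𝟙 (¬? (P? e)))
  ∏-choose P? []       x y = refl
  ∏-choose P? (e ∷ xs) x y with P? e
  ... | yes _ = trans (cong (x *_) (∏-choose P? xs x y)) (sym (*-assoc x _ _))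
  ... | no _  = trans (cong (y *_) (∏-choose P? xs x y)) (eq y (x ^ ∑ xs (𝟙 ∘ P?)) (y ^ ∑ xs (λ e → 𝟙 (¬? (P? e)))))
    where
    eq : ∀ y p q → y * (p * q) ≡ p * (y * q)
    eq = solve-∀

  module _ {n : ℕ} (G : Hypergraph n) (a b k′ d : ℕ) .{{_ : NonZero b}} (a≤b : a ≤ b)
           (uniform : Uniform G (2 + k′)) (regular : Regular G d) (linear : Linear G) (no-cross : NoCrossEdges G)
           (C : ℕ) (C+a^k : C + a ^ suc k′ ≡ (a + b) ^ suc k′) where

    private
      k = suc k′
      s = a + b
      Q = s ^ k
      z = μ a b (ind G)
      err = 2 * d * C ^ d
      instance
        s≢0 : NonZero s
        s≢0 = >-nonZero (<-≤-trans (>-nonZero⁻¹ b) (m≤n+m b a))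

      p : Fin n → ℕ
      p u = μ a b (λ I → χ u I * ind G I)

      module _ (v : Fin n) where
        es = edgesAt G v

        m m̄ : Subset n → ℕ
        m I = ∑ es (λ e → 𝟙 (free? G v I e))
        m̄ I = ∑ es (λ e → 𝟙 (¬? (free? G v I e)))

        m+m̄ : ∀ I → m I + m̄ I ≡ d
        m+m̄ I = trans (sym (∑-+ es _ _)) (trans (∑-cong es λ e _ → 𝟙+𝟙¬ (free? G v I e))
          (trans (∑-const es 1) (trans (*-identityʳ (length es)) (regular v))))

        -- The weight that balances the odds of v against the unblocked neighbours: Γ + a m̄ = d (a + b).
        Γ : Subset n → ℕ
        Γ I = d * b + a * m I

        m-resp : ∀ {I J w} → w ≡ v ⊎ Neighbours G w v → AgreeOff w I J → m I ≤ m J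
        m-resp {I} {J} near agree = ∑-mono es λ e e∈ → 𝟙-mono (free? G v I e) (free? G v J e)
          (free-resp G v no-cross near e∈ agree)

        Γ-resp : ∀ {I J w} → w ≡ v ⊎ Neighbours G w v → AgreeOff w I J → Γ I ≤ Γ J
        Γ-resp near agree = +-monoʳ-≤ (d * b) (*-monoʳ-≤ a (m-resp near agree))

        F : Subset n → Subset n → ℕ
        F = factor G {a} {b} k uniform linear no-cross C C+a^k v

        N : Subset n → Subset n → ℕ
        N = notContained G {a} {b} k uniform linear no-cross C C+a^k v

        -- As `a ≤ b`, `Γ I` is at most `b * (2 * m I + m̄ I)`, and `free-edges-bound` trades the
        -- exponential dependence on `m I` for a term linear in `m̄ I` plus `err`.
        Γ-bound : ∀ I → Γ I * ∏ es (F I) ≤ b * (m̄ I * Q ^ d + err)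
        Γ-bound I = begin
          Γ I * ∏ es (F I)                             ≡⟨ cong (Γ I *_) (∏-choose (free? G v I) es C Q) ⟩
          (d * b + a * M) * (C ^ M * Q ^ M̄)            ≤⟨ *-monoˡ-≤ _ (+-monoʳ-≤ (d * b) (*-monoˡ-≤ M a≤b)) ⟩
          (d * b + b * M) * (C ^ M * Q ^ M̄)            ≡⟨ cong (λ d → (d * b + b * M) * (C ^ M * Q ^ M̄)) (m+m̄ I) ⟨
          ((M + M̄) * b + b * M) * (C ^ M * Q ^ M̄)      ≡⟨ eq₁ M M̄ b (C ^ M * Q ^ M̄) ⟩
          b * ((2 * M + M̄) * (C ^ M * Q ^ M̄))
            ≤⟨ *-monoʳ-≤ b (subst (λ Q → (2 * M + M̄) * (C ^ M * Q ^ M̄) ≤ M̄ * Q ^ (M + M̄) + (2 * M + M̄) * C ^ (M + M̄))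
                 C+a^k (free-edges-bound C (a ^ k) {{subst NonZero (sym C+a^k) (m^n≢0 s k)}} M M̄)) ⟩
          b * (M̄ * Q ^ (M + M̄) + (2 * M + M̄) * C ^ (M + M̄))
            ≤⟨ *-monoʳ-≤ b (+-monoʳ-≤ _ (*-monoˡ-≤ (C ^ (M + M̄)) (≤-from-+ M̄ (eq₂ M M̄)))) ⟩
          b * (M̄ * Q ^ (M + M̄) + 2 * (M + M̄) * C ^ (M + M̄))
            ≡⟨ cong (λ d → b * (M̄ * Q ^ d + 2 * d * C ^ d)) (m+m̄ I) ⟩
          b * (M̄ * Q ^ d + err)                        ∎
          where
          M = m I
          M̄ = m̄ I
          eq₁ : ∀ m m̄ b x → ((m + m̄) * b + b * m) * x ≡ b * ((2 * m + m̄) * x)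
          eq₁ = solve-∀
          eq₂ : ∀ m m̄ → 2 * m + m̄ + m̄ ≡ 2 * (m + m̄)
          eq₂ = solve-∀

        -- If `v` is in an independent `I`, no link of an edge at `v` lies in `I`, so all `d`
        -- factors of the product equal `Q`; and `Γ` does not see `v`.
        remove-v : ∀ I → v ∈ I → Q ^ d * (ind G I * Γ I) ≤ ind G (I ⊖ v) * Γ (I ⊖ v) * ∏ es (N (I ⊖ v))
        remove-v I v∈I with independent? G I | independent? G (I ⊖ v)
        ... | no _     | _     = ≤-trans (≤-reflexive (*-zeroʳ (Q ^ d))) z≤n
        ... | yes indI | no ¬p = contradiction (independent-⊖ G indI) ¬p
        ... | yes indI | yes _ = begin
          Q ^ d * (1 * Γ I)                    ≤⟨ *-mono-≤ (≤-reflexive Q^d≡) (*-monoʳ-≤ 1 (Γ-resp (inj₁ refl) agreeOff-[]≔)) ⟩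
          ∏ es (N (I ⊖ v)) * (1 * Γ (I ⊖ v))   ≡⟨ *-comm _ (1 * Γ (I ⊖ v)) ⟩
          1 * Γ (I ⊖ v) * ∏ es (N (I ⊖ v))     ∎
          where
          N≡Q : ∀ e → e ∈ˡ es → Q ≤ N (I ⊖ v) e
          N≡Q e e∈ with e ⊖ v ⊆? I ⊖ v
          ... | no _  = ≤-reflexive (sym (*-identityʳ Q))
          ... | yes ⊆ = contradiction (λ {x} x∈ → e⊆I x∈ (x ≟ v)) (All.lookup indI (proj₁ (∈-edgesAt⁻ G v e∈)))
            where
            e⊆I : ∀ {x} → x ∈ e → Dec (x ≡ v) → x ∈ I
            e⊆I x∈ (yes refl) = v∈I
            e⊆I x∈ (no x≢v)   = ⊖-⊆ (⊆ (x∈[]≔⁺ x≢v x∈))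
          Q^d≡ : Q ^ d ≡ ∏ es (N (I ⊖ v))
          Q^d≡ = ≤-antisym
            (≤-trans (≤-reflexive (trans (cong (Q ^_) (sym (regular v))) (sym (∏-const es Q)))) (∏-mono es N≡Q))
            (≤-trans (∏-mono es λ e _ → ≤-trans (*-monoʳ-≤ Q (𝟙≤1 (¬? (e ⊖ v ⊆? I ⊖ v)))) (≤-reflexive (*-identityʳ Q)))
              (≤-reflexive (trans (∏-const es Q) (cong (Q ^_) (regular v)))))

        -- Delete `v` by `remove-v`, replace the indicators by `μ-edges` started at `R = Γ`, and
        -- finish with `Γ-bound`. `Γ` qualifies as `R` because adding a neighbour of `v` does not
        -- change which edges are free.
        occupied : Q ^ d * μ a b (λ I → χ v I * (ind G I * Γ I)) ≤
                   a * μ a b (λ I → χ̄ v I * ind G I * (m̄ I * Q ^ d + err))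
        occupied = *-cancelˡ-≤ b (begin
          b * (Q ^ d * μ a b (λ I → χ v I * (ind G I * Γ I)))
            ≡⟨ cong (b *_) (μ-*ˡ (Q ^ d) _) ⟩
          b * μ a b (λ I → Q ^ d * (χ v I * (ind G I * Γ I)))
            ≡⟨ cong (b *_) (μ-cong λ I → eq₁ (Q ^ d) (χ v I) (ind G I * Γ I)) ⟩
          b * μ a b (λ I → χ v I * (Q ^ d * (ind G I * Γ I)))
            ≤⟨ μ-remove {a = a} {b} v {g = λ I → ind G I * Γ I * ∏ es (N I)} remove-v ⟩
          a * μ a b (λ I → χ̄ v I * (ind G I * Γ I * ∏ es (N I)))
            ≡⟨ cong (a *_) (μ-cong λ I → eq₂ (χ̄ v I) (ind G I) (Γ I) (∏ es (N I))) ⟩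
          a * μ a b (λ I → χ̄ v I * ind G I * Γ I * ∏ es (N I))
            ≤⟨ *-monoʳ-≤ a (μ-edges G k uniform linear no-cross C C+a^k v es
                 (Unique.filter⁺ (v ∈?_) (Hypergraph.unique G)) (λ e∈ → e∈) Γ
                 λ e∈ u∈ → Γ-resp (inj₂ (∈⊖⇒neighbours G v e∈ u∈)) agreeOff-[]≔) ⟩
          a * μ a b (λ I → χ̄ v I * ind G I * Γ I * ∏ es (F I))
            ≤⟨ *-monoʳ-≤ a (μ-mono λ I → ≤-trans (≤-reflexive (*-assoc (χ̄ v I * ind G I) (Γ I) _))
                 (≤-trans (*-monoʳ-≤ (χ̄ v I * ind G I) (Γ-bound I)) (≤-reflexive (eq₃ (χ̄ v I * ind G I) b _)))) ⟩
          a * μ a b (λ I → b * (χ̄ v I * ind G I * (m̄ I * Q ^ d + err)))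
            ≡⟨ cong (a *_) (μ-*ˡ b _) ⟨
          a * (b * μ a b (λ I → χ̄ v I * ind G I * (m̄ I * Q ^ d + err)))
            ≡⟨ eq₃ a b _ ⟩
          b * (a * μ a b (λ I → χ̄ v I * ind G I * (m̄ I * Q ^ d + err))) ∎)
          where
          eq₁ : ∀ q c x → q * (c * x) ≡ c * (q * x)
          eq₁ = solve-∀
          eq₂ : ∀ c i g p → c * (i * g * p) ≡ c * i * g * p
          eq₂ = solve-∀
          eq₃ : ∀ a b x → a * (b * x) ≡ b * (a * x)
          eq₃ = solve-∀

        -- Adding `a * m̄` on the sets containing `v` completes `Γ` to the constant `d * s` on the
        -- left, and on the right extends the sum over sets without `v` to all sets.
        occupied′ : Q ^ d * (d * s) * p v ≤ a * μ a b (λ I → ind G I * (m̄ I * Q ^ d + err))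
        occupied′ = begin
          Q ^ d * (d * s) * p v
            ≡⟨ *-assoc (Q ^ d) (d * s) (p v) ⟩
          Q ^ d * (d * s * p v)
            ≡⟨ cong (Q ^ d *_) (μ-*ˡ (d * s) _) ⟩
          Q ^ d * μ a b (λ I → d * s * (χ v I * ind G I))
            ≡⟨ cong (Q ^ d *_) (μ-cong λ I → trans (cong (λ d → d * s * (χ v I * ind G I)) (sym (m+m̄ I)))
                 (trans (eq₁ (m I) (m̄ I) a b (χ v I) (ind G I))
                   (cong (λ d → χ v I * (ind G I * (d * b + a * m I)) + a * (χ v I * ind G I * m̄ I)) (m+m̄ I)))) ⟩
          Q ^ d * μ a b (λ I → χ v I * (ind G I * Γ I) + a * (χ v I * ind G I * m̄ I))
            ≡⟨ cong (Q ^ d *_) (trans (μ-+ _ _) (cong (μ a b (λ I → χ v I * (ind G I * Γ I)) +_) (sym (μ-*ˡ a _)))) ⟩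
          Q ^ d * (μ a b (λ I → χ v I * (ind G I * Γ I)) + a * y)
            ≡⟨ *-distribˡ-+ (Q ^ d) _ (a * y) ⟩
          Q ^ d * μ a b (λ I → χ v I * (ind G I * Γ I)) + Q ^ d * (a * y)
            ≤⟨ +-monoˡ-≤ (Q ^ d * (a * y)) occupied ⟩
          a * w + Q ^ d * (a * y)
            ≡⟨ eq₂ a w (Q ^ d) y ⟩
          a * (w + Q ^ d * y)
            ≡⟨ cong (λ x → a * (w + x)) (μ-*ˡ (Q ^ d) _) ⟩
          a * (w + μ a b (λ I → Q ^ d * (χ v I * ind G I * m̄ I)))
            ≡⟨ cong (a *_) (μ-+ _ _) ⟨
          a * μ a b (λ I → χ̄ v I * ind G I * (m̄ I * Q ^ d + err) + Q ^ d * (χ v I * ind G I * m̄ I))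
            ≤⟨ *-monoʳ-≤ a (μ-mono λ I → ≤-trans (≤-from-+ (χ v I * ind G I * err) (eq₃ (χ̄ v I) (ind G I) (m̄ I) (Q ^ d) err (χ v I)))
                 (≤-reflexive (trans (cong (_* (ind G I * (m̄ I * Q ^ d + err))) (χ+χ̄ v I)) (*-identityˡ _)))) ⟩
          a * μ a b (λ I → ind G I * (m̄ I * Q ^ d + err)) ∎
          where
          y = μ a b (λ I → χ v I * ind G I * m̄ I)
          w = μ a b (λ I → χ̄ v I * ind G I * (m̄ I * Q ^ d + err))
          eq₁ : ∀ m m̄ a b c i → (m + m̄) * (a + b) * (c * i) ≡ c * (i * ((m + m̄) * b + a * m)) + a * (c * i * m̄)
          eq₁ = solve-∀
          eq₂ : ∀ a w q y → a * w + q * (a * y) ≡ a * (w + q * y)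
          eq₂ = solve-∀
          eq₃ : ∀ c̄ i m̄ q e c → c̄ * i * (m̄ * q + e) + q * (c * i * m̄) + c * i * e ≡ (c + c̄) * (i * (m̄ * q + e))
          eq₃ = solve-∀

        -- By `μ-ind-∈` each neighbour is charged only when unblocked, and the link of an edge has
        -- at most `k′` unblocked vertices, or `k′ + 1` if the edge is free.
        link-bound : s * ∑ es (λ e → ∑ (elements (e ⊖ v)) p) ≤ a * μ a b (λ I → ind G I * (k′ * d + m I))
        link-bound = begin
          s * ∑ es (λ e → ∑ (elements (e ⊖ v)) p)
            ≡⟨ trans (∑-*ˡ s es _) (∑-cong es λ e _ → ∑-*ˡ s (elements (e ⊖ v)) p) ⟩
          ∑ es (λ e → ∑ (elements (e ⊖ v)) λ u → s * p u)
            ≤⟨ ∑-mono es (λ e _ → ∑-mono (elements (e ⊖ v)) λ u _ → μ-ind-∈ G {a} {b} v u) ⟩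
          ∑ es (λ e → ∑ (elements (e ⊖ v)) λ u → a * μ a b (λ I → U I u * ind G I))
            ≡⟨ trans (∑-*ˡ a es _) (∑-cong es λ e _ → ∑-*ˡ a (elements (e ⊖ v)) _) ⟨
          a * ∑ es (λ e → ∑ (elements (e ⊖ v)) λ u → μ a b (λ I → U I u * ind G I))
            ≡⟨ cong (a *_) (trans (∑-cong es λ e _ → μ-∑ (elements (e ⊖ v)) _) (μ-∑ es _)) ⟩
          a * μ a b (λ I → ∑ es (λ e → ∑ (elements (e ⊖ v)) λ u → U I u * ind G I))
            ≤⟨ *-monoʳ-≤ a (μ-mono pointwise) ⟩
          a * μ a b (λ I → ind G I * (k′ * d + m I)) ∎
          where
          U : Subset n → Fin n → ℕ
          U I u = 𝟙 (unblocked? G v I u)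
          pointwise : ∀ I → ∑ es (λ e → ∑ (elements (e ⊖ v)) λ u → U I u * ind G I) ≤ ind G I * (k′ * d + m I)
          pointwise I = begin
            ∑ es (λ e → ∑ (elements (e ⊖ v)) λ u → U I u * ind G I)
              ≡⟨ ∑-cong es (λ e _ → ∑-cong (elements (e ⊖ v)) λ u _ → *-comm (U I u) (ind G I)) ⟩
            ∑ es (λ e → ∑ (elements (e ⊖ v)) λ u → ind G I * U I u)
              ≡⟨ trans (∑-*ˡ (ind G I) es _) (∑-cong es λ e _ → ∑-*ˡ (ind G I) (elements (e ⊖ v)) _) ⟨
            ind G I * ∑ es (λ e → ∑ (elements (e ⊖ v)) (U I))
              ≤⟨ *-monoʳ-≤ (ind G I) (∑-mono es λ e e∈ → s≤s⁻¹ (subst (λ l → suc (∑ (elements (e ⊖ v)) (U I)) ≤ l + 𝟙 (free? G v I e))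
                   (length-link G {a} {b} k uniform linear no-cross C C+a^k v e∈) (∑𝟙-all (unblocked? G v I) (elements (e ⊖ v))))) ⟩
            ind G I * ∑ es (λ e → k′ + 𝟙 (free? G v I e))
              ≡⟨ cong (ind G I *_) (trans (∑-+ es _ _) (cong (_+ m I) (trans (∑-const es k′)
                   (trans (*-comm (length es) k′) (cong (k′ *_) (regular v)))))) ⟩
            ind G I * (k′ * d + m I) ∎

        -- The bound for `v` contributes `m̄` and the bound for its neighbours `m`; their sum is `d`
        -- for every `I`, so the random number of free edges disappears.
        local-bound : s * Q ^ d * ∑ es (λ e → ∑ (elements e) p) ≤ a * (d * (k * Q ^ d + 2 * C ^ d)) * z
        local-bound = begin
          s * Q ^ d * ∑ es (λ e → ∑ (elements e) p)
            ≡⟨ cong (s * Q ^ d *_) (∑-cong es λ e e∈ → ∑-elements-⊖ (proj₂ (∈-edgesAt⁻ G v e∈)) p) ⟨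
          s * Q ^ d * ∑ es (λ e → p v + L e)
            ≡⟨ cong (s * Q ^ d *_) (trans (∑-+ es _ _) (cong (_+ ∑ es L) (trans (∑-const es (p v)) (cong (_* p v) (regular v))))) ⟩
          s * Q ^ d * (d * p v + ∑ es L)
            ≡⟨ eq₁ s (Q ^ d) d (p v) (∑ es L) ⟩
          Q ^ d * (d * s) * p v + Q ^ d * (s * ∑ es L)
            ≤⟨ +-mono-≤ occupied′ (*-monoʳ-≤ (Q ^ d) link-bound) ⟩
          a * x + Q ^ d * (a * y)
            ≡⟨ eq₂ a x (Q ^ d) y ⟩
          a * (x + Q ^ d * y)
            ≡⟨ cong (a *_) (trans (cong (x +_) (μ-*ˡ (Q ^ d) _)) (sym (μ-+ _ _))) ⟩
          a * μ a b (λ I → ind G I * (m̄ I * Q ^ d + err) + Q ^ d * (ind G I * (k′ * d + m I)))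
            ≡⟨ cong (a *_) (μ-cong λ I → trans (eq₃ (ind G I) (m̄ I) (Q ^ d) err (k′ * d) (m I))
                 (trans (cong (λ δ → (Q ^ d * (δ + k′ * d) + err) * ind G I) (m+m̄ I))
                   (cong (_* ind G I) (eq₄ (Q ^ d) d k′ (C ^ d))))) ⟩
          a * μ a b (λ I → d * (k * Q ^ d + 2 * C ^ d) * ind G I)
            ≡⟨ cong (a *_) (μ-*ˡ (d * (k * Q ^ d + 2 * C ^ d)) (ind G)) ⟨
          a * (d * (k * Q ^ d + 2 * C ^ d) * z)
            ≡⟨ *-assoc a _ z ⟨
          a * (d * (k * Q ^ d + 2 * C ^ d)) * z ∎
          where
          L = λ e → ∑ (elements (e ⊖ v)) p
          x = μ a b (λ I → ind G I * (m̄ I * Q ^ d + err))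
          y = μ a b (λ I → ind G I * (k′ * d + m I))
          eq₁ : ∀ s q d p l → s * q * (d * p + l) ≡ q * (d * s) * p + q * (s * l)
          eq₁ = solve-∀
          eq₂ : ∀ a w q y → a * w + q * (a * y) ≡ a * (w + q * y)
          eq₂ = solve-∀
          eq₃ : ∀ i m̄ q e κ m → i * (m̄ * q + e) + q * (i * (κ + m)) ≡ (q * (m + m̄ + κ) + e) * i
          eq₃ = solve-∀
          eq₄ : ∀ q d k′ c → q * (d + k′ * d) + 2 * d * c ≡ d * (suc k′ * q + 2 * c)
          eq₄ = solve-∀

    -- Double counting twice: an edge is met from each of its `2 + k′` vertices, and a vertex lies
    -- in `d` edges.
    ∑-edgesAt : ∑ (allFin n) (λ v → ∑ (edgesAt G v) (λ e → ∑ (elements e) p)) ≡ d * ((2 + k′) * μ a b (λ I → ∣ I ∣ * ind G I))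
    ∑-edgesAt = begin-equality
      ∑ V (λ v → ∑ (edgesAt G v) g)
        ≡⟨ ∑-cong V (λ v _ → ∑-filter (v ∈?_) E g) ⟩
      ∑ V (λ v → ∑ E λ e → 𝟙 (v ∈? e) * g e)
        ≡⟨ ∑-swap V E _ ⟩
      ∑ E (λ e → ∑ V λ v → 𝟙 (v ∈? e) * g e)
        ≡⟨ ∑-cong E (λ e e∈ → trans (∑-cong V λ v _ → *-comm (𝟙 (v ∈? e)) (g e)) (trans (sym (∑-*ˡ (g e) V _))
             (trans (cong (g e *_) (trans (sym (length-filter-∑ (_∈? e) V)) (trans (length-elements e) (uniform e e∈)))) (*-comm (g e) r)))) ⟩
      ∑ E (λ e → r * g e)
        ≡⟨ ∑-*ˡ r E g ⟨
      r * ∑ E g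
        ≡⟨ cong (r *_) (trans (∑-cong E λ e _ → ∑-filter (_∈? e) V p) (∑-swap E V _)) ⟩
      r * ∑ V (λ u → ∑ E λ e → 𝟙 (u ∈? e) * p u)
        ≡⟨ cong (r *_) (∑-cong V λ u _ → trans (∑-cong E λ e _ → *-comm (𝟙 (u ∈? e)) (p u)) (trans (sym (∑-*ˡ (p u) E _))
             (trans (cong (p u *_) (trans (sym (length-filter-∑ (u ∈?_) E)) (regular u))) (*-comm (p u) d)))) ⟩
      r * ∑ V (λ u → d * p u)
        ≡⟨ cong (r *_) (∑-*ˡ d V p) ⟨
      r * (d * ∑ V p)
        ≡⟨ cong (λ x → r * (d * x)) (trans (μ-∑ V _) (μ-cong λ I → trans (∑-cong V λ u _ → *-comm (χ u I) (ind G I))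
             (trans (sym (∑-*ˡ (ind G I) V _)) (trans (*-comm (ind G I) _) (cong (_* ind G I) (∑-χ I)))))) ⟩
      r * (d * S)
        ≡⟨ eq r d S ⟩
      d * (r * S) ∎
      where
      r = 2 + k′
      V = allFin n
      E = edges G
      S = μ a b (λ I → ∣ I ∣ * ind G I)
      g = λ e → ∑ (elements e) p
      eq : ∀ r d x → r * (d * x) ≡ d * (r * x)
      eq = solve-∀

    occupancy : .{{NonZero d}} →
      s * (2 + k′) * Q ^ d * μ a b (λ I → ∣ I ∣ * ind G I) ≤ a * n * (k * Q ^ d + 2 * C ^ d) * z
    occupancy = *-cancelˡ-≤ d (begin
      d * (s * r * Q ^ d * S)            ≡⟨ eq₁ d s r (Q ^ d) S ⟩
      s * Q ^ d * (d * (r * S))          ≡⟨ cong (s * Q ^ d *_) ∑-edgesAt ⟨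
      s * Q ^ d * ∑ V (λ v → ∑ (edgesAt G v) (λ e → ∑ (elements e) p)) ≡⟨ ∑-*ˡ (s * Q ^ d) V _ ⟩
      ∑ V (λ v → s * Q ^ d * ∑ (edgesAt G v) (λ e → ∑ (elements e) p)) ≤⟨ ∑-mono V (λ v _ → local-bound v) ⟩
      ∑ V (λ _ → a * (d * x) * z)        ≡⟨ trans (∑-const V _) (cong (_* (a * (d * x) * z)) (length-tabulate {n = n} (λ i → i))) ⟩
      n * (a * (d * x) * z)              ≡⟨ eq₂ n a d x z ⟩
      d * (a * n * x * z)                ∎)
      where
      r = 2 + k′
      V = allFin n
      S = μ a b (λ I → ∣ I ∣ * ind G I)
      x = k * Q ^ d + 2 * C ^ d
      eq₁ : ∀ d s r q x → d * (s * r * q * x) ≡ s * q * (d * (r * x))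
      eq₁ = solve-∀
      eq₂ : ∀ n a d x z → n * (a * (d * x) * z) ≡ d * (a * n * x * z)
      eq₂ = solve-∀

  -- Integration over the fugacity

  ∑-++ : ∀ (xs ys : List A) f → ∑ (xs ++ ys) f ≡ ∑ xs f + ∑ ys f
  ∑-++ []       ys f = refl
  ∑-++ (x ∷ xs) ys f = trans (cong (f x +_) (∑-++ xs ys f)) (sym (+-assoc (f x) _ _))

  ∑-subsets : ∀ n (f : Subset n → ℕ) → ∑ (subsets n) f ≡ μ 1 1 f
  ∑-subsets zero    f = trans (+-identityʳ (f [])) (sym μ-[])
  ∑-subsets (suc n) f = trans (∑-++ (map (inside ∷_) (subsets n)) _ f)
    (trans (cong₂ _+_ (half inside) (half outside)) (sym μ-∷))
    where
    half : ∀ s → ∑ (map (s ∷_) (subsets n)) f ≡ 1 * μ 1 1 (λ I → f (s ∷ I))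
    half s = trans (∑-map (s ∷_) (subsets n) f) (trans (∑-subsets n (f ∘ (s ∷_))) (sym (*-identityˡ _)))

  μ-scale : ∀ c (f : Subset n → ℕ) → μ c c f ≡ c ^ n * μ 1 1 f
  μ-scale {zero}  c f = trans μ-[] (sym (trans (*-identityˡ _) μ-[]))
  μ-scale {suc n} c f
    rewrite μ-∷ {a = c} {c} {f} | μ-∷ {a = 1} {1} {f} | μ-scale c (f ∘ (inside ∷_)) | μ-scale c (f ∘ (outside ∷_))
    = eq c (c ^ n) _ _
    where
    eq : ∀ c y u w → c * (y * u) + c * (y * w) ≡ c * y * (1 * u + 1 * w)
    eq = solve-∀

  -- Every term but that of the empty set has a factor 0.
  μ-zero-weight : ∀ b (f : Subset n → ℕ) → (∀ I → f I ≤ 1) → μ 0 b f ≤ b ^ n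
  μ-zero-weight {zero}  b f h = ≤-trans (≤-reflexive μ-[]) (h [])
  μ-zero-weight {suc n} b f h = ≤-trans (≤-reflexive μ-∷) (*-monoʳ-≤ b (μ-zero-weight b (f ∘ (outside ∷_)) (h ∘ (outside ∷_))))

  i≤μ : ∀ r (G : Hypergraph n) → Uniform G r → i r G ≤ μ 1 1 (ind G)
  i≤μ {n} r G uniform = begin
    i r G                                          ≡⟨ length-filter-∑ (weakIndependent? G r) (subsets n) ⟩
    ∑ (subsets n) (λ I → 𝟙 (weakIndependent? G r I)) ≡⟨ ∑-subsets n _ ⟩
    μ 1 1 (λ I → 𝟙 (weakIndependent? G r I))       ≤⟨ μ-mono (λ I → 𝟙-mono (weakIndependent? G r I) (independent? G I) λ weak →
      All.tabulate λ {e} e∈ e⊆I → <⇒≱ (All.lookup weak e∈) (≤-trans (≤-reflexive (sym (uniform e e∈)))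
        (p⊆q⇒∣p∣≤∣q∣ λ x∈ → x∈p∩q⁺ (e⊆I x∈ , x∈)))) ⟩
    μ 1 1 (ind G)                                  ∎

  -- Since β′ γ - β γ′ = M N, Bernoulli for each of the two powers shows that their product grows at
  -- least by the factor (1 + e / α′)(1 + f M N / (β′ γ′)); the cross term is dropped.
  ratio-step : ∀ α β M N e f → let α′ = suc α; β′ = β + M; γ = β + N; γ′ = β + N + M; X = α′ * (β′ * γ′) in
               α ^ e * (β * γ′) ^ f * (X + (e * (β′ * γ′) + f * (M * N * α′))) ≤ α′ ^ e * (β′ * γ) ^ f * X
  ratio-step α β M N e f = begin
    α ^ e * (β * γ′) ^ f * (α′ * L + (e * L + f * (M * N * α′)))
      ≤⟨ *-monoʳ-≤ (α ^ e * (β * γ′) ^ f) (≤-from-+ (e * (f * (M * N))) (eq₁ α′ L e f (M * N))) ⟩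
    α ^ e * (β * γ′) ^ f * ((α′ + e * 1) * (L + f * (M * N)))
      ≡⟨ eq₂ (α ^ e) ((β * γ′) ^ f) (α′ + e * 1) (L + f * (M * N)) ⟩
    α ^ e * (α′ + e * 1) * ((β * γ′) ^ f * (L + f * (M * N)))
      ≤⟨ *-mono-≤ (bernoulli α 1 α′ e (n≤1+n α)) (bernoulli (β * γ′) (M * N) L f (*-monoˡ-≤ γ′ (m≤m+n β M))) ⟩
    (α + 1) ^ e * α′ * ((β * γ′ + M * N) ^ f * L)
      ≡⟨ cong₂ (λ x y → x ^ e * α′ * (y ^ f * L)) (+-comm α 1) (eq₃ β M N) ⟩
    α′ ^ e * α′ * ((β′ * γ) ^ f * L)
      ≡⟨ eq₂ (α′ ^ e) α′ ((β′ * γ) ^ f) L ⟩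
    α′ ^ e * (β′ * γ) ^ f * (α′ * L) ∎
    where
    α′ = suc α
    β′ = β + M
    γ = β + N
    γ′ = β + N + M
    L = β′ * γ′
    eq₁ : ∀ a L e f D → a * L + (e * L + f * (D * a)) + e * (f * D) ≡ (a + e * 1) * (L + f * D)
    eq₁ = solve-∀
    eq₂ : ∀ x y u w → x * y * (u * w) ≡ x * u * (y * w)
    eq₂ = solve-∀
    eq₃ : ∀ β M N → β * (β + N + M) + M * N ≡ (β + M) * (β + N)
    eq₃ = solve-∀

  module _ {n : ℕ} .{{_ : NonZero n}} (G : Hypergraph n) (k′ d : ℕ) .{{_ : NonZero d}}
           (uniform : Uniform G (2 + k′)) (regular : Regular G d) (linear : Linear G) (no-cross : NoCrossEdges G)
           (M : ℕ) .{{_ : NonZero M}} (M^k≤d : M ^ suc k′ ≤ d) where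

    private
      k = suc k′
      r = 2 + k′
      -- M / ((1 + Mλ)(2 + Mλ)) is the derivative of log ((1 + Mλ) / (2 + Mλ)). Multiplying the
      -- differential inequality by `M` therefore makes all exponents integers; `33 * n` in place of
      -- `32 * n` leaves slack for the discretisation.
      e = r * M
      e₁ = k * n * M
      f = 33 * n
      -- Chosen so that `T + g ≤ N * N * B`: this is the value of `T + g` with the running index
      -- replaced by `N`.
      B = e₁ * ((1 + M) * (2 + M)) + 66 * n * M
      -- For this mesh the discretisation error of a step is absorbed by the difference between 33 and 32.
      N = B * B

      instance
        B≢0 : NonZero B
        B≢0 = >-nonZero (<-≤-trans (>-nonZero⁻¹ (66 * n * M) {{m*n≢0 (66 * n) M {{m*n≢0 66 n}}}}) (m≤n+m _ _))
        N≢0 : NonZero N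
        N≢0 = m*n≢0 B B
        e≢0 : NonZero e
        e≢0 = m*n≢0 r M

      Z : ℕ → ℕ
      Z j = μ j N (ind G)

      -- `N` times 1 + λ, 1 + Mλ and 2 + Mλ at λ = j / N.
      α β γ : ℕ → ℕ
      α j = j + N
      β j = N + M * j
      γ j = 2 * N + M * j

      β-suc : ∀ j → β (suc j) ≡ β j + M
      β-suc = eq N M
        where
        eq : ∀ N M j → N + M * suc j ≡ N + M * j + M
        eq = solve-∀

      γ≡ : ∀ j → γ j ≡ β j + N
      γ≡ = eq N M
        where
        eq : ∀ N M j → 2 * N + M * j ≡ N + M * j + N
        eq = solve-∀

      γ-suc : ∀ j → γ (suc j) ≡ β j + N + M
      γ-suc = eq N M
        where
        eq : ∀ N M j → 2 * N + M * suc j ≡ N + M * j + N + M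
        eq = solve-∀

      module Step (j : ℕ) (j<N : j < N) where
        a = suc j
        s = a + N
        Q = s ^ k
        C = Q ∸ a ^ k
        X₁ = β a * γ a
        X = s * X₁
        Y₁ = M * N * s
        T = e₁ * X₁ + 32 * n * Y₁
        g = n * Y₁
        S = μ a N (λ I → ∣ I ∣ * ind G I)

        C+a^k : C + a ^ k ≡ Q
        C+a^k = m∸n+n≡m (^-monoˡ-≤ k (m≤m+n a N))

        instance
          Q^d≢0 : NonZero (Q ^ d)
          Q^d≢0 = m^n≢0 Q d {{m^n≢0 s k}}
          β≢0 : NonZero (β a)
          β≢0 = >-nonZero (<-≤-trans (>-nonZero⁻¹ N) (m≤m+n N (M * a)))
          γ≢0 : NonZero (γ a)
          γ≢0 = >-nonZero (<-≤-trans (>-nonZero⁻¹ (2 * N) {{m*n≢0 2 N}}) (m≤m+n (2 * N) (M * a)))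
          X₁≢0 : NonZero X₁
          X₁≢0 = m*n≢0 (β a) (γ a)
          X≢0 : NonZero X
          X≢0 = m*n≢0 s X₁
          Y₁≢0 : NonZero Y₁
          Y₁≢0 = m*n≢0 (M * N) s {{m*n≢0 M N}}
          g≢0 : NonZero g
          g≢0 = m*n≢0 n Y₁

        -- `decay` bounds the term with `C ^ d`, after which `Q ^ d` is a common factor and cancels.
        occupancy′ : s * r * X₁ * S ≤ a * (n * (k * X₁ + 32 * (N * N)) * Z a)
        occupancy′ = *-cancelʳ-≤ _ _ (Q ^ d) (begin
          s * r * X₁ * S * Q ^ d
            ≡⟨ eq₁ (s * r) X₁ S (Q ^ d) ⟩
          X₁ * (s * r * Q ^ d * S)
            ≤⟨ *-monoʳ-≤ X₁ (occupancy G a N k′ d j<N uniform regular linear no-cross C C+a^k) ⟩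
          X₁ * (a * n * (k * Q ^ d + 2 * C ^ d) * Z a)
            ≡⟨ eq₂ X₁ a n k (Q ^ d) (C ^ d) (Z a) ⟩
          a * n * Z a * (k * Q ^ d * X₁ + 2 * (C ^ d * X₁))
            ≤⟨ *-monoʳ-≤ (a * n * Z a) (+-monoʳ-≤ (k * Q ^ d * X₁) (*-monoʳ-≤ 2 (decay a N M k d C j<N M^k≤d C+a^k))) ⟩
          a * n * Z a * (k * Q ^ d * X₁ + 2 * (16 * (N * N) * Q ^ d))
            ≡⟨ eq₃ a n (Z a) k (Q ^ d) X₁ (N * N) ⟩
          a * (n * (k * X₁ + 32 * (N * N)) * Z a) * Q ^ d ∎)
          where
          eq₁ : ∀ s x S q → s * x * S * q ≡ x * (s * q * S)
          eq₁ = solve-∀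
          eq₂ : ∀ x a n k q c z → x * (a * n * (k * q + 2 * c) * z) ≡ a * n * z * (k * q * x + 2 * (c * x))
          eq₂ = solve-∀
          eq₃ : ∀ a n z k q x N → a * n * z * (k * q * x + 2 * (16 * N * q)) ≡ a * (n * (k * x + 32 * N) * z) * q
          eq₃ = solve-∀

        -- `μ-convex` bounds the increase of `Z` by its derivative at the right end `a`, which is
        -- the expected size bounded in `occupancy′`.
        growth : e * X * Z a ≤ e * X * Z j + T * Z a
        growth = begin
          r * M * (s * X₁) * Z a
            ≡⟨ eq₁ r M s X₁ (Z a) ⟩
          M * (s * r * X₁ * Z a)
            ≤⟨ *-monoʳ-≤ M (*-cancelˡ-≤ a (begin
              a * (s * r * X₁ * Z a)                 ≡⟨ eq₂ a (s * r * X₁) (Z a) ⟩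
              s * r * X₁ * (a * Z a)                 ≤⟨ *-monoʳ-≤ (s * r * X₁) (μ-convex j N (ind G)) ⟩
              s * r * X₁ * (a * Z j + S)             ≡⟨ eq₃ (s * r * X₁) a (Z j) S ⟩
              a * (s * r * X₁ * Z j) + s * r * X₁ * S ≤⟨ +-monoʳ-≤ (a * (s * r * X₁ * Z j)) occupancy′ ⟩
              a * (s * r * X₁ * Z j) + a * (n * (k * X₁ + 32 * (N * N)) * Z a) ≡⟨ *-distribˡ-+ a (s * r * X₁ * Z j) (n * (k * X₁ + 32 * (N * N)) * Z a) ⟨
              a * (s * r * X₁ * Z j + n * (k * X₁ + 32 * (N * N)) * Z a) ∎)) ⟩
          M * (s * r * X₁ * Z j + n * (k * X₁ + 32 * (N * N)) * Z a)
            -- `N * N` is enlarged to `N * s`: this drops the factor 1 / (1 + λ) from the error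
            -- term, so that it integrates in closed form.
            ≤⟨ ≤-from-+ (32 * n * (M * N * a) * Z a) (eq₄ r M s X₁ (Z j) n k N a (Z a)) ⟩
          r * M * (s * X₁) * Z j + T * Z a ∎
          where
          eq₁ : ∀ r M s x z → r * M * (s * x) * z ≡ M * (s * r * x * z)
          eq₁ = solve-∀
          eq₂ : ∀ a x z → a * (x * z) ≡ x * (a * z)
          eq₂ = solve-∀
          eq₃ : ∀ x a z S → x * (a * z + S) ≡ a * (x * z) + x * S
          eq₃ = solve-∀
          eq₄ : ∀ r M s x z n k N a z′ →
                M * (s * r * x * z + n * (k * x + 32 * (N * N)) * z′) + 32 * n * (M * N * a) * z′ ≡
                r * M * (s * x) * z + (k * n * M * x + 32 * n * (M * N * (a + N))) * z′
          eq₄ = solve-∀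

        T+g≡ : T + g ≡ e₁ * X₁ + f * Y₁
        T+g≡ = eq e₁ X₁ n Y₁
          where
          eq : ∀ e x n y → e * x + 32 * n * y + n * y ≡ e * x + 33 * n * y
          eq = solve-∀

        fine : T * (T + g) ≤ X * g
        fine = begin
          T * (T + g)                  ≤⟨ *-mono-≤ (≤-trans (m≤m+n T g) T+g≤) T+g≤ ⟩
          N * N * B * (N * N * B)      ≡⟨ eq₁ B ⟩
          -- With `B * B = N` the left side is `N ^ 5`, of which `X` supplies three factors and `g`
          -- two.
          N * (N * N) * (N * N)        ≤⟨ *-mono-≤ (*-mono-≤ (m≤n+m N a) (*-mono-≤ (m≤m+n N (M * a)) N≤γ)) N²≤g ⟩
          X * g                        ∎
          where
          eq₁ : ∀ B → B * B * (B * B) * B * (B * B * (B * B) * B) ≡ B * B * (B * B * (B * B)) * (B * B * (B * B))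
          eq₁ = solve-∀
          eq₂ : ∀ e M N n → e * ((N + M * N) * (2 * N + M * N)) + 33 * n * (M * N * (N + N)) ≡
                            N * N * (e * ((1 + M) * (2 + M)) + 66 * n * M)
          eq₂ = solve-∀
          N≤γ : N ≤ γ a
          N≤γ = ≤-trans (m≤m+n N _) (m≤m+n (2 * N) (M * a))
          N²≤g : N * N ≤ g
          N²≤g = ≤-trans (*-mono-≤ (m≤n*m N M) (m≤n+m N a)) (m≤n*m Y₁ n)
          T+g≤ : T + g ≤ N * N * B
          T+g≤ = begin
            T + g                      ≡⟨ T+g≡ ⟩
            e₁ * X₁ + 33 * n * Y₁
              ≤⟨ +-mono-≤ (*-monoʳ-≤ e₁ (*-mono-≤ (+-monoʳ-≤ N (*-monoʳ-≤ M j<N)) (+-monoʳ-≤ (2 * N) (*-monoʳ-≤ M j<N))))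
                          (*-monoʳ-≤ (33 * n) (*-monoʳ-≤ (M * N) (+-monoˡ-≤ N j<N))) ⟩
            e₁ * ((N + M * N) * (2 * N + M * N)) + 33 * n * (M * N * (N + N)) ≡⟨ eq₂ e₁ M N n ⟩
            N * N * B                  ∎

        ratio : α j ^ e₁ * (β j * γ a) ^ f * (X + (T + g)) ≤ α a ^ e₁ * (β a * γ j) ^ f * X
        ratio = subst (λ t → α j ^ e₁ * (β j * γ a) ^ f * (X + t) ≤ α a ^ e₁ * (β a * γ j) ^ f * X)
          (sym T+g≡) (aligned (β-suc j) (γ≡ j) (γ-suc j))
          where
          aligned : ∀ {β′ γ₀ γ′} → β′ ≡ β j + M → γ₀ ≡ β j + N → γ′ ≡ β j + N + M →
                 α j ^ e₁ * (β j * γ′) ^ f * (s * (β′ * γ′) + (e₁ * (β′ * γ′) + f * (M * N * s))) ≤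
                 α a ^ e₁ * (β′ * γ₀) ^ f * (s * (β′ * γ′))
          aligned refl refl refl = ratio-step (α j) (β j) M N e₁ f

        step : Z a ^ e * (α j ^ e₁ * (β j * γ a) ^ f) ≤ Z j ^ e * (α a ^ e₁ * (β a * γ j) ^ f)
        step = compare-step X T g (Z j ^ e) (Z a ^ e) _ _ (power-step e X T (Z j) (Z a) growth) ratio fine

      -- U / V is decreasing: with λ = j / N this is the bound on Z(λ) ^ (r M) by
      -- (1 + λ) ^ (k n M) · (2 (1 + M λ) / (2 + M λ)) ^ (33 n).
      U V : ℕ → ℕ
      U j = Z j ^ e * γ j ^ f
      V j = α j ^ e₁ * β j ^ f

      instance
        V≢0 : ∀ {j} → NonZero (V j)
        V≢0 {j} = m*n≢0 (α j ^ e₁) (β j ^ f)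
          {{m^n≢0 (α j) e₁ {{>-nonZero (<-≤-trans (>-nonZero⁻¹ N) (m≤n+m N j))}}}}
          {{m^n≢0 (β j) f {{>-nonZero (<-≤-trans (>-nonZero⁻¹ N) (m≤m+n N (M * j)))}}}}

      integrate : ∀ j → j ≤ N → U j * V 0 ≤ U 0 * V j
      integrate zero    _   = ≤-refl
      integrate (suc j) j<N = *-cancelʳ-≤ _ _ (V j) (begin
        U a * V 0 * V j         ≡⟨ eq₁ (U a) (V 0) (V j) ⟩
        U a * V j * V 0         ≡⟨ cong (_* V 0) (eq₂ (Z a ^ e) (γ a ^ f) (α j ^ e₁) (β j ^ f)) ⟩
        Z a ^ e * (α j ^ e₁ * (β j ^ f * γ a ^ f)) * V 0
                                ≡⟨ cong (λ x → Z a ^ e * (α j ^ e₁ * x) * V 0) (^-distribʳ-* f (β j) (γ a)) ⟨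
        Z a ^ e * (α j ^ e₁ * (β j * γ a) ^ f) * V 0
                                ≤⟨ *-monoˡ-≤ (V 0) (Step.step j j<N) ⟩
        Z j ^ e * (α a ^ e₁ * (β a * γ j) ^ f) * V 0
                                ≡⟨ cong (λ x → Z j ^ e * (α a ^ e₁ * x) * V 0) (^-distribʳ-* f (β a) (γ j)) ⟩
        Z j ^ e * (α a ^ e₁ * (β a ^ f * γ j ^ f)) * V 0
                                ≡⟨ eq₃ (Z j ^ e) (α a ^ e₁) (β a ^ f) (γ j ^ f) (V 0) ⟩
        U j * V 0 * V a         ≤⟨ *-monoˡ-≤ (V a) (integrate j (<⇒≤ j<N)) ⟩
        U 0 * V j * V a         ≡⟨ eq₁ (U 0) (V j) (V a) ⟩
        U 0 * V a * V j         ∎)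
        where
        a = suc j
        eq₁ : ∀ x y z → x * y * z ≡ x * z * y
        eq₁ = solve-∀
        eq₂ : ∀ z c a b → z * c * (a * b) ≡ z * (a * (b * c))
        eq₂ = solve-∀
        eq₃ : ∀ z a b c v → z * (a * (b * c)) * v ≡ z * c * v * (a * b)
        eq₃ = solve-∀

    -- The end points of `integrate`: at λ = 0 only the empty set counts and β / γ = 1 / 2, giving
    -- `2 ^ (33 * n)`; at λ = 1 the factor 1 + λ = 2 gives `2 ^ (k * n * M)` and β / γ ≤ 1. `K`
    -- collects the powers common to both sides.
    count-bound : μ 1 1 (ind G) ^ (r * M) ≤ 2 ^ (33 * n + k * n * M)
    count-bound = *-cancelˡ-≤ K {{K≢0}} (begin
      K * x ^ e
        ≡⟨ eq₁ ((N ^ n) ^ e) (N ^ e₁) (N ^ f) (γ N ^ f) (x ^ e) ⟩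
      (N ^ n) ^ e * x ^ e * γ N ^ f * (N ^ e₁ * N ^ f)
        ≡⟨ cong (λ z → z * γ N ^ f * (N ^ e₁ * N ^ f)) (^-distribʳ-* e (N ^ n) x) ⟨
      (N ^ n * x) ^ e * γ N ^ f * (N ^ e₁ * N ^ f)
        ≡⟨ cong₂ (λ z b → z ^ e * γ N ^ f * (N ^ e₁ * b ^ f)) (sym (μ-scale N (ind G))) (eq₀ N M) ⟩
      U N * V 0
        ≤⟨ integrate N ≤-refl ⟩
      U 0 * V N
        ≤⟨ *-mono-≤ (*-monoˡ-≤ (γ 0 ^ f) (^-monoˡ-≤ e (μ-zero-weight N (ind G) λ I → 𝟙≤1 (independent? G I))))
                    (*-monoʳ-≤ (α N ^ e₁) (^-monoˡ-≤ f (+-monoˡ-≤ (M * N) (m≤m+n N (N + 0))))) ⟩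
      (N ^ n) ^ e * γ 0 ^ f * (α N ^ e₁ * γ N ^ f)
        ≡⟨ cong₂ (λ c a → (N ^ n) ^ e * c ^ f * (a ^ e₁ * γ N ^ f)) (eq₂ N M) (eq₃ N) ⟩
      (N ^ n) ^ e * (2 * N) ^ f * ((2 * N) ^ e₁ * γ N ^ f)
        ≡⟨ cong₂ (λ c a → (N ^ n) ^ e * c * (a * γ N ^ f)) (^-distribʳ-* f 2 N) (^-distribʳ-* e₁ 2 N) ⟩
      (N ^ n) ^ e * (2 ^ f * N ^ f) * (2 ^ e₁ * N ^ e₁ * γ N ^ f)
        ≡⟨ eq₄ ((N ^ n) ^ e) (2 ^ f) (N ^ f) (2 ^ e₁) (N ^ e₁) (γ N ^ f) ⟩
      K * (2 ^ f * 2 ^ e₁)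
        ≡⟨ cong (K *_) (^-distribˡ-+-* 2 f e₁) ⟨
      K * 2 ^ (f + e₁) ∎)
      where
      x = μ 1 1 (ind G)
      K = (N ^ n) ^ e * N ^ e₁ * N ^ f * γ N ^ f
      K≢0 : NonZero K
      K≢0 = m*n≢0 ((N ^ n) ^ e * N ^ e₁ * N ^ f) (γ N ^ f)
        {{m*n≢0 ((N ^ n) ^ e * N ^ e₁) (N ^ f) {{m*n≢0 ((N ^ n) ^ e) (N ^ e₁) {{m^n≢0 (N ^ n) e {{m^n≢0 N n}}}} {{m^n≢0 N e₁}}}} {{m^n≢0 N f}}}}
        {{m^n≢0 (γ N) f {{>-nonZero (<-≤-trans (>-nonZero⁻¹ (2 * N) {{m*n≢0 2 N}}) (m≤m+n (2 * N) (M * N)))}}}}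
      eq₀ : ∀ N M → N ≡ N + M * 0
      eq₀ = solve-∀
      eq₁ : ∀ z a b c x → z * a * b * c * x ≡ z * x * c * (a * b)
      eq₁ = solve-∀
      eq₂ : ∀ N M → 2 * N + M * 0 ≡ 2 * N
      eq₂ = solve-∀
      eq₃ : ∀ N → N + N ≡ 2 * N
      eq₃ = solve-∀
      eq₄ : ∀ z p b q a c → z * (p * b) * (q * a * c) ≡ z * a * b * c * (p * q)
      eq₄ = solve-∀

  -- The integer part of the `k`-th root, searched downwards from `d`, where d < d + 1 ≤ (d + 1)^k;
  -- `d ≥ 1` stops the search before 0.
  root : ∀ k d .{{_ : NonZero k}} .{{_ : NonZero d}} → ∃[ M ] NonZero M × M ^ k ≤ d × d < suc M ^ k
  root k d = search d (<-≤-trans (n<1+n d) (subst (_≤ suc d ^ k) (*-identityʳ (suc d)) (^-monoʳ-≤ (suc d) (>-nonZero⁻¹ k))))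
    where
    search : ∀ M → d < suc M ^ k → ∃[ M ] NonZero M × M ^ k ≤ d × d < suc M ^ k
    search zero    d<1 = contradiction (>-nonZero⁻¹ d) (<⇒≱ (subst (d <_) (^-zeroˡ k) d<1))
    search (suc M) d<  with suc M ^ k ≤? d
    ... | yes ≤d = suc M , _ , ≤d , d<
    ... | no  ≰d = search M (≰⇒> ≰d)

open import Defs
open import Data.Integer using (+_)
open import Data.Nat using (ℕ; NonZero; NonTrivial; nonTrivial⇒nonZero; _∸_)
open import Data.Product using (Σ-syntax)
open import Data.Rational.Unnormalised as ℚ using (ℚᵘ; mkℚᵘ; Positive; _/_; *<*; *≤*; *≡*)
open import Data.Integer as ℤ using (-[1+_])
import Data.Integer.Properties as ℤ
open import Data.Nat as ℕ using (suc; _^_)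
import Data.Nat.Properties as ℕ
open import Data.Product using (_,_; proj₁; proj₂)
import Data.Rational.Unnormalised.Properties as ℚ
open Counting using (≤-from-+; i≤μ; count-bound; root)

-- From the counting bound to the inequality of reals.

ℚ-≤ : ∀ {m D m′ D′} → m ℕ.* suc D′ ℕ.≤ m′ ℕ.* suc D → mkℚᵘ (+ m) D ℚ.≤ mkℚᵘ (+ m′) D′
ℚ-≤ {m} {D} {m′} {D′} h = *≤* (subst₂ ℤ._≤_ (ℤ.pos-* m (suc D′)) (ℤ.pos-* m′ (suc D)) (ℤ.+≤+ h))

subtract-back : ∀ x y → (x ℚ.+ y) ℚ.- y ℚ.≃ x
subtract-back x y = ℚ.≃-trans (ℚ.+-assoc x y (ℚ.- y)) (ℚ.≃-trans (ℚ.+-congʳ x (ℚ.+-inverseʳ y)) (ℚ.+-identityʳ x))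

add-back : ∀ x y → (x ℚ.- y) ℚ.+ y ℚ.≃ x
add-back x y = ℚ.≃-trans (ℚ.+-assoc x (ℚ.- y) y) (ℚ.≃-trans (ℚ.+-congʳ x (ℚ.+-inverseˡ y)) (ℚ.+-identityʳ x))

-- From m / D < log₂ x ≤ K / E, read off by raising the hypotheses to the powers `E` and `D`.
log-slope : ∀ x m D E K → 2 ^ m ℕ.< x ^ D → x ^ E ℕ.≤ 2 ^ K → m ℕ.* E ℕ.≤ K ℕ.* D
log-slope x m D E K lt bound = ℕ.≮⇒≥ λ KD<mE → ℕ.<-irrefl refl (begin-strict
  2 ^ (K ℕ.* D)    <⟨ ℕ.^-monoʳ-< 2 (ℕ.n<1+n 1) KD<mE ⟩
  2 ^ (m ℕ.* E)    ≡⟨ ℕ.^-*-assoc 2 m E ⟨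
  (2 ^ m) ^ E      ≤⟨ ℕ.^-monoˡ-≤ E (ℕ.<⇒≤ lt) ⟩
  (x ^ D) ^ E      ≡⟨ trans (ℕ.^-*-assoc x D E) (trans (cong (x ^_) (ℕ.*-comm D E)) (sym (ℕ.^-*-assoc x E D))) ⟩
  (x ^ E) ^ D      ≤⟨ ℕ.^-monoˡ-≤ D bound ⟩
  (2 ^ K) ^ D      ≡⟨ ℕ.^-*-assoc 2 K D ⟩
  2 ^ (K ℕ.* D)    ∎)
  where open ℕ.≤-Reasoning

-- `log-slope` gives the bound k / r + 33 / (r M), and M + 1 ≤ 2 M ≤ r M turns the last term into 33
-- / (M + 1), which is what `mkℚᵘ (+ 33) M` denotes. The equation on `p` restricts the hypothesis to
-- nonnegative rationals; negative ones satisfy the bound trivially.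
rate-bound : ∀ k′ n′ M x p .{{_ : NonZero M}} →
             let k = suc k′; r = suc k; n = suc n′ in
             x ^ (r ℕ.* M) ℕ.≤ 2 ^ (33 ℕ.* n ℕ.+ k ℕ.* n ℕ.* M) →
             (∀ m D → p ≡ mkℚᵘ (+ m) D → 2 ^ m ℕ.< x ^ suc D) →
             + 1 / n ℚ.* p ℚ.≤ + k / r ℚ.+ mkℚᵘ (+ 33) M
rate-bound k′ n′ M x (mkℚᵘ -[1+ m ] D) bound below = *≤* ℤ.-≤+
rate-bound k′ n′ M x (mkℚᵘ (+ m) D)    bound below =
  ℚ.≤-respˡ-≃ (*≡* lhs) (ℚ.≤-respʳ-≃ (*≡* rhs) (ℚ-≤ {m} {D ℕ.+ n′ ℕ.* suc D} {k ℕ.* suc M ℕ.+ 33 ℕ.* r} {M ℕ.+ k ℕ.* suc M} main))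
  where
  k = suc k′
  r = suc k
  n = suc n′
  lhs : + m ℤ.* + (n ℕ.* suc D) ≡ (+ 1 ℤ.* + m) ℤ.* + (n ℕ.* suc D)
  lhs = cong (ℤ._* + (n ℕ.* suc D)) (sym (ℤ.*-identityˡ (+ m)))
  rhs : + (k ℕ.* suc M ℕ.+ 33 ℕ.* r) ℤ.* + (r ℕ.* suc M) ≡ (+ k ℤ.* + suc M ℤ.+ + 33 ℤ.* + r) ℤ.* + (r ℕ.* suc M)
  rhs = cong (ℤ._* + (r ℕ.* suc M)) (cong₂ ℤ._+_ (ℤ.pos-* k (suc M)) (ℤ.pos-* 33 r))
  open ℕ.≤-Reasoning
  main : m ℕ.* (r ℕ.* suc M) ℕ.≤ (k ℕ.* suc M ℕ.+ 33 ℕ.* r) ℕ.* (n ℕ.* suc D)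
  main = ℕ.*-cancelʳ-≤ _ _ M (begin
    m ℕ.* (r ℕ.* suc M) ℕ.* M
      ≡⟨ eq₁ m r M ⟩
    m ℕ.* (r ℕ.* M) ℕ.* suc M
      ≤⟨ ℕ.*-monoˡ-≤ (suc M) (log-slope x m (suc D) (r ℕ.* M) (33 ℕ.* n ℕ.+ k ℕ.* n ℕ.* M) (below m D refl) bound) ⟩
    (33 ℕ.* n ℕ.+ k ℕ.* n ℕ.* M) ℕ.* suc D ℕ.* suc M
      ≡⟨ eq₂ n k M (suc D) ⟩
    n ℕ.* suc D ℕ.* (33 ℕ.* suc M ℕ.+ k ℕ.* suc M ℕ.* M)
      ≤⟨ ℕ.*-monoʳ-≤ (n ℕ.* suc D) (ℕ.+-monoˡ-≤ _ (ℕ.*-monoʳ-≤ 33 (begin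
        1 ℕ.+ M             ≤⟨ ℕ.+-monoˡ-≤ M (ℕ.>-nonZero⁻¹ M) ⟩
        M ℕ.+ M             ≤⟨ ≤-from-+ (k′ ℕ.* M) (eq₃ k′ M) ⟩
        r ℕ.* M             ∎))) ⟩
    n ℕ.* suc D ℕ.* (33 ℕ.* (r ℕ.* M) ℕ.+ k ℕ.* suc M ℕ.* M)
      ≡⟨ eq₄ (n ℕ.* suc D) r M (k ℕ.* suc M) ⟩
    (k ℕ.* suc M ℕ.+ 33 ℕ.* r) ℕ.* (n ℕ.* suc D) ℕ.* M ∎)
    where
    eq₁ : ∀ m r M → m ℕ.* (r ℕ.* suc M) ℕ.* M ≡ m ℕ.* (r ℕ.* M) ℕ.* suc M
    eq₁ = solve-∀
    eq₂ : ∀ n k M D → (33 ℕ.* n ℕ.+ k ℕ.* n ℕ.* M) ℕ.* D ℕ.* suc M ≡ n ℕ.* D ℕ.* (33 ℕ.* suc M ℕ.+ k ℕ.* suc M ℕ.* M)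
    eq₂ = solve-∀
    eq₃ : ∀ k′ M → M ℕ.+ M ℕ.+ k′ ℕ.* M ≡ suc (suc k′) ℕ.* M
    eq₃ = solve-∀
    eq₄ : ∀ x r M y → x ℕ.* (33 ℕ.* (r ℕ.* M) ℕ.+ y ℕ.* M) ≡ (y ℕ.+ 33 ℕ.* r) ℕ.* x ℕ.* M
    eq₄ = solve-∀

theorem8 : Σ[ C ∈ ℚᵘ ] Σ[ C>0 ∈ Positive C ]
    ∀ (r d n : ℕ) .{{_ : NonTrivial r}} .{{_ : NonZero d}} .{{_ : NonZero n}}
    (G : Hypergraph n) →
    Uniform G r → Regular G d → Linear G → NoCrossEdges G →
    let instance
          C-pos = C>0
          r≢0   = nonTrivial⇒nonZero r
          r∸1≢0 = nonTrivial⇒∸1-nonZero r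
          i≢0   = i-nonZero r G
    in
    log₂ (i r G) ÷ℕ n ≤ fromℚ (+ (r ∸ 1) / r) + C · (d ^-1/ (r ∸ 1))
-- 34 rather than 33 makes `p₂<` strict, as the lower cut of a multiple demands.
theorem8 = mkℚᵘ (+ 34) 0 , _ , bound
  where
  bound : ∀ (r d n : ℕ) .{{_ : NonTrivial r}} .{{_ : NonZero d}} .{{_ : NonZero n}}
    (G : Hypergraph n) →
    Uniform G r → Regular G d → Linear G → NoCrossEdges G →
    let instance
          r≢0   = nonTrivial⇒nonZero r
          r∸1≢0 = nonTrivial⇒∸1-nonZero r
          i≢0   = i-nonZero r G
    in
    log₂ (i r G) ÷ℕ n ≤ fromℚ (+ (r ∸ 1) / r) + mkℚᵘ (+ 34) 0 · (d ^-1/ (r ∸ 1))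
  bound r@(suc k@(suc k′)) d n@(suc n′) G uniform regular linear no-cross {q} (p , p<log , q<p/n) =
    -- A lower bound for the sum is a pair of lower bounds: `p₂` is 33 / (M + 1), below 34 times 1 /
    -- (M + 1), where 1 / (M + 1) is below the root since d < (M + 1)^k; density puts `p₁` between
    -- `q − p₂` and `k / r`.
    let p₁ , <p₁ , p₁<k/r = ℚ.<-dense q-p₂< in
    p₁ , p₂ , p₁<k/r , (mkℚᵘ (+ 1) M , root-below , p₂<) , ℚ.<-respˡ-≃ (add-back q p₂) (ℚ.+-monoˡ-< p₂ <p₁)
    where
    M = proj₁ (root k d)
    M^k≤d = proj₁ (proj₂ (proj₂ (root k d)))
    d<[1+M]^k = proj₂ (proj₂ (proj₂ (root k d)))
    p₂ = mkℚᵘ (+ 33) M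
    instance
      M≢0 : NonZero M
      M≢0 = proj₁ (proj₂ (root k d))
    log-bound : i r G ^ (r ℕ.* M) ℕ.≤ 2 ^ (33 ℕ.* n ℕ.+ k ℕ.* n ℕ.* M)
    log-bound = ℕ.≤-trans (ℕ.^-monoˡ-≤ (r ℕ.* M) (i≤μ r G uniform))
      (count-bound G k′ d uniform regular linear no-cross M M^k≤d)
    q< : q ℚ.< + k / r ℚ.+ p₂
    q< = ℚ.<-≤-trans q<p/n (rate-bound k′ n′ M (i r G) p log-bound λ { m D refl → p<log })
    q-p₂< : q ℚ.- p₂ ℚ.< + k / r
    q-p₂< = ℚ.<-respʳ-≃ (subtract-back (+ k / r) p₂) (ℚ.+-monoˡ-< (ℚ.- p₂) q<)
    root-below : 1 ^ k ℕ.* d ℕ.< suc M ^ k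
    root-below = subst (ℕ._< suc M ^ k) (sym (trans (cong (ℕ._* d) (ℕ.^-zeroˡ k)) (ℕ.*-identityˡ d))) d<[1+M]^k
    p₂< : p₂ ℚ.< mkℚᵘ (+ 34) 0 ℚ.* mkℚᵘ (+ 1) M
    p₂< = *<* (subst (λ D → + 33 ℤ.* + D ℤ.< + 34 ℤ.* + suc M) (sym (ℕ.+-identityʳ (suc M)))
      (ℤ.*-monoʳ-<-pos (+ suc M) (ℤ.+<+ (ℕ.n<1+n 33))))
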